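{- $\mathrm{MC}(\times,/)$ is $\mathrm{PL}$-hard under logarithmic-space many-one reductions.
   Context: Natural numbers include $0$. For $A,B\subseteq\mathbb N$: $A\cup B$, $A\cap B$ are the usual operations, $\overline{A}=\mathbb N\setminus A$, $A+B=\{a+b: a\in A, b\in B\}$, $A\times B=\{a\cdot b: a\in A, b\in B\}$, and $A/B=\{c\in\mathbb N:\exists a\in A\ \exists b\in B\setminus\{0\}: a=c\cdot b\}$ (exact integer division without remainder or rounding). For $\emptyset\ne\mathcal O\subseteq\{\cup,\cap,\overline{\phantom{c}},+,\times,/\}$, an $\mathcal O$-circuit $C=(V,E,g_C,\alpha)$ is a finite acyclic directed multigraph with gate set $V\subseteq\mathbb N$, every gate having indegree $0$, $1$ or $2$, a designated output gate $g_C\in V$, and a labeling $\alpha$: gates of indegree $0$ (input gates) are labeled by natural numbers, gates of indegree $1$ are labeled $\overline{\phantom{c}}$ (allowed only if $\overline{\phantom{c}}\in\mathcal O$), and gates of indegree $2$ are labeled by an operation in $\mathcal O\setminus\{\overline{\phantom{c}}\}$. The result set $I(g)\subseteq\mathbb N$ is defined inductively: $I(g)=\{\alpha(g)\}$ for an input gate; $I(g)=\mathbb N\setminus I(p)$ for a complement gate with predecessor $p$; $I(g)=I(g_1)\,\sigma\,I(g_2)$ for a gate labeled $\sigma$ with predecessors $g_1\le g_2$ (a double edge from one gate gives $g_1=g_2$). $I(C)=I(g_C)$. A circuit is encoded as a bit string listing its gates in reverse topological order, each gate as the triple (gate name, label, list of predecessors), with all numbers (including input labels) in binary; $|C|$ denotes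 the length of this encoding. The membership problem is $\mathrm{MC}(\mathcal O)=\{(C,b): C \text{ is an } \mathcal O\text{ -circuit},\ b\in\mathbb N,\ b\in I(C)\}$, with $b$ given in binary; $\mathrm{MC}(\sigma_1,\dots,\sigma_n)$ abbreviates $\mathrm{MC}(\{\sigma_1,\dots,\sigma_n\})$. $\mathrm{PL}$ is the class of languages accepted by probabilistic Turing machines running in polynomial time and logarithmic space with acceptance probability strictly greater than $1/2$. -}

module Defs where

open import Data.Bool using (Bool; true; false; _∧_; if_then_else_; T)
open import Data.Fin using (Fin)
open import Data.Fin.Induction using (spo-wellFounded)
open import Data.List using (List; []; _∷_; _++_; length; map; concatMap; reverse; allFin; foldl)
open import Data.List.Membership.Propositional using () renaming (_∈_ to _∈ˡ_)
open import Data.List.Relation.Binary.Permutation.Propositional using (_↭_)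
open import Data.List.Relation.Unary.AllPairs using (AllPairs)
open import Data.List.Relation.Unary.Any using (here; there)
open import Data.Maybe using (Maybe; just; nothing)
open import Data.Nat using (ℕ; zero; suc; pred; _+_; _*_; _^_; _⊓_; _≤_; _≤?_)
open import Data.Nat.Logarithm using (⌊log₂_⌋)
open import Data.Product using (Σ-syntax; ∃-syntax; _×_; _,_)
open import Data.Rational as ℚ using (ℚ; 0ℚ; 1ℚ; ½)
open import Data.Unit using (⊤; tt)
open import Data.Vec as Vec using (Vec)
open import Function using (_⇔_; _↔_; Injective)
open import Induction.WellFounded using (Acc; acc; WellFounded)
open import Level using (0ℓ)
open import Relation.Binary.Construct.Closure.Transitive as Plus using (TransClosure)
open import Relation.Binary.PropositionalEquality using (_≡_; _≢_; refl; isEquivalence; resp₂)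
open import Relation.Nullary using (¬_; does)
open import Relation.Unary using (Pred; _∈_; _∪_; _∩_; ∁; ｛_｝)

Word : Set
Word = List Bool

Language : Set₁
Language = Pred Word 0ℓ

------------------------------------------------------------------------
-- Turing machines

Finite : Set → Set
Finite A = ∃[ n ] (A ↔ Fin n)

data Move : Set where
  left stay right : Move

data InputSymbol : Set where
  ⊢ ⊣ : InputSymbol
  bit : Bool → InputSymbol

-- Position 0 holds ⊢, positions 1 … |x| hold x, position |x|+1 holds ⊣.
readInput : Word → ℕ → InputSymbol
readInput x       zero          = ⊢
readInput []      (suc i)       = ⊣
readInput (b ∷ x) (suc zero)    = bit b
readInput (b ∷ x) (suc (suc i)) = readInput x (suc i)

moveInput : Word → Move → ℕ → ℕ
moveInput x left  i = pred i
moveInput x stay  i = i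
moveInput x right i = suc i ⊓ suc (length x)

-- The visited part of a two-way infinite tape; the cells on either side
-- are listed starting next to the head.
record Tape (Γ : Set) : Set where
  constructor tape
  field
    before  : List Γ
    current : Γ
    after   : List Γ

module _ {Γ : Set} (blank : Γ) where

  moveTape : Move → Tape Γ → Tape Γ
  moveTape stay  t                      = t
  moveTape left  (tape []       a rs)   = tape [] blank (a ∷ rs)
  moveTape left  (tape (l ∷ ls) a rs)   = tape ls l (a ∷ rs)
  moveTape right (tape ls a [])         = tape (a ∷ ls) blank []
  moveTape right (tape ls a (r ∷ rs))   = tape (a ∷ ls) r rs

  writeMove : Γ × Move → Tape Γ → Tape Γ
  writeMove (b , m) (tape ls a rs) = moveTape m (tape ls b rs)

tapeSize : {Γ : Set} → Tape Γ → ℕ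
tapeSize (tape ls a rs) = length ls + suc (length rs)

-- Machines with a read-only input tape and a fixed number of work tapes.
-- Each step additionally consumes an R (a coin flip, or nothing of
-- interest) and produces a W (output, or nothing of interest).
record Machine (R W : Set) : Set₁ where
  field
    State       : Set
    stateFinite : Finite State
    Γ           : Set
    ΓFinite     : Finite Γ
    blank       : Γ
    tapes       : ℕ
    start       : State
    halting     : State → Bool
    δ           : State → InputSymbol → Vec Γ tapes → R →
                  State × Move × Vec (Γ × Move) tapes × W

  record Config : Set where
    constructor config
    field
      state : State
      head  : ℕ
      work  : Vec (Tape Γ) tapes

  open Config public

  initial : Config
  initial = config start 0 (Vec.replicate tapes (tape [] blank []))

  Halted : Config → Set
  Halted c = T (halting (state c))

  space : Config → ℕ
  space c = Vec.sum (Vec.map tapeSize (work c))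

  action : Word → Config → R → State × Move × Vec (Γ × Move) tapes × W
  action x c = δ (state c) (readInput x (head c)) (Vec.map Tape.current (work c))

  step : Word → Config → R → Config
  step x c r with halting (state c)
  ... | true  = c
  ... | false = let (q , m , as , _) = action x c r in
                config q (moveInput x m (head c))
                       (Vec.zipWith (writeMove blank) as (work c))

  emit : Word → Config → R → Maybe W
  emit x c r with halting (state c)
  ... | true  = nothing
  ... | false = let (_ , _ , _ , w) = action x c r in just w

  run : Word → Config → List R → Config
  run x = foldl (step x)

  -- Logarithmic space on every computation, over all sequences of Rs.
  LogSpace : Set
  LogSpace = ∃[ c ] ∀ (x : Word) (rs : List R) →
             space (run x initial rs) ≤ c * ⌊log₂ length x ⌋ + c

------------------------------------------------------------------------
-- Logarithmic-space many-one reductions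

Transducer : Set₁
Transducer = Machine ⊤ (Maybe Bool)

module _ (M : Transducer) where
  open Machine M

  runFor : Word → ℕ → Config
  runFor x zero    = initial
  runFor x (suc t) = step x (runFor x t) tt

  emitted : Maybe (Maybe Bool) → Word
  emitted (just (just b)) = b ∷ []
  emitted _               = []

  outputFor : Word → ℕ → Word
  outputFor x zero    = []
  outputFor x (suc t) = outputFor x t ++ emitted (emit x (runFor x t) tt)

  Computes : (Word → Word) → Set
  Computes f = ∀ x → ∃[ t ] (Halted (runFor x t) × outputFor x t ≡ f x)

LogSpaceComputable : (Word → Word) → Set₁
LogSpaceComputable f = Σ[ M ∈ Transducer ] (Computes M f × Machine.LogSpace M)

infix 4 _≤ₘˡᵒᵍ_

_≤ₘˡᵒᵍ_ : Language → Language → Set₁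
A ≤ₘˡᵒᵍ B = Σ[ f ∈ (Word → Word) ] (LogSpaceComputable f × (∀ x → x ∈ A ⇔ f x ∈ B))

------------------------------------------------------------------------
-- Probabilistic machines and PL

record ProbabilisticMachine : Set₁ where
  field
    machine   : Machine Bool ⊤
    accepting : Machine.State machine → Bool

  open Machine machine public

  -- The probability that M, started in the given configuration and
  -- flipping a fair coin in each step, accepts within t steps.
  acceptProb : Word → Config → ℕ → ℚ
  acceptProb x c zero    = if halting (state c) ∧ accepting (state c) then 1ℚ else 0ℚ
  acceptProb x c (suc t) =
    ½ ℚ.* (acceptProb x (step x c false) t ℚ.+ acceptProb x (step x c true) t)

record PL (L : Language) : Set₁ where
  field
    M : ProbabilisticMachine

  open ProbabilisticMachine M public

  field
    coeff degree : ℕ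

  time : ℕ → ℕ
  time n = coeff * n ^ degree + coeff

  field
    polyTime : ∀ (x : Word) (coins : List Bool) → length coins ≡ time (length x) →
               Halted (run x initial coins)
    logSpace : LogSpace
    correct  : ∀ (x : Word) → x ∈ L ⇔ acceptProb x initial (time (length x)) ℚ.> ½

PLHard : Language → Set₁
PLHard B = ∀ (L : Language) → PL L → L ≤ₘˡᵒᵍ B

------------------------------------------------------------------------
-- Sets of natural numbers

_⊕_ _⊗_ _⊘_ : Pred ℕ 0ℓ → Pred ℕ 0ℓ → Pred ℕ 0ℓ
(A ⊕ B) n = ∃[ a ] ∃[ b ] (a ∈ A × b ∈ B × n ≡ a + b)
(A ⊗ B) n = ∃[ a ] ∃[ b ] (a ∈ A × b ∈ B × n ≡ a * b)
(A ⊘ B) c = ∃[ a ] ∃[ b ] (a ∈ A × b ∈ B × b ≢ 0 × a ≡ c * b)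

------------------------------------------------------------------------
-- Circuits

data BinaryOp : Set where
  union intersection plus times divide : BinaryOp

data Op : Set where
  complement : Op
  binary     : BinaryOp → Op

apply : BinaryOp → Pred ℕ 0ℓ → Pred ℕ 0ℓ → Pred ℕ 0ℓ
apply union        A B = A ∪ B
apply intersection A B = A ∩ B
apply plus         A B = A ⊕ B
apply times        A B = A ⊗ B
apply divide       A B = A ⊘ B

-- A gate's label together with its incoming edges, given by their
-- sources.  The order of the two sources of a combining gate is irrelevant:
-- operands are ordered by gate name (see evalGate).
data Gate (O : Pred Op 0ℓ) (V : Set) : Set where
  input   : ℕ → Gate O V
  negate  : complement ∈ O → V → Gate O V
  combine : (σ : BinaryOp) → binary σ ∈ O → V → V → Gate O V

preds : ∀ {O V} → Gate O V → List V
preds (input a)         = []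
preds (negate _ p)      = p ∷ []
preds (combine _ _ p q) = p ∷ q ∷ []

Edge : ∀ {O V} → (V → Gate O V) → V → V → Set
Edge gate p g = p ∈ˡ preds (gate g)

-- The gate set is the image of name, a finite subset of ℕ.
record Circuit (O : Pred Op 0ℓ) : Set where
  field
    size           : ℕ
    name           : Fin size → ℕ
    name-injective : Injective _≡_ _≡_ name
    gate           : Fin size → Gate O (Fin size)
    output         : Fin size
    acyclic        : ∀ {g} → ¬ TransClosure (Edge gate) g g

  infix 4 _⟶_ _⟶⁺_

  _⟶_ _⟶⁺_ : Fin size → Fin size → Set
  _⟶_  = Edge gate
  _⟶⁺_ = TransClosure _⟶_

  ⟶-wellFounded : WellFounded _⟶_
  ⟶-wellFounded = Plus.wellFounded⁻ _⟶_ (spo-wellFounded record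
    { isEquivalence = isEquivalence
    ; irrefl        = λ { refl → acyclic }
    ; trans         = Plus.transitive _⟶_
    ; <-resp-≈      = resp₂ _⟶⁺_
    })

  evalGate : (γ : Gate O (Fin size)) → (∀ p → p ∈ˡ preds γ → Pred ℕ 0ℓ) → Pred ℕ 0ℓ
  evalGate (input a)         I = ｛ a ｝
  evalGate (negate _ p)      I = ∁ (I p (here refl))
  evalGate (combine σ _ p q) I =
    if does (name p ≤? name q) then apply σ P Q else apply σ Q P
    where
    P = I p (here refl)
    Q = I q (there (here refl))

  resultAcc : (g : Fin size) → Acc _⟶_ g → Pred ℕ 0ℓ
  resultAcc g (acc rs) = evalGate (gate g) (λ p p⟶g → resultAcc p (rs p⟶g))

  result : Fin size → Pred ℕ 0ℓ
  result g = resultAcc g (⟶-wellFounded g)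

  I[C] : Pred ℕ 0ℓ
  I[C] = result output

  -- Each gate is listed exactly once, before all of its predecessors.
  ReverseTopological : List (Fin size) → Set
  ReverseTopological gs = gs ↭ allFin size × AllPairs (λ g h → ¬ (g ⟶ h)) gs

------------------------------------------------------------------------
-- Encoding

increment : List Bool → List Bool
increment []           = true ∷ []
increment (false ∷ bs) = true ∷ bs
increment (true ∷ bs)  = false ∷ increment bs

binaryLSB : ℕ → List Bool
binaryLSB zero    = false ∷ []
binaryLSB (suc n) = increment (binaryLSB n)

toBinary : ℕ → List Bool
toBinary n = reverse (binaryLSB n)

data Token : Set where
  digit           : Bool → Token
  comma semicolon : Token
  op              : Op → Token

tokenBits : Token → Word
tokenBits (digit b)                  = false ∷ false ∷ false ∷ b     ∷ []
tokenBits comma                      = false ∷ false ∷ true  ∷ false ∷ []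
tokenBits semicolon                  = false ∷ false ∷ true  ∷ true  ∷ []
tokenBits (op complement)            = true  ∷ false ∷ false ∷ false ∷ []
tokenBits (op (binary union))        = true  ∷ false ∷ false ∷ true  ∷ []
tokenBits (op (binary intersection)) = true  ∷ false ∷ true  ∷ false ∷ []
tokenBits (op (binary plus))         = true  ∷ false ∷ true  ∷ true  ∷ []
tokenBits (op (binary times))        = true  ∷ true  ∷ false ∷ false ∷ []
tokenBits (op (binary divide))       = true  ∷ true  ∷ false ∷ true  ∷ []

number : ℕ → List Token
number n = map digit (toBinary n)

labelTokens : ∀ {O V} → Gate O V → List Token
labelTokens (input a)         = number a
labelTokens (negate _ _)      = op complement ∷ []
labelTokens (combine σ _ _ _) = op (binary σ) ∷ []

module _ {O : Pred Op 0ℓ} (C : Circuit O) where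
  open Circuit C

  gateTokens : Fin size → List Token
  gateTokens g =
    number (name g) ++ comma ∷ labelTokens (gate g) ++
    concatMap (λ p → comma ∷ number (name p)) (preds (gate g)) ++ semicolon ∷ []

  -- The name of the output gate is written in front of the gate list.
  circuitTokens : List (Fin size) → List Token
  circuitTokens gs = number (name output) ++ semicolon ∷ concatMap gateTokens gs

  encode : List (Fin size) → ℕ → Word
  encode gs b = concatMap tokenBits (circuitTokens gs ++ number b)

MC : Pred Op 0ℓ → Language
MC O w = Σ[ C ∈ Circuit O ] ∃[ gs ] ∃[ b ]
         (Circuit.ReverseTopological C gs × w ≡ encode C gs b × b ∈ Circuit.I[C] C)

{-# OPTIONS --safe #-}

-- A configuration with r + 1 steps to go has as many accepting computations as its two successors, with r steps
-- to go, have together.  So if a gate for every point of time and every configuration of logarithmic size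
-- multiplies the values of the gates of the two successors, it computes 2^a, where a is the number of accepting
-- computations.  More than half of the 2^r computations accept if and only if 2^(2a) is a multiple of
-- 2^(2^r + 1); the power 2^(2^r) is provided by an additional configuration all of whose computations accept.
-- Since the quotient is a singleton or empty, multiplying it by {0} leaves {0} or ∅, so 0 is the number to test.
--
-- Gates are named by bit strings coding time, head position and tape contents.  A transducer lists them by
-- counting through all strings of the right length, whether they code reachable configurations or not; as a
-- step of the machine changes its configuration only locally, the names of the successors can be written in
-- single passes over the tape.

module Submission where

open import Defs
open import Data.Bool using (Bool; true; false; not; _∧_; if_then_else_; T)
open import Data.Empty using (⊥-elim)
open import Data.Fin using (Fin; zero; suc; toℕ; fromℕ; inject₁)
open import Data.Fin.Properties using (1↔⊤; 2↔Bool; +↔⊎; *↔×; toℕ-inject₁; toℕ-fromℕ; toℕ<n; toℕ-injective)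
open import Data.List as List using (List; []; _∷_; _++_; length; map; reverse; replicate; upTo; concatMap;
  _ʳ++_; applyUpTo; cartesianProduct; lookup; allFin)
open import Data.List.Membership.Propositional using () renaming (_∈_ to _∈ˡ_)
open import Data.List.Membership.Propositional.Properties using (∈-map⁺; ∈-upTo⁺; ∈-lookup; ∈-map⁻; ∈-++⁺ˡ;
  ∈-++⁺ʳ; ∈-cartesianProduct⁺; ∈-cartesianProduct⁻; ∈-allFin)
open import Data.List.Properties using (++-assoc; ++-identityʳ; length-++; length-replicate;
  reverse-involutive; unfold-reverse; reverse-injective; ∷-injective; ∷-injectiveʳ; length-map; ʳ++-defn;
  reverse-map; map-++; concatMap-++; ++-ʳ++; concatMap-cong; concatMap-map; map-injective; map-∘; map-cong;
  map-tabulate; tabulate-lookup; ∷-injectiveˡ; foldl-++)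
open import Data.List.Relation.Binary.Permutation.Propositional using (↭-refl; ↭-sym)
open import Data.List.Relation.Binary.Permutation.Propositional.Properties using (∈-resp-↭)
open import Data.List.Relation.Unary.All as All using (All; []; _∷_)
open import Data.List.Relation.Unary.AllPairs as AllPairs using (AllPairs; []; _∷_)
open import Data.List.Relation.Unary.Any as Any using (here; there)
open import Data.List.Relation.Unary.Any.Properties using (lookup-index)
open import Data.List.Relation.Unary.Unique.Propositional using (Unique)
open import Data.Maybe as Maybe using (Maybe; just; nothing)
open import Data.Nat using (ℕ; zero; suc; _+_; _*_; _≤_; _≤?_; z≤n; s≤s; _^_; _<_; pred; _⊓_; _∸_; _≤ᵇ_)
open import Data.Nat.Logarithm using (⌊log₂_⌋; ⌊log₂⌋-mono-≤; ⌊log₂[2^n]⌋≡n)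
open import Data.Nat.Properties
open import Data.Product using (Σ-syntax; ∃-syntax; _×_; _,_; proj₁; proj₂)
open import Data.Product.Function.NonDependent.Propositional using (_×-↔_)
open import Data.Rational as ℚ using (ℚ; 0ℚ; 1ℚ; ½)
open import Data.Sum using (_⊎_; inj₁; inj₂)
open import Data.Sum.Function.Propositional using (_⊎-↔_)
open import Data.Sum.Properties using (inj₁-injective; inj₂-injective)
open import Data.Unit using (⊤; tt)
open import Data.Vec as Vec using (Vec; []; _∷_)
open import Data.Vec.Properties using (lookup-zipWith; lookup-map; map-replicate; tabulate∘lookup; tabulate-cong)
open import Function using (_↔_; mk↔ₛ′; _∘_; _⇔_; mk⇔; Equivalence; Inverse)
open import Function.Construct.Composition using (_⇔-∘_)
open import Function.Construct.Symmetry using (⇔-sym)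
open import Function.Properties.Inverse using (↔-trans; ↔-sym; ↔-refl)
open import Induction.WellFounded using (Acc; acc)
open import Level using (0ℓ)
open import Relation.Binary.Construct.Closure.Transitive using (TransClosure; [_]; _∷_)
open import Relation.Binary.Definitions using (tri<; tri≈; tri>)
open import Relation.Binary.PropositionalEquality hiding ([_])
open import Relation.Nullary using (¬_; does)
open import Relation.Unary using (Pred; _∈_; ｛_｝; _∪_)
import Data.List.Relation.Unary.All.Properties as All
import Data.List.Relation.Unary.AllPairs.Properties as AllPairs
import Data.List.Relation.Unary.Unique.Propositional.Properties as Unique
import Data.Rational.Properties as ℚ
import Data.Vec.Properties as Vec

-- The exponent r is not the running time of the machine but the largest clock value that the row of
-- cells can express, so the transducer never evaluates a time bound. This is harmless because
-- halted configurations stay fixed: extra coin flips multiply the number of accepting computations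
-- and the number of all computations by the same power of 2. The row has `suc K` cells for each
-- binary digit of the input length, with `K` so large that clock, head position and tape contents
-- fit; counting the input symbols lays it out.
--
-- Strings that code nothing reachable receive gates so that every predecessor that is named exists;
-- the clock alone makes the circuit acyclic.
--
-- Membership asserts that some circuit with the given encoding produces the number. To conclude
-- from membership back to acceptance, every circuit with that encoding must be evaluated, not only
-- the intended one. Hence the encoding is shown to be uniquely readable, and gates are evaluated
-- from names, labels and names of predecessors alone. Names also decide which operand of a quotient
-- is the dividend, so the numerator has to be named by a smaller number than the denominator.

finite-via : ∀ {A B : Set} → A ↔ B → Finite B → Finite A
finite-via f (n , g) = n , ↔-trans f g

⊤-finite : Finite ⊤
⊤-finite = 1 , ↔-sym 1↔⊤

Bool-finite : Finite Bool
Bool-finite = 2 , ↔-sym 2↔Bool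

Fin-finite : ∀ n → Finite (Fin n)
Fin-finite n = n , ↔-refl

⊎-finite : ∀ {A B : Set} → Finite A → Finite B → Finite (A ⊎ B)
⊎-finite (m , f) (n , g) = m + n , ↔-trans (f ⊎-↔ g) (↔-sym +↔⊎)

×-finite : ∀ {A B : Set} → Finite A → Finite B → Finite (A × B)
×-finite (m , f) (n , g) = m * n , ↔-trans (f ×-↔ g) (↔-sym *↔×)

Maybe-finite : ∀ {A : Set} → Finite A → Finite (Maybe A)
Maybe-finite fin = finite-via
  (mk↔ₛ′ (λ { nothing → inj₁ tt ; (just a) → inj₂ a })
         (λ { (inj₁ tt) → nothing ; (inj₂ a) → just a })
         (λ { (inj₁ tt) → refl ; (inj₂ a) → refl })
         (λ { nothing → refl ; (just a) → refl }))
  (⊎-finite ⊤-finite fin)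

Vec-finite : ∀ {A : Set} → Finite A → ∀ n → Finite (Vec A n)
Vec-finite fin zero    = finite-via
  (mk↔ₛ′ (λ _ → tt) (λ _ → []) (λ _ → refl) (λ { [] → refl })) ⊤-finite
Vec-finite fin (suc n) = finite-via
  (mk↔ₛ′ Vec.uncons (λ (a , v) → a ∷ v) (λ _ → refl) (λ { (a ∷ v) → refl }))
  (×-finite fin (Vec-finite fin n))

-- Structured programs for transducers with one work tape, and their compilation.

module Programs (Reg Sym : Set) where

  infixr 4 _⨾_
  infix 5 when_thenₚ_elseₚ_

  Action : Set
  Action = Reg → InputSymbol → Sym → Reg × Move × (Sym × Move) × Maybe Bool

  Test : Set
  Test = Reg → InputSymbol → Sym → Bool

  data Prog : Set where
    act          : Action → Prog
    _⨾_          : Prog → Prog → Prog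
    when_thenₚ_elseₚ_ : Test → Prog → Prog → Prog
    while        : Test → Prog → Prog

  -- The control states of a program. A test occupies a state of its own, where the machine branches
  -- without acting.
  Loc : Prog → Set
  Loc (act _)              = ⊤
  Loc (p ⨾ q)              = Loc p ⊎ Loc q
  Loc (when _ thenₚ p elseₚ q) = ⊤ ⊎ (Loc p ⊎ Loc q)
  Loc (while _ p)          = ⊤ ⊎ Loc p

  Loc-finite : ∀ p → Finite (Loc p)
  Loc-finite (act _)              = ⊤-finite
  Loc-finite (p ⨾ q)              = ⊎-finite (Loc-finite p) (Loc-finite q)
  Loc-finite (when _ thenₚ p elseₚ q) = ⊎-finite ⊤-finite (⊎-finite (Loc-finite p) (Loc-finite q))
  Loc-finite (while _ p)          = ⊎-finite ⊤-finite (Loc-finite p)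

  entry : ∀ p → Loc p
  entry (act _)              = tt
  entry (p ⨾ q)              = inj₁ (entry p)
  entry (when _ thenₚ p elseₚ q) = inj₁ tt
  entry (while _ p)          = inj₁ tt

  orElse : ∀ {A B : Set} → (A → B) → Maybe B → Maybe A → Maybe B
  orElse f b nothing  = b
  orElse f b (just a) = just (f a)

  branch : ∀ {A : Set} → A → A → Bool → A
  branch a b true  = a
  branch a b false = b

  -- The location after the current step; nothing means that the program is left.
  next : ∀ p → Loc p → Reg → InputSymbol → Sym → Maybe (Loc p)
  next (act _)              _               r i s = nothing
  next (p ⨾ q)              (inj₁ l)        r i s = orElse inj₁ (just (inj₂ (entry q))) (next p l r i s)
  next (p ⨾ q)              (inj₂ l)        r i s = orElse inj₂ nothing (next q l r i s)
  next (when t thenₚ p elseₚ q) (inj₁ _)        r i s =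
    just (inj₂ (branch (inj₁ (entry p)) (inj₂ (entry q)) (t r i s)))
  next (when t thenₚ p elseₚ q) (inj₂ (inj₁ l)) r i s = orElse (inj₂ ∘ inj₁) nothing (next p l r i s)
  next (when t thenₚ p elseₚ q) (inj₂ (inj₂ l)) r i s = orElse (inj₂ ∘ inj₂) nothing (next q l r i s)
  next (while t p)          (inj₁ _)        r i s = branch (just (inj₂ (entry p))) nothing (t r i s)
  next (while t p)          (inj₂ l)        r i s = orElse inj₂ (just (inj₁ tt)) (next p l r i s)

  idle : Action
  idle r i s = r , stay , (s , stay) , nothing

  action : ∀ p → Loc p → Action
  action (act a)              _               = a
  action (p ⨾ q)              (inj₁ l)        = action p l
  action (p ⨾ q)              (inj₂ l)        = action q l
  action (when t thenₚ p elseₚ q) (inj₁ _)        = idle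
  action (when t thenₚ p elseₚ q) (inj₂ (inj₁ l)) = action p l
  action (when t thenₚ p elseₚ q) (inj₂ (inj₂ l)) = action q l
  action (while t p)          (inj₁ _)        = idle
  action (while t p)          (inj₂ l)        = action p l

  record Store : Set where
    constructor ⟨_,_,_⟩
    field
      reg  : Reg
      head : ℕ
      work : Tape Sym

  open Store public

  outputBit : Maybe Bool → Word
  outputBit (just b) = b ∷ []
  outputBit nothing  = []

  module Execution (blank : Sym) (x : Word) where

    view : ∀ {A : Set} → (Reg → InputSymbol → Sym → A) → Store → A
    view f σ = f (reg σ) (readInput x (head σ)) (Tape.current (work σ))

    perform : Action → Store → Store
    perform a σ = let (r , m , wm , _) = view a σ in
      ⟨ r , moveInput x m (head σ) , writeMove blank wm (work σ) ⟩

    written : Action → Store → Word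
    written a σ = outputBit (proj₂ (proj₂ (proj₂ (view a σ))))

    -- Derivations are finite and end with `leave`, so termination is part of every statement about
    -- a program. Starting from an arbitrary location permits induction over the rest of an
    -- execution.
    data Exec (p : Prog) : Loc p → Store → Word → Store → Set where
      leave : ∀ {l σ} → view (next p l) σ ≡ nothing →
              Exec p l σ (written (action p l) σ) (perform (action p l) σ)
      goto  : ∀ {l l′ σ w σ′} → view (next p l) σ ≡ just l′ →
              Exec p l′ (perform (action p l) σ) w σ′ →
              Exec p l σ (written (action p l) σ ++ w) σ′

    infix 3 _∶_⇒_∣_

    _∶_⇒_∣_ : Prog → Store → Store → Word → Set
    p ∶ σ ⇒ σ′ ∣ w = Exec p (entry p) σ w σ′

    emits≡ : ∀ {p l σ σ′ w w′} → w ≡ w′ → Exec p l σ w σ′ → Exec p l σ w′ σ′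
    emits≡ refl e = e

    ends≡ : ∀ {p l σ σ′ σ″ w} → σ′ ≡ σ″ → Exec p l σ w σ′ → Exec p l σ w σ″
    ends≡ refl e = e

    act-exec : ∀ {a} σ → act a ∶ σ ⇒ perform a σ ∣ written a σ
    act-exec σ = leave refl

    -- The execution of `p` is followed from location to location; the step that would leave `p`
    -- becomes a jump to the entry of `q`.
    seq-left : ∀ {p q l σ w σ′ w′ σ″} → Exec p l σ w σ′ → q ∶ σ′ ⇒ σ″ ∣ w′ →
               Exec (p ⨾ q) (inj₁ l) σ (w ++ w′) σ″
    seq-left {q = q} (leave e) f = goto (cong (orElse inj₁ (just (inj₂ (entry q)))) e) (seq-right f)
      where
      seq-right : ∀ {p q l σ w σ′} → Exec q l σ w σ′ → Exec (p ⨾ q) (inj₂ l) σ w σ′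
      seq-right (leave e)  = leave (cong (orElse inj₂ nothing) e)
      seq-right (goto e f) = goto (cong (orElse inj₂ nothing) e) (seq-right f)
    seq-left {p} {q} (goto {l} {σ = σ} {w = w} e f) g =
      emits≡ (sym (++-assoc (written (action p l) σ) w _))
        (goto (cong (orElse inj₁ (just (inj₂ (entry q)))) e) (seq-left f g))

    infixr 4 _⨾ₑ_

    _⨾ₑ_ : ∀ {p q σ w σ′ w′ σ″} → p ∶ σ ⇒ σ′ ∣ w → q ∶ σ′ ⇒ σ″ ∣ w′ → (p ⨾ q) ∶ σ ⇒ σ″ ∣ w ++ w′
    _⨾ₑ_ = seq-left

    if-true : ∀ {t p q σ w σ′} → view t σ ≡ true → p ∶ σ ⇒ σ′ ∣ w → when t thenₚ p elseₚ q ∶ σ ⇒ σ′ ∣ w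
    if-true {p = p} {q} e f =
      goto (cong (λ b → just (inj₂ (branch (inj₁ (entry p)) (inj₂ (entry q)) b))) e) (lift f)
      where
      lift : ∀ {t p q l σ w σ′} → Exec p l σ w σ′ → Exec (when t thenₚ p elseₚ q) (inj₂ (inj₁ l)) σ w σ′
      lift (leave e)  = leave (cong (orElse _ nothing) e)
      lift (goto e f) = goto (cong (orElse _ nothing) e) (lift f)

    if-false : ∀ {t p q σ w σ′} → view t σ ≡ false → q ∶ σ ⇒ σ′ ∣ w → when t thenₚ p elseₚ q ∶ σ ⇒ σ′ ∣ w
    if-false {p = p} {q} e f =
      goto (cong (λ b → just (inj₂ (branch (inj₁ (entry p)) (inj₂ (entry q)) b))) e) (lift f)
      where
      lift : ∀ {t p q l σ w σ′} → Exec q l σ w σ′ → Exec (when t thenₚ p elseₚ q) (inj₂ (inj₂ l)) σ w σ′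
      lift (leave e)  = leave (cong (orElse _ nothing) e)
      lift (goto e f) = goto (cong (orElse _ nothing) e) (lift f)

    while-false : ∀ {t p σ} → view t σ ≡ false → while t p ∶ σ ⇒ σ ∣ []
    while-false {p = p} e = leave (cong (branch (just (inj₂ (entry p))) nothing) e)

    while-true : ∀ {t p σ w σ′ w′ σ″} → view t σ ≡ true → p ∶ σ ⇒ σ′ ∣ w → while t p ∶ σ′ ⇒ σ″ ∣ w′ →
                 while t p ∶ σ ⇒ σ″ ∣ w ++ w′
    while-true {p = p} e f g = goto (cong (branch (just (inj₂ (entry p))) nothing) e) (lift f g)
      where
      lift : ∀ {t p l σ w σ′ w′ σ″} → Exec p l σ w σ′ → while t p ∶ σ′ ⇒ σ″ ∣ w′ →
             Exec (while t p) (inj₂ l) σ (w ++ w′) σ″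
      lift (leave e)          g = goto (cong (orElse inj₂ (just (inj₁ tt))) e) g
      lift {p = p} (goto {l} {σ = σ} {w = w} e f) g =
        emits≡ (sym (++-assoc (written (action p l) σ) w _)) (goto (cong (orElse inj₂ (just (inj₁ tt))) e) (lift f g))

  module Compile (blank : Sym) (Reg-finite : Finite Reg) (Sym-finite : Finite Sym) (r₀ : Reg)
                 (p : Prog) where

    transducer : Transducer
    transducer = record
      { State       = Maybe (Loc p) × Reg
      ; stateFinite = ×-finite (Maybe-finite (Loc-finite p)) Reg-finite
      ; Γ           = Sym
      ; ΓFinite     = Sym-finite
      ; blank       = blank
      ; tapes       = 1
      ; start       = just (entry p) , r₀
      ; halting     = λ { (nothing , _) → true ; (just _ , _) → false }
      ; δ           = δ
      }
      where
      δ : Maybe (Loc p) × Reg → InputSymbol → Vec Sym 1 → ⊤ →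
          (Maybe (Loc p) × Reg) × Move × Vec (Sym × Move) 1 × Maybe Bool
      δ (nothing , r) i (s ∷ []) _ = (nothing , r) , stay , (s , stay) ∷ [] , nothing
      δ (just l , r)  i (s ∷ []) _ =
        let (r′ , m , wm , b) = action p l r i s in (next p l r i s , r′) , m , wm ∷ [] , b

    private module M = Machine transducer

    conf : Maybe (Loc p) → Store → M.Config
    conf l ⟨ r , h , t ⟩ = M.config (l , r) h (t ∷ [])

    σ₀ : Store
    σ₀ = ⟨ r₀ , 0 , tape [] blank [] ⟩

    module _ (x : Word) where

      open Execution blank x

      emitted-written : ∀ a → emitted transducer (just a) ≡ outputBit a
      emitted-written (just b) = refl
      emitted-written nothing  = refl

      -- Each constructor of `Exec` is one step of the transducer. The time `t` is arbitrary so that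
      -- the induction can resume after every `goto`.
      exec-run : ∀ {l σ w σ′} t → Exec p l σ w σ′ → runFor transducer x t ≡ conf (just l) σ →
                 ∃[ t′ ] (runFor transducer x t′ ≡ conf nothing σ′ ×
                          outputFor transducer x t′ ≡ outputFor transducer x t ++ w)
      exec-run {l} {σ} t (leave e) eq = suc t
        , trans (cong (λ c → M.step x c tt) eq) (cong (λ l′ → conf l′ (perform (action p l) σ)) e)
        , cong (outputFor transducer x t ++_)
            (trans (cong (λ c → emitted transducer (M.emit x c tt)) eq) (emitted-written _))
      exec-run {l} {σ} t (goto {w = w} e f) eq
        with exec-run (suc t) f
               (trans (cong (λ c → M.step x c tt) eq) (cong (λ l′ → conf l′ (perform (action p l) σ)) e))
      ... | t′ , run≡ , out≡ = t′ , run≡ , trans out≡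
        (trans (cong (λ v → (outputFor transducer x t ++ v) ++ w)
                 (trans (cong (λ c → emitted transducer (M.emit x c tt)) eq) (emitted-written _)))
               (++-assoc (outputFor transducer x t) _ w))

      moveTape-size : ∀ m (t : Tape Sym) → tapeSize t ≤ tapeSize (moveTape blank m t)
      moveTape-size stay  t                    = ≤-refl
      moveTape-size left  (tape []       a rs) = n≤1+n _
      moveTape-size left  (tape (l ∷ ls) a rs) = ≤-reflexive (sym (+-suc (length ls) _))
      moveTape-size right (tape ls a [])       = n≤1+n _
      moveTape-size right (tape ls a (r ∷ rs)) = ≤-reflexive (+-suc (length ls) _)

      step-space : ∀ c → M.space c ≤ M.space (M.step x c tt)
      step-space (M.config (nothing , r) h (t ∷ []))            = ≤-refl
      step-space (M.config (just l , r)  h (tape ls a rs ∷ [])) =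
        +-monoˡ-≤ 0 (moveTape-size (proj₂ wm) (tape ls (proj₁ wm) rs))
        where wm = proj₁ (proj₂ (proj₂ (action p l r (readInput x h) a)))

      runFor-space-≤ : ∀ d t → M.space (runFor transducer x t) ≤ M.space (runFor transducer x (d + t))
      runFor-space-≤ zero    t = ≤-refl
      runFor-space-≤ (suc d) t = ≤-trans (runFor-space-≤ d t) (step-space (runFor transducer x (d + t)))

      halted-fixed : ∀ {σ t} d → runFor transducer x t ≡ conf nothing σ →
                     runFor transducer x (d + t) ≡ conf nothing σ
      halted-fixed zero    eq = eq
      halted-fixed (suc d) eq = cong (λ c → M.step x c tt) (halted-fixed d eq)

      run-runFor : ∀ rs t → M.run x (runFor transducer x t) rs ≡ runFor transducer x (length rs + t)
      run-runFor []        t = refl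
      run-runFor (tt ∷ rs) t = trans (run-runFor rs (suc t)) (cong (runFor transducer x) (+-suc (length rs) t))

    -- The tape never shrinks, so its final size bounds the space used at any time.
    compile : (f : Word → Word) (c : ℕ) →
              (∀ x → ∃[ σ ] (Execution._∶_⇒_∣_ blank x p σ₀ σ (f x) ×
                             tapeSize (work σ) ≤ c * ⌊log₂ length x ⌋ + c)) →
              LogSpaceComputable f
    compile f c correct = transducer , computes , c , logSpace
      where
      final : ∀ x → ∃[ t ] (runFor transducer x t ≡ conf nothing (proj₁ (correct x)) ×
                            outputFor transducer x t ≡ f x)
      final x = exec-run x 0 (proj₁ (proj₂ (correct x))) refl

      computes : Computes transducer f
      computes x with final x
      ... | t , eq , out = t , subst (λ c → T (M.halting (M.state c))) (sym eq) tt , out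

      bound : ∀ x t → M.space (runFor transducer x t) ≤ c * ⌊log₂ length x ⌋ + c
      bound x t with final x
      ... | t′ , eq , _ = ≤-trans (≤-trans (runFor-space-≤ x t′ t)
              (≤-reflexive (trans (cong M.space
                (trans (cong (runFor transducer x) (+-comm t′ t)) (halted-fixed x t eq)))
                                  (+-identityʳ _))))
              (proj₂ (proj₂ (correct x)))

      logSpace : ∀ x rs → M.space (M.run x M.initial rs) ≤ c * ⌊log₂ length x ⌋ + c
      logSpace x rs = subst (λ c′ → M.space c′ ≤ _) (sym (run-runFor x rs 0)) (bound x (length rs + 0))

-- Numerals with a fixed number of digits.

successor : ∀ {n} → Fin n → Maybe (Fin n)
successor {suc zero}    zero    = nothing
successor {suc (suc n)} zero    = just (suc zero)
successor {suc (suc n)} (suc i) = Maybe.map suc (successor i)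

successor-just : ∀ {n} {i j : Fin n} → successor i ≡ just j → toℕ j ≡ suc (toℕ i)
successor-just {suc (suc n)} {zero}  refl = refl
successor-just {suc (suc n)} {suc i} eq with successor i in e
successor-just {suc (suc n)} {suc i} refl | just j = cong suc (successor-just {i = i} e)

successor-nothing : ∀ {n} {i : Fin (suc n)} → successor i ≡ nothing → i ≡ fromℕ n
successor-nothing {zero}  {zero}  _  = refl
successor-nothing {suc n} {suc i} eq with successor i in e
... | nothing = cong suc (successor-nothing e)

data Dir : Set where
  down none up : Dir

module Digits (b : ℕ) where

  base : ℕ
  base = suc (suc b)

  Digit : Set
  Digit = Fin base

  -- One step of adding or subtracting 1: carry (or borrow) and digit in, carry and digit out.
  shiftDigit : Dir → Bool → Digit → Bool × Digit
  shiftDigit none c     d = c , d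
  shiftDigit down false d = false , d
  shiftDigit down true  zero    = true , fromℕ (suc b)
  shiftDigit down true  (suc d) = false , inject₁ d
  shiftDigit up   false d = false , d
  shiftDigit up   true  d with successor d
  ... | just d′ = false , d′
  ... | nothing = true , zero

  -- The least significant digit comes first.
  shift : ∀ {m} → Dir → Bool → Vec Digit m → Bool × Vec Digit m
  shift δ c []      = c , []
  shift δ c (d ∷ v) = let (c′ , d′) = shiftDigit δ c d
                          (c″ , v′) = shift δ c′ v
                      in c″ , d′ ∷ v′

  -- The initial carry `true` is the unit to be added or subtracted. The final carry is dropped, so
  -- counting is modulo `base ^ m`.
  move : ∀ {m} → Dir → Vec Digit m → Vec Digit m
  move δ v = proj₂ (shift δ true v)

  overflow : ∀ {m} → Vec Digit m → Bool
  overflow v = proj₁ (shift up true v)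

  shift-none : ∀ {m} c (v : Vec Digit m) → shift none c v ≡ (c , v)
  shift-none c []      = refl
  shift-none c (d ∷ v) rewrite shift-none c v = refl

  val : ∀ {m} → Vec Digit m → ℕ
  val []      = 0
  val (d ∷ v) = toℕ d + base * val v

  bool : Bool → ℕ
  bool false = 0
  bool true  = 1

  shiftDigit-up : ∀ c d → let (c′ , d′) = shiftDigit up c d in
                  toℕ d′ + base * bool c′ ≡ bool c + toℕ d
  shiftDigit-up false d = trans (cong (toℕ d +_) (*-zeroʳ base)) (+-identityʳ _)
  shiftDigit-up true  d with successor d in e
  ... | just d′ = trans (cong (toℕ d′ +_) (*-zeroʳ base)) (trans (+-identityʳ _) (successor-just e))
  ... | nothing = trans (*-identityʳ base)
    (cong suc (sym (trans (cong toℕ (successor-nothing {i = d} e)) (toℕ-fromℕ (suc b)))))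

  -- Conservation of value, from which the behaviour with and without overflow is read off.
  shift-up : ∀ {m} c (v : Vec Digit m) → let (c′ , v′) = shift up c v in
             val v′ + base ^ m * bool c′ ≡ bool c + val v
  shift-up {zero} c []      = trans (+-identityʳ _) (sym (+-identityʳ _))
  shift-up {suc m} c (d ∷ v) = begin
    (toℕ d′ + base * val v′) + base * base ^ m * bool c″
      ≡⟨ cong (toℕ d′ + base * val v′ +_) (*-assoc base (base ^ m) (bool c″)) ⟩
    (toℕ d′ + base * val v′) + base * (base ^ m * bool c″)
      ≡⟨ +-assoc (toℕ d′) _ _ ⟩
    toℕ d′ + (base * val v′ + base * (base ^ m * bool c″))
      ≡⟨ cong (toℕ d′ +_) (sym (*-distribˡ-+ base (val v′) _)) ⟩
    toℕ d′ + base * (val v′ + base ^ m * bool c″)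
      ≡⟨ cong (λ z → toℕ d′ + base * z) (shift-up c′ v) ⟩
    toℕ d′ + base * (bool c′ + val v)
      ≡⟨ cong (toℕ d′ +_) (*-distribˡ-+ base (bool c′) (val v)) ⟩
    toℕ d′ + (base * bool c′ + base * val v)
      ≡⟨ sym (+-assoc (toℕ d′) _ _) ⟩
    (toℕ d′ + base * bool c′) + base * val v
      ≡⟨ cong (_+ base * val v) (shiftDigit-up c d) ⟩
    (bool c + toℕ d) + base * val v
      ≡⟨ +-assoc (bool c) _ _ ⟩
    bool c + (toℕ d + base * val v) ∎
    where
    open ≡-Reasoning
    c′ = proj₁ (shiftDigit up c d)
    d′ = proj₂ (shiftDigit up c d)
    c″ = proj₁ (shift up c′ v)
    v′ = proj₂ (shift up c′ v)

  shiftDigit-down-up : ∀ c d → let (c′ , d′) = shiftDigit up c d in shiftDigit down c d′ ≡ (c′ , d)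
  shiftDigit-down-up false d = refl
  shiftDigit-down-up true  d with successor d in e
  ... | nothing = cong (true ,_) (sym (successor-nothing e))
  ... | just zero    with () ← successor-just {i = d} e
  ... | just (suc d′) = cong (false ,_) (toℕ-injective (trans (toℕ-inject₁ d′) (suc-injective (successor-just e))))

  -- The borrows of the decrement retrace the carries of the increment digit by digit. Subtraction
  -- needs no arithmetic beyond this: the input head moves left only from positions `suc i`, whose
  -- numeral is itself an increment.
  shift-down-up : ∀ {m} c (v : Vec Digit m) → shift down c (proj₂ (shift up c v)) ≡ (proj₁ (shift up c v) , v)
  shift-down-up c []      = refl
  shift-down-up c (d ∷ v) rewrite shiftDigit-down-up c d | shift-down-up (proj₁ (shiftDigit up c d)) v = refl

  move-down-up : ∀ {m} (v : Vec Digit m) → move down (move up v) ≡ v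
  move-down-up v = cong proj₂ (shift-down-up true v)

  val< : ∀ {m} (v : Vec Digit m) → val v < base ^ m
  val< {zero}  []      = s≤s z≤n
  val< {suc m} (d ∷ v) = begin-strict
    toℕ d + base * val v <⟨ +-monoˡ-< (base * val v) (toℕ<n d) ⟩
    base + base * val v  ≡⟨ sym (*-suc base (val v)) ⟩
    base * suc (val v)   ≤⟨ *-monoʳ-≤ base (val< v) ⟩
    base * base ^ m      ∎
    where open ≤-Reasoning

  -- A carry out accounts for `base ^ m` of `suc (val v)`, which is at most `base ^ m`; nothing
  -- remains for the new digits.
  overflow-val : ∀ {m} (v : Vec Digit m) → overflow v ≡ true → suc (val v) ≡ base ^ m × val (move up v) ≡ 0
  overflow-val {m} v eq with shift up true v | shift-up true v | val< v
  overflow-val {m} v refl | true , v′ | e | v< =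
    let e′ = trans (cong (val v′ +_) (sym (*-identityʳ (base ^ m)))) e
        z  = n≤0⇒n≡0 (+-cancelʳ-≤ (base ^ m) (val v′) 0 (≤-trans (≤-reflexive e′) v<))
    in trans (sym e′) (cong (_+ base ^ m) z) , z

  no-overflow-val : ∀ {m} (v : Vec Digit m) → overflow v ≡ false → val (move up v) ≡ suc (val v)
  no-overflow-val {m} v eq with shift up true v | shift-up true v
  no-overflow-val {m} v refl | false , v′ | e =
    trans (sym (trans (cong (val v′ +_) (*-zeroʳ (base ^ m))) (+-identityʳ _))) e

  val-injective : ∀ {m} (v v′ : Vec Digit m) → val v ≡ val v′ → v ≡ v′
  val-injective [] [] _ = refl
  val-injective (d ∷ v) (d′ ∷ v′) eq = cong₂ _∷_ (toℕ-injective (proj₁ q)) (val-injective v v′ (proj₂ q))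
    where
    -- Uniqueness of quotient and remainder, by cancelling one `base` at a time on both sides.
    split : ∀ {i j} x y → i < base → j < base → i + base * x ≡ j + base * y → i ≡ j × x ≡ y
    split {i} {j} zero zero i< j< e =
      trans (sym (+-identityʳ i)) (trans (subst (λ z → i + z ≡ j + z) (*-zeroʳ base) e) (+-identityʳ j)) , refl
    split {i} {j} zero (suc y) i< j< e = ⊥-elim (<⇒≱ i< (begin
      base                ≤⟨ m≤m*n base (suc y) ⟩
      base * suc y        ≤⟨ m≤n+m _ j ⟩
      j + base * suc y    ≡⟨ sym e ⟩
      i + base * 0        ≡⟨ trans (cong (i +_) (*-zeroʳ base)) (+-identityʳ i) ⟩
      i                   ∎))
      where open ≤-Reasoning
    split {i} {j} (suc x) zero i< j< e = ⊥-elim (<⇒≱ j< (begin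
      base                ≤⟨ m≤m*n base (suc x) ⟩
      base * suc x        ≤⟨ m≤n+m _ i ⟩
      i + base * suc x    ≡⟨ e ⟩
      j + base * 0        ≡⟨ trans (cong (j +_) (*-zeroʳ base)) (+-identityʳ j) ⟩
      j                   ∎))
      where open ≤-Reasoning
    split {i} {j} (suc x) (suc y) i< j< e =
      let (p , q) = split x y i< j< (+-cancelˡ-≡ base _ _ (trans (rot i x) (trans e (sym (rot j y))))) in p , cong suc q
      where
      rot : ∀ i x → base + (i + base * x) ≡ i + base * suc x
      rot i x = trans (sym (+-assoc base i _)) (trans (cong (_+ base * x) (+-comm base i))
                (trans (+-assoc i base _) (cong (i +_) (sym (*-suc base x)))))
    q = split (val v) (val v′) (toℕ<n d) (toℕ<n d′) eq

  zeros : ∀ m → Vec Digit m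
  zeros m = Vec.replicate m zero

  -- Iterated increment instead of repeated division: this is what the loops of the transducer do,
  -- so round `suc i` starts with the required string by definition.
  digits : ∀ m → ℕ → Vec Digit m
  digits m zero    = zeros m
  digits m (suc i) = move up (digits m i)

  val-zeros : ∀ m → val (zeros m) ≡ 0
  val-zeros zero    = refl
  val-zeros (suc m) = trans (cong (base *_) (val-zeros m)) (*-zeroʳ base)

  overflow-step : ∀ {m} (v : Vec Digit m) → suc (val v) < base ^ m → overflow v ≡ false
  overflow-step v lt with overflow v in e
  ... | false = refl
  ... | true  = ⊥-elim (<-irrefl (proj₁ (overflow-val v e)) lt)

  overflow-last : ∀ {m} (v : Vec Digit m) → suc (val v) ≡ base ^ m → overflow v ≡ true
  overflow-last v eq with overflow v in e
  ... | true  = refl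
  ... | false = ⊥-elim (<-irrefl (trans (no-overflow-val v e) eq) (val< (move up v)))

  val-digits : ∀ m {i} → i < base ^ m → val (digits m i) ≡ i
  val-digits m {zero}  lt = val-zeros m
  val-digits m {suc i} lt =
    let ih = val-digits m {i} (<-trans (n<1+n i) lt) in
    trans (no-overflow-val (digits m i) (overflow-step (digits m i) (subst (λ z → suc z < base ^ m) (sym ih) lt)))
          (cong suc ih)

  digits-val : ∀ {m} (v : Vec Digit m) → digits m (val v) ≡ v
  digits-val v = val-injective _ v (val-digits _ (val< v))

  -- After a complete inner loop its track is zero again, ready for the next round of the outer
  -- loop.
  digits-wrap : ∀ m {i} → suc i ≡ base ^ m → digits m (suc i) ≡ zeros m
  digits-wrap m {i} eq =
    let lt = ≤-reflexive eq
        e  = val-digits m lt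
    in val-injective _ (zeros m) (trans (proj₂ (overflow-val (digits m i)
         (overflow-last (digits m i) (trans (cong suc e) eq)))) (sym (val-zeros m)))

  strings : ∀ m → List (Vec Digit m)
  strings m = map (digits m) (upTo (base ^ m))

  ∈-strings : ∀ {m} (v : Vec Digit m) → v ∈ˡ strings m
  ∈-strings {m} v = subst (_∈ˡ strings m) (digits-val v) (∈-map⁺ (digits m) (∈-upTo⁺ (val< v)))

  -- All digits have codes of the same length, so concatenated codes can be cut apart without
  -- delimiters.
  oneHot : ∀ {n} → Fin n → List Bool
  oneHot {suc n} zero    = true ∷ replicate n false
  oneHot {suc n} (suc i) = false ∷ oneHot i

  oneHot-length : ∀ {n} (i : Fin n) → length (oneHot i) ≡ n
  oneHot-length {suc n} zero    = cong suc (length-replicate n)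
  oneHot-length {suc n} (suc i) = cong suc (oneHot-length i)

  oneHot-injective : ∀ {n} (i j : Fin n) {r r′} → oneHot i ++ r ≡ oneHot j ++ r′ → i ≡ j × r ≡ r′
  oneHot-injective {suc n} zero zero eq = refl , drop n (∷-injectiveʳ eq)
    where
    drop : ∀ n {r r′} → replicate n false ++ r ≡ replicate n false ++ r′ → r ≡ r′
    drop zero    eq = eq
    drop (suc n) eq = drop n (∷-injectiveʳ eq)
  oneHot-injective {suc n} (suc i) (suc j) eq =
    let (p , q) = oneHot-injective i j (∷-injectiveʳ eq) in cong suc p , q

  codes : ∀ {m} → Vec Digit m → List Bool
  codes []      = []
  codes (d ∷ v) = oneHot d ++ codes v

  codes-length : ∀ {m} (v : Vec Digit m) → length (codes v) ≡ m * base
  codes-length []      = refl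
  codes-length (d ∷ v) = trans (length-++ (oneHot d)) (cong₂ _+_ (oneHot-length d) (codes-length v))

  codes-injective : ∀ {m} (v v′ : Vec Digit m) {r r′} → codes v ++ r ≡ codes v′ ++ r′ → v ≡ v′ × r ≡ r′
  codes-injective [] [] eq = refl , eq
  codes-injective (d ∷ v) (d′ ∷ v′) {r} {r′} eq =
    let (p , q) = oneHot-injective d d′ (trans (sym (++-assoc (oneHot d) (codes v) r))
                                        (trans eq (++-assoc (oneHot d′) (codes v′) r′)))
        (p′ , q′) = codes-injective v v′ q
    in cong₂ _∷_ p p′ , q′

-- Binary numerals

lsbValue : List Bool → ℕ
lsbValue []           = 0
lsbValue (false ∷ bs) = lsbValue bs + lsbValue bs
lsbValue (true ∷ bs)  = suc (lsbValue bs + lsbValue bs)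

lsbValue-increment : ∀ bs → lsbValue (increment bs) ≡ suc (lsbValue bs)
lsbValue-increment []           = refl
lsbValue-increment (false ∷ bs) = refl
lsbValue-increment (true ∷ bs)  rewrite lsbValue-increment bs = cong suc (+-suc _ _)

lsbValue-binaryLSB : ∀ n → lsbValue (binaryLSB n) ≡ n
lsbValue-binaryLSB zero    = refl
lsbValue-binaryLSB (suc n) = trans (lsbValue-increment (binaryLSB n)) (cong suc (lsbValue-binaryLSB n))

toBinary-injective : ∀ {m n} → toBinary m ≡ toBinary n → m ≡ n
toBinary-injective {m} {n} eq = trans (sym (lsbValue-binaryLSB m))
  (trans (cong lsbValue (reverse-injective {x = binaryLSB m} {binaryLSB n} eq)) (lsbValue-binaryLSB n))

-- The argument is positive because zero is written as the single digit `false`, and doubling it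
-- does not prepend another.
binaryLSB-double : ∀ n → binaryLSB (suc n + suc n) ≡ false ∷ binaryLSB (suc n)
binaryLSB-double zero    = refl
binaryLSB-double (suc n) rewrite +-suc n (suc n) | binaryLSB-double n = refl

binaryLSB-lsbValue : ∀ bs → let n = lsbValue (bs ++ true ∷ []) in
                     ∃[ k ] n ≡ suc k × binaryLSB n ≡ bs ++ true ∷ []
binaryLSB-lsbValue [] = 0 , refl , refl
binaryLSB-lsbValue (false ∷ bs) with lsbValue (bs ++ true ∷ []) | binaryLSB-lsbValue bs
... | _ | k , refl , eq = _ , refl , trans (binaryLSB-double k) (cong (false ∷_) eq)
binaryLSB-lsbValue (true ∷ bs) with lsbValue (bs ++ true ∷ []) | binaryLSB-lsbValue bs
... | _ | k , refl , eq = _ , refl , trans (cong increment (binaryLSB-double k)) (cong (true ∷_) eq)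

-- A leading one makes every bit string a canonical numeral.
fromBits : List Bool → ℕ
fromBits bs = lsbValue (reverse bs ++ true ∷ [])

toBinary-fromBits : ∀ bs → toBinary (fromBits bs) ≡ true ∷ bs
toBinary-fromBits bs = trans (cong reverse (proj₂ (proj₂ (binaryLSB-lsbValue (reverse bs)))))
  (trans (cong reverse (sym (unfold-reverse true bs))) (reverse-involutive (true ∷ bs)))

lsbValue<2^length : ∀ bs → lsbValue bs < 2 ^ length bs
lsbValue<2^length []       = s≤s z≤n
lsbValue<2^length (c ∷ bs) = ≤-trans (≤-trans (s≤s (bound c)) (≤-reflexive (sym (+-suc (suc v) v))))
  (≤-trans (+-mono-≤ ih ih) (≤-reflexive (cong (2 ^ length bs +_) (sym (+-identityʳ _)))))
  where
  v  = lsbValue bs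
  ih = lsbValue<2^length bs
  bound : ∀ c → lsbValue (c ∷ bs) ≤ suc (v + v)
  bound false = n≤1+n _
  bound true  = ≤-refl

bitLength : ℕ → ℕ
bitLength n = length (binaryLSB n)

n<2^bitLength : ∀ n → n < 2 ^ bitLength n
n<2^bitLength n = subst (_< 2 ^ bitLength n) (lsbValue-binaryLSB n) (lsbValue<2^length (binaryLSB n))

log₂≤bitLength : ∀ n → ⌊log₂ n ⌋ ≤ bitLength n
log₂≤bitLength n = ≤-trans (⌊log₂⌋-mono-≤ (<⇒≤ (n<2^bitLength n))) (≤-reflexive (⌊log₂[2^n]⌋≡n (bitLength n)))

increment-leading-one : ∀ bs → ∃[ cs ] increment (bs ++ true ∷ []) ≡ cs ++ true ∷ []
increment-leading-one []           = false ∷ [] , refl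
increment-leading-one (false ∷ bs) = true ∷ bs , refl
increment-leading-one (true ∷ bs)  = let (cs , eq) = increment-leading-one bs in false ∷ cs , cong (false ∷_) eq

leading-one : ∀ n → ∃[ bs ] binaryLSB (suc n) ≡ bs ++ true ∷ []
leading-one zero    = [] , refl
leading-one (suc n) with leading-one n
... | bs , eq rewrite eq = increment-leading-one bs

2^length≤lsbValue : ∀ bs → 2 ^ length bs ≤ lsbValue (bs ++ true ∷ [])
2^length≤lsbValue []       = s≤s z≤n
2^length≤lsbValue (c ∷ bs) = ≤-trans (≤-reflexive (cong (2 ^ length bs +_) (+-identityʳ _)))
                                     (≤-trans (+-mono-≤ ih ih) (bound c))
  where
  v  = lsbValue (bs ++ true ∷ [])
  ih = 2^length≤lsbValue bs
  bound : ∀ c → v + v ≤ lsbValue (c ∷ bs ++ true ∷ [])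
  bound false = ≤-refl
  bound true  = n≤1+n _

-- This bound keeps the transducer within logarithmic space; its counterpart `log₂≤bitLength` makes
-- the row long enough for the simulated machine.
bitLength≤1+log₂ : ∀ n → bitLength n ≤ suc ⌊log₂ n ⌋
bitLength≤1+log₂ zero    = s≤s z≤n
bitLength≤1+log₂ (suc n) with leading-one n
... | bs , eq = begin
  bitLength (suc n)            ≡⟨ trans (cong length eq) (trans (length-++ bs) (+-comm (length bs) 1)) ⟩
  suc (length bs)              ≡⟨ cong suc (sym (⌊log₂[2^n]⌋≡n (length bs))) ⟩
  suc ⌊log₂ 2 ^ length bs ⌋    ≤⟨ s≤s (⌊log₂⌋-mono-≤ {2 ^ length bs} {suc n}
      (≤-trans (2^length≤lsbValue bs)
        (≤-reflexive (trans (cong lsbValue (sym eq)) (lsbValue-binaryLSB (suc n)))))) ⟩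
  suc ⌊log₂ suc n ⌋ ∎
  where open ≤-Reasoning

bitLength>0 : ∀ n → 0 < bitLength n
bitLength>0 zero    = s≤s z≤n
bitLength>0 (suc n) with binaryLSB n
... | []         = s≤s z≤n
... | false ∷ bs = s≤s z≤n
... | true ∷ bs  = s≤s z≤n

digitTokens : List Bool → Word
digitTokens bs = concatMap tokenBits (map digit bs)

digitTokens-++ : ∀ bs cs → digitTokens (bs ++ cs) ≡ digitTokens bs ++ digitTokens cs
digitTokens-++ bs cs = trans (cong (concatMap tokenBits) (map-++ digit bs cs))
  (concatMap-++ tokenBits (map digit bs) (map digit cs))

digitTokens-length : ∀ bs → length (digitTokens bs) ≡ length bs * 4
digitTokens-length []       = refl
digitTokens-length (b ∷ bs) = cong (4 +_) (digitTokens-length bs)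

-- Sweeps along the cells of the work tape.

module Sweeps (b : ℕ) where

  open Digits b

  -- `carry` also serves as the flag that ends loops and as the mark of the first cell. `first`
  -- caches column 0 of the simulated configuration; `last₁` and `last₂` are the columns scanned one
  -- and two cells ago.
  record Reg : Set where
    constructor reg⟨_,_,_,_⟩
    field
      carry : Bool
      first : Digit
      last₁ last₂ : Maybe Digit

  open Reg public

  Reg-finite : Finite Reg
  Reg-finite = finite-via
    (mk↔ₛ′ (λ r → carry r , first r , last₁ r , last₂ r) (λ (c , d , p , q) → reg⟨ c , d , p , q ⟩)
      (λ _ → refl) (λ _ → refl))
    (×-finite Bool-finite (×-finite (Fin-finite base)
      (×-finite (Maybe-finite (Fin-finite base)) (Maybe-finite (Fin-finite base)))))

  -- The counter track is only used to measure the input; nothing marks a padding cell.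
  Cell : Set
  Cell = Maybe Bool × Digit × Digit × Digit

  data Sym : Set where
    blank lend rend : Sym
    cell            : Cell → Sym

  Sym-finite : Finite Sym
  Sym-finite = finite-via
    (mk↔ₛ′ (λ { blank → inj₁ zero ; lend → inj₁ (suc zero) ; rend → inj₁ (suc (suc zero)) ; (cell a) → inj₂ a })
           (λ { (inj₁ zero) → blank ; (inj₁ (suc zero)) → lend ; (inj₁ (suc (suc zero))) → rend ; (inj₂ a) → cell a })
           (λ { (inj₁ zero) → refl ; (inj₁ (suc zero)) → refl ; (inj₁ (suc (suc zero))) → refl ; (inj₂ a) → refl })
           (λ { blank → refl ; lend → refl ; rend → refl ; (cell a) → refl }))
    (⊎-finite (Fin-finite 3)
      (×-finite (Maybe-finite Bool-finite) (×-finite (Fin-finite base) (×-finite (Fin-finite base) (Fin-finite base)))))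

  open Programs Reg Sym public

  headBit : Word → Maybe Bool
  headBit []      = nothing
  headBit (c ∷ _) = just c

  emitHead : (Reg → InputSymbol → Sym → Word) → Action
  emitHead g r i s = r , stay , (s , stay) , headBit (g r i s)

  -- A step writes at most one bit, so a word is spread over several steps. Register, input symbol
  -- and scanned symbol stay the same meanwhile, so `g` can be evaluated afresh in each of them; if
  -- the word is shorter than the number of steps, the last ones are silent.
  emit : ℕ → (Reg → InputSymbol → Sym → Word) → Prog
  emit zero    g = act idle
  emit (suc ℓ) g = act (emitHead g) ⨾ emit ℓ (λ r i s → List.drop 1 (g r i s))

  -- A Mealy machine running along the cells, with the register as its state, that may also rewrite
  -- them. The input head rests during a pass, so the input symbol is constant. `width` fixes the
  -- number of emitting steps per cell.
  record Pass : Set where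
    field
      width      : ℕ
      out        : Reg → InputSymbol → Cell → Word
      out-length : ∀ r i a → length (out r i a) ≤ width
      update     : Reg → InputSymbol → Cell → Reg × Cell

    finalReg : InputSymbol → Reg → List Cell → Reg
    finalReg i r []       = r
    finalReg i r (a ∷ as) = finalReg i (proj₁ (update r i a)) as

    cells : InputSymbol → Reg → List Cell → List Cell
    cells i r []       = []
    cells i r (a ∷ as) = proj₂ (update r i a) ∷ cells i (proj₁ (update r i a)) as

    output : InputSymbol → Reg → List Cell → Word
    output i r []       = []
    output i r (a ∷ as) = out r i a ++ output i (proj₁ (update r i a)) as

  isCell notLend : Reg → InputSymbol → Sym → Bool
  isCell r i (cell _) = true
  isCell r i _        = false
  notLend r i lend    = false
  notLend r i _       = true

  onCell : {A : Set} → A → (Cell → A) → Sym → A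
  onCell z f (cell a) = f a
  onCell z f _        = z

  scan : Pass → Prog
  scan P = while isCell
    (emit width (λ r i → onCell [] (out r i)) ⨾
     act (λ r i s → onCell (idle r i s) (λ a →
       let (r′ , a′) = update r i a in r′ , stay , (cell a′ , right) , nothing) s))
    where open Pass P

  back : Prog
  back = while notLend (act (λ r i s → r , stay , (s , left) , nothing))

  -- `mid` runs on the right marker before the head returns: there the row can be extended, or
  -- output still outstanding can be written.
  sweep : (Reg → Reg) → Pass → Prog → Prog
  sweep f P mid = act (λ r i s → f r , stay , (s , right) , nothing) ⨾ scan P ⨾ mid ⨾ back

  appendCells : List Cell → Prog
  appendCells []       = act (λ r i s → r , stay , (rend , stay) , nothing)
  appendCells (a ∷ as) = act (λ r i s → r , stay , (cell a , right) , nothing) ⨾ appendCells as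

  modify : (Reg → Reg) → Prog
  modify f = act (λ r i s → f r , stay , (s , stay) , nothing)

  moveHead : Move → Prog
  moveHead m = act (λ r i s → r , m , (s , stay) , nothing)

  rest : List Cell → Tape Sym
  rest as = tape [] lend (map cell as ++ rend ∷ [])

  module SweepExec (x : Word) where

    open Execution blank x public

    emit-exec : ∀ ℓ g σ → length (view g σ) ≤ ℓ → emit ℓ g ∶ σ ⇒ σ ∣ view g σ
    emit-exec zero g σ le with view g σ
    emit-exec zero g σ z≤n | [] = act-exec σ
    emit-exec (suc ℓ) g σ le = emits≡ (cons (view g σ))
        (act-exec {emitHead g} σ ⨾ₑ emit-exec ℓ (λ r i s → List.drop 1 (g r i s)) σ (drop-length (view g σ) le))
      where
      drop-length : ∀ (w : Word) → length w ≤ suc ℓ → length (List.drop 1 w) ≤ ℓ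
      drop-length []      _        = z≤n
      drop-length (c ∷ w) (s≤s le) = le
      cons : ∀ (w : Word) → outputBit (headBit w) ++ List.drop 1 w ≡ w
      cons []      = refl
      cons (c ∷ w) = refl

    at : List Sym → List Cell → Tape Sym
    at ls []       = tape ls rend []
    at ls (a ∷ as) = tape ls (cell a) (map cell as ++ rend ∷ [])

    moveRight-at : ∀ ls s as → moveTape blank right (tape ls s (map cell as ++ rend ∷ [])) ≡ at (s ∷ ls) as
    moveRight-at ls s []       = refl
    moveRight-at ls s (a ∷ as) = refl

    module _ (P : Pass) (h : ℕ) where
      open Pass P

      private i = readInput x h

      scan-exec : ∀ as r ls → scan P ∶ ⟨ r , h , at ls as ⟩ ⇒
                  ⟨ finalReg i r as , h , at (map cell (cells i r as) ʳ++ ls) [] ⟩ ∣ output i r as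
      scan-exec []       r ls = while-false refl
      scan-exec (a ∷ as) r ls = emits≡ (cong (_++ output i (proj₁ (update r i a)) as) (++-identityʳ (out r i a)))
        (while-true refl
          (emit-exec width _ ⟨ r , h , at ls (a ∷ as) ⟩ (out-length r i a)
           ⨾ₑ ends≡ (cong (λ t → ⟨ _ , h , t ⟩) (moveRight-at ls _ as)) (act-exec ⟨ r , h , at ls (a ∷ as) ⟩))
          (scan-exec as _ _))

    -- The scanned symbol is general because it is the right marker only before the first move and a
    -- cell after it.
    back-exec : ∀ {r h} ys s ts → (∀ r i → notLend r i s ≡ true) →
                back ∶ ⟨ r , h , tape (map cell ys ++ lend ∷ []) s ts ⟩ ⇒
                       ⟨ r , h , tape [] lend (map cell ys ʳ++ s ∷ ts) ⟩ ∣ []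
    back-exec {r} {h} []       s ts nl = while-true (nl r (readInput x h)) (act-exec _) (while-false refl)
    back-exec {r} {h} (y ∷ ys) s ts nl =
      while-true (nl r (readInput x h)) (act-exec _) (back-exec ys (cell y) (s ∷ ts) (λ _ _ → refl))

    reversed : ∀ as → map cell as ʳ++ (lend ∷ []) ≡ map cell (reverse as) ++ lend ∷ []
    reversed as = trans (ʳ++-defn (map cell as)) (cong (_++ lend ∷ []) (sym (reverse-map cell as)))

    unreversed : ∀ as ts → map cell (reverse as) ʳ++ ts ≡ map cell as ++ ts
    unreversed as ts = trans (ʳ++-defn (map cell (reverse as)))
      (cong (_++ ts) (trans (sym (reverse-map cell (reverse as))) (cong (map cell) (reverse-involutive as))))

    rewind-exec : ∀ {r h} as → back ∶ ⟨ r , h , tape (map cell as ʳ++ lend ∷ []) rend [] ⟩ ⇒ ⟨ r , h , rest as ⟩ ∣ []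
    rewind-exec {r} {h} as rewrite reversed as =
      ends≡ (cong (λ ts → ⟨ r , h , tape [] lend ts ⟩) (unreversed as (rend ∷ [])))
            (back-exec (reverse as) rend [] (λ _ _ → refl))

    sweep-exec : ∀ {f P mid r h as r′ as′ w} → let open Pass P; i = readInput x h in
      mid ∶ ⟨ finalReg i (f r) as , h , tape (map cell (cells i (f r) as) ʳ++ lend ∷ []) rend [] ⟩ ⇒
            ⟨ r′ , h , tape (map cell as′ ʳ++ lend ∷ []) rend [] ⟩ ∣ w →
      sweep f P mid ∶ ⟨ r , h , rest as ⟩ ⇒ ⟨ r′ , h , rest as′ ⟩ ∣ output i (f r) as ++ w
    sweep-exec {f} {P} {r = r} {h} {as} {as′ = as′} {w} e =
      emits≡ (cong (Pass.output P _ (f r) as ++_) (++-identityʳ w))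
        (ends≡ (cong (λ t → ⟨ f r , h , t ⟩) (moveRight-at [] lend as)) (act-exec ⟨ r , h , rest as ⟩)
         ⨾ₑ scan-exec P h as (f r) (lend ∷ []) ⨾ₑ e ⨾ₑ rewind-exec as′)

    appendCells-exec : ∀ {r h} ls as s → appendCells as ∶ ⟨ r , h , tape ls s [] ⟩ ⇒
                       ⟨ r , h , tape (map cell as ʳ++ ls) rend [] ⟩ ∣ []
    appendCells-exec ls []       s = act-exec _
    appendCells-exec ls (a ∷ as) s = act-exec _ ⨾ₑ appendCells-exec (cell a ∷ ls) as blank

  data Track : Set where
    τ-track h-track s-track : Track

  get : Track → Cell → Digit
  get τ-track (c , τ , h , s) = τ
  get h-track (c , τ , h , s) = h
  get s-track (c , τ , h , s) = s

  put : Track → Digit → Cell → Cell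
  put τ-track d (c , τ , h , s) = c , d , h , s
  put h-track d (c , τ , h , s) = c , τ , d , s
  put s-track d (c , τ , h , s) = c , τ , h , d

  Key : ℕ → Set
  Key m = Vec Digit m × Vec Digit m × Vec Digit m

  getᵏ : ∀ {m} → Track → Key m → Vec Digit m
  getᵏ τ-track (τ , h , s) = τ
  getᵏ h-track (τ , h , s) = h
  getᵏ s-track (τ , h , s) = s

  putᵏ : ∀ {m} → Track → Vec Digit m → Key m → Key m
  putᵏ τ-track v (τ , h , s) = v , h , s
  putᵏ h-track v (τ , h , s) = τ , v , s
  putᵏ s-track v (τ , h , s) = τ , h , v

  -- Three numerals share the row, with the least significant digits on the left, so that carries
  -- travel in the direction of the sweep.
  layout : ∀ {m} → Vec (Maybe Bool) m → Key m → List Cell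
  layout []       _                           = []
  layout (c ∷ cs) (t ∷ τ , i ∷ h , d ∷ s) = (c , t , i , d) ∷ layout cs (τ , h , s)

  getᵏ-∷ : ∀ {m} tr t i d (τ h s : Vec Digit m) c →
           getᵏ tr (t ∷ τ , i ∷ h , d ∷ s) ≡ get tr (c , t , i , d) ∷ getᵏ tr (τ , h , s)
  getᵏ-∷ τ-track t i d τ h s c = refl
  getᵏ-∷ h-track t i d τ h s c = refl
  getᵏ-∷ s-track t i d τ h s c = refl

  layout-put : ∀ {m} tr e (v : Vec Digit m) c cs t i d τ h s →
               put tr e (c , t , i , d) ∷ layout cs (putᵏ tr v (τ , h , s)) ≡
               layout (c ∷ cs) (putᵏ tr (e ∷ v) (t ∷ τ , i ∷ h , d ∷ s))
  layout-put τ-track e v c cs t i d τ h s = refl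
  layout-put h-track e v c cs t i d τ h s = refl
  layout-put s-track e v c cs t i d τ h s = refl

  codeTokens : Digit → Word
  codeTokens d = digitTokens (oneHot d)

  codeTokens-length : ∀ d → length (codeTokens d) ≤ base * 4
  codeTokens-length d = ≤-reflexive (trans (digitTokens-length (oneHot d)) (cong (_* 4) (oneHot-length d)))

  outs : ∀ {m} → (Digit → Word) → Vec Digit m → Word
  outs f []      = []
  outs f (d ∷ v) = f d ++ outs f v

  outs-codes : ∀ {m} (v : Vec Digit m) → outs codeTokens v ≡ digitTokens (codes v)
  outs-codes []      = refl
  outs-codes (d ∷ v) = trans (cong (codeTokens d ++_) (outs-codes v)) (sym (digitTokens-++ (oneHot d) (codes v)))

  outs-[] : ∀ {m} (v : Vec Digit m) → outs (λ _ → []) v ≡ []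
  outs-[] []      = refl
  outs-[] (d ∷ v) = outs-[] v

  setCarry : Bool → Reg → Reg
  setCarry c r = record r { carry = c }

  -- One carry propagation with three uses: writing the shifted numeral to the output while the tape
  -- keeps the old one, finding out whether there is an overflow, and storing the shifted numeral.
  module ShiftPass (tr : Track) (dir : Digit → InputSymbol → Dir) (write : Bool)
                   (ℓ : ℕ) (f : Digit → Word) (f-length : ∀ d → length (f d) ≤ ℓ) where

    shifted : Reg → InputSymbol → Cell → Bool × Digit
    shifted r i a = shiftDigit (dir (first r) i) (carry r) (get tr a)

    rewritten : Bool → Digit → Cell → Cell
    rewritten true  d a = put tr d a
    rewritten false d a = a

    shiftPass : Pass
    shiftPass = record
      { width      = ℓ
      ; out        = λ r i a → f (proj₂ (shifted r i a))
      ; out-length = λ r i a → f-length (proj₂ (shifted r i a))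
      ; update     = λ r i a → setCarry (proj₁ (shifted r i a)) r , rewritten write (proj₂ (shifted r i a)) a
      }

    open Pass shiftPass

    result : ∀ {m} → InputSymbol → Reg → Key m → Bool × Vec Digit m
    result i r k = shift (dir (first r) i) (carry r) (getᵏ tr k)

    finalReg-layout : ∀ {m} i r cs (k : Key m) → finalReg i r (layout cs k) ≡ setCarry (proj₁ (result i r k)) r
    finalReg-layout i r [] (τ , h , s) with getᵏ tr (τ , h , s)
    ... | [] = refl
    finalReg-layout i r (c ∷ cs) (t ∷ τ , j ∷ h , d ∷ s) rewrite getᵏ-∷ tr t j d τ h s c =
      finalReg-layout i _ cs (τ , h , s)

    output-layout : ∀ {m} i r cs (k : Key m) → output i r (layout cs k) ≡ outs f (proj₂ (result i r k))
    output-layout i r [] (τ , h , s) with getᵏ tr (τ , h , s)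
    ... | [] = refl
    output-layout i r (c ∷ cs) (t ∷ τ , j ∷ h , d ∷ s) rewrite getᵏ-∷ tr t j d τ h s c =
      cong (f _ ++_) (output-layout i _ cs (τ , h , s))

    cells-layout : ∀ {m} i r cs (k : Key m) → write ≡ false → cells i r (layout cs k) ≡ layout cs k
    cells-layout i r []       k                       refl = refl
    cells-layout i r (c ∷ cs) (t ∷ τ , j ∷ h , d ∷ s) refl = cong (_ ∷_) (cells-layout i _ cs (τ , h , s) refl)

  module WritePass (tr : Track) (dir : Digit → InputSymbol → Dir) where

    open ShiftPass tr dir true 0 (λ _ → []) (λ _ → z≤n) public
    open Pass shiftPass

    cells-put : ∀ {m} i r cs (k : Key m) → cells i r (layout cs k) ≡ layout cs (putᵏ tr (proj₂ (result i r k)) k)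
    cells-put i r []       (τ , h , s) = refl
    cells-put i r (c ∷ cs) (t ∷ τ , j ∷ h , d ∷ s) rewrite getᵏ-∷ tr t j d τ h s c =
      trans (cong (_ ∷_) (cells-put i _ cs (τ , h , s))) (layout-put tr _ _ c cs t j d τ h s)

-- Gate descriptions as strings of tokens.

word : List Token → Word
word = concatMap tokenBits

word-++ : ∀ ts us → word (ts ++ us) ≡ word ts ++ word us
word-++ = concatMap-++ tokenBits

-- What the encoding says about a gate: name, label, names of the predecessors.
Description : Set
Description = ℕ × (ℕ ⊎ Op) × List ℕ

descriptionLabel : ℕ ⊎ Op → List Token
descriptionLabel (inj₁ a) = number a
descriptionLabel (inj₂ o) = op o ∷ []

nameTokens : List ℕ → List Token
nameTokens = concatMap (λ p → comma ∷ number p)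

descriptionTokens : Description → List Token
descriptionTokens (n , l , ps) = number n ++ comma ∷ descriptionLabel l ++ nameTokens ps ++ semicolon ∷ []

headerTokens : ℕ → List Description → List Token
headerTokens o ds = number o ++ semicolon ∷ concatMap descriptionTokens ds

-- A space-bounded computation as a cellular automaton: i is the scanned input symbol, c the coin and s₀ the
-- content of the first cell, which determines the motion of the input head; φ i c s₀ p s n is the new content of
-- a cell with content s between p and n.
record Rule (b : ℕ) : Set where
  field
    dir       : (c : Bool) (s₀ : Fin (suc (suc b))) (i : InputSymbol) → Dir
    φ         : (i : InputSymbol) (c : Bool) (s₀ : Fin (suc (suc b))) (p : Maybe (Fin (suc (suc b))))
                (s : Fin (suc (suc b))) (n : Maybe (Fin (suc (suc b)))) → Fin (suc (suc b))
    accepts   : Fin (suc (suc b)) → Bool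
    init star : Fin (suc (suc b))

-- The reduction and the program that writes it.

module Reduction (b K : ℕ) (rule : Rule b) where

  open Rule rule
  open Digits b
  open Sweeps b

  firstDigit : ∀ {m} → Vec Digit m → Digit
  firstDigit []      = zero
  firstDigit (d ∷ v) = d

  nextDigit : ∀ {m} → Vec Digit m → Maybe Digit
  nextDigit []      = nothing
  nextDigit (d ∷ v) = just d

  evolve : ∀ {m} → InputSymbol → Bool → Digit → Maybe Digit → Vec Digit m → Vec Digit m
  evolve i c s₀ p []      = []
  evolve i c s₀ p (s ∷ v) = φ i c s₀ p s (nextDigit v) ∷ evolve i c s₀ (just s) v

  -- Covers both configurations from which paths are counted: `star` codes the blank column, so
  -- `header init` is the initial configuration and `header star` the always accepting one.
  header : Digit → ∀ m → Vec Digit m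
  header d zero    = []
  header d (suc m) = d ∷ Vec.replicate m star

  nameBits : ∀ {m} → Key m → List Bool
  nameBits (τ , h , s) = codes τ ++ codes h ++ codes s

  keyName : ∀ {m} → Key m → ℕ
  keyName k = fromBits (nameBits k)

  -- With `K` padding cells behind each bit of the counter, the row gets `suc K` cells per bit: a
  -- constant multiple of the logarithm is marked off without computing it.
  expand : List Bool → List (Maybe Bool)
  expand []       = []
  expand (c ∷ bs) = just c ∷ replicate K nothing ++ expand bs

  counters : Word → List (Maybe Bool)
  counters x = expand (binaryLSB (length x))

  width : Word → ℕ
  width x = length (counters x)

  module Graph (x : Word) where

    -- Strings that code positions beyond the input are read as ⊣, in agreement with the input head
    -- of the transducer, which stops there.
    symbol : ∀ {m} → Vec Digit m → InputSymbol
    symbol h = readInput x (val h ⊓ suc (length x))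

    nextKey : ∀ {m} → Bool → Key m → Key m
    nextKey c (τ , h , s) =
      move up τ , move (dir c (firstDigit s) (symbol h)) h , evolve (symbol h) c (firstDigit s) nothing s

    leafLabel : Digit → ℕ
    leafLabel d = if accepts d then 2 else 1

    describe : ∀ {m} → Key m → Description
    describe k@(τ , h , s) = keyName k , (if overflow τ
      then inj₁ (leafLabel (firstDigit s)) , []
      else inj₂ (binary times) , keyName (nextKey false k) ∷ keyName (nextKey true k) ∷ [])

    startKey starKey : ∀ m → Key m
    startKey m = zeros m , zeros m , header init m
    starKey  m = zeros m , zeros m , header star m

    -- Time is the outermost coordinate and increases, so every gate precedes its predecessors in
    -- the list.
    grid : List (Key (width x))
    grid = cartesianProduct (strings (width x)) (cartesianProduct (strings (width x)) (strings (width x)))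

    -- Gate 0 is the output {0} times quotient, gate 2 the quotient of gates 3 and 4, and gates 1
    -- and 5 are the constants 0 and 2. Since operands are ordered by name, the numerator must have
    -- the smaller of the names 3 and 4. The order of listing is again reverse topological.
    extraDescriptions : List Description
    extraDescriptions =
      (0 , inj₂ (binary times) , 1 ∷ 2 ∷ []) ∷
      (2 , inj₂ (binary divide) , 3 ∷ 4 ∷ []) ∷
      (3 , inj₂ (binary times) , keyName (startKey (width x)) ∷ keyName (startKey (width x)) ∷ []) ∷
      (4 , inj₂ (binary times) , keyName (starKey (width x)) ∷ 5 ∷ []) ∷
      (1 , inj₁ 0 , []) ∷
      (5 , inj₁ 2 , []) ∷ []

    descriptions : List Description
    descriptions = extraDescriptions ++ map describe grid

  reduction : Word → Word
  reduction x = word (headerTokens 0 (Graph.descriptions x) ++ number 0)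

  number-keyName : ∀ {m} (k : Key m) → number (keyName k) ≡ map digit (true ∷ nameBits k)
  number-keyName k = cong (map digit) (toBinary-fromBits (nameBits k))

  noDir upDir : Digit → InputSymbol → Dir
  noDir _ _ = none
  upDir _ _ = up

  text : List Token → Prog
  text ts = emit (length (word ts)) (λ _ _ _ → word ts)

  shiftSweep : Pass → Prog
  shiftSweep P = sweep (setCarry true) P (act idle)

  module CodePass (tr : Track) (δ : Digit → InputSymbol → Dir) =
    ShiftPass tr δ false (base * 4) codeTokens codeTokens-length
  module SilentPass (tr : Track) (δ : Digit → InputSymbol → Dir) =
    ShiftPass tr δ false 0 (λ _ → []) (λ _ → z≤n)

  emitTrack : Track → (Digit → InputSymbol → Dir) → Prog
  emitTrack tr δ = shiftSweep (CodePass.shiftPass tr δ)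

  testOverflow : Track → Prog
  testOverflow tr = shiftSweep (SilentPass.shiftPass tr upDir)

  advance : Track → Prog
  advance tr = shiftSweep (WritePass.shiftPass tr upDir)

  -- The carry is set before the sweep and cleared by the first cell, so it distinguishes column 0.
  headerDigit : Digit → Reg → Digit
  headerDigit d r = if carry r then d else star

  headerPass : Digit → Pass
  headerPass d = record
    { width      = base * 4
    ; out        = λ r i a → codeTokens (headerDigit d r)
    ; out-length = λ r i a → codeTokens-length (headerDigit d r)
    ; update     = λ r i a → setCarry false r , a
    }

  pending : Bool → Reg → InputSymbol → Maybe Digit → Maybe Digit → Word
  pending c r i nothing  s = []
  pending c r i (just q) s = codeTokens (φ i c (first r) (last₂ r) q s)

  pending-length : ∀ c r i q s → length (pending c r i q s) ≤ base * 4
  pending-length c r i nothing  s = z≤n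
  pending-length c r i (just q) s = codeTokens-length (φ i c (first r) (last₂ r) q s)

  -- Emits with a delay of one cell, since the new content of a cell depends on both neighbours.
  evolvePass : Bool → Pass
  evolvePass c = record
    { width      = base * 4
    ; out        = λ r i a → pending c r i (last₁ r) (just (get s-track a))
    ; out-length = λ r i a → pending-length c r i (last₁ r) _
    ; update     = λ r i a → record r { last₂ = last₁ r ; last₁ = just (get s-track a) } , a
    }

  emitEvolved : Bool → Prog
  emitEvolved c = sweep (λ r → record r { last₁ = nothing ; last₂ = nothing }) (evolvePass c)
                        (emit (base * 4) (λ r i _ → pending c r i (last₁ r) nothing))

  emitHeader : Digit → Prog
  emitHeader d = shiftSweep (headerPass d)

  -- The leading digit `true` is the one added by `fromBits`. The third track is left to `p`, which
  -- copies it, evolves it or writes a starting configuration.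
  emitName : (Digit → InputSymbol → Dir) → (Digit → InputSymbol → Dir) → Prog → Prog
  emitName δτ δh p = text (digit true ∷ []) ⨾ emitTrack τ-track δτ ⨾ emitTrack h-track δh ⨾ p

  -- Column 0 holds the state and the scanned symbols, on which the new content of every column
  -- depends; it stays in the register while the gate is written.
  loadFirst : Prog
  loadFirst = act (λ r i s → r , stay , (s , right) , nothing) ⨾
              act (λ r i s → record r { first = onCell zero (get s-track) s } , stay , (s , left) , nothing)

  emitPredecessor : Bool → Prog
  emitPredecessor c = text (comma ∷ []) ⨾ emitName upDir (dir c) (emitEvolved c)

  isCarry isNotCarry notStart notEnd : Reg → InputSymbol → Sym → Bool
  isCarry r _ _    = carry r
  isNotCarry r _ _ = not (carry r)
  notStart _ ⊢ _   = false
  notStart _ _ _   = true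
  notEnd _ ⊣ _     = false
  notEnd _ _ _     = true

  leafWord : Digit → Word
  leafWord d = word (number (if accepts d then 2 else 1))

  emitLabel : Prog
  emitLabel = when isCarry
    -- The longer of the two labels, 2, has two binary digits, and a token takes four bits.
    thenₚ emit 8 (λ r _ _ → leafWord (first r))
    elseₚ (text (op (binary times) ∷ []) ⨾ emitPredecessor false ⨾ emitPredecessor true)

  emitGate : Prog
  emitGate = loadFirst ⨾ emitName noDir noDir (emitTrack s-track noDir) ⨾ text (comma ∷ []) ⨾
             testOverflow τ-track ⨾ emitLabel ⨾ text (semicolon ∷ [])

  -- Bodies increment a track and leave the overflow in the carry, so the loop visits each string
  -- once. The carry is cleared first, which forces the initial round.
  odometer : Prog → Prog
  odometer p = modify (setCarry false) ⨾ while isNotCarry p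

  rewindInput : Prog
  rewindInput = while notStart (moveHead left)

  -- The input head advances together with `h-track`. Thus the symbol scanned by the simulated
  -- configuration is under the head whenever a gate is written.
  emitRow emitLayer : Prog
  emitRow   = odometer (emitGate ⨾ advance s-track)
  emitLayer = odometer (emitRow ⨾ advance h-track ⨾ moveHead right)

  emitGrid : Prog
  emitGrid = odometer (emitLayer ⨾ rewindInput ⨾ advance τ-track)

  emitExtras : Prog
  emitExtras =
    text (number 0 ++ semicolon ∷
          descriptionTokens (0 , inj₂ (binary times) , 1 ∷ 2 ∷ []) ++
          descriptionTokens (2 , inj₂ (binary divide) , 3 ∷ 4 ∷ []) ++
          number 3 ++ comma ∷ op (binary times) ∷ comma ∷ []) ⨾
    emitName noDir noDir (emitHeader init) ⨾
    text (comma ∷ []) ⨾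
    emitName noDir noDir (emitHeader init) ⨾
    text (semicolon ∷ number 4 ++ comma ∷ op (binary times) ∷ comma ∷ []) ⨾
    emitName noDir noDir (emitHeader star) ⨾
    text (comma ∷ number 5 ++ semicolon ∷
          descriptionTokens (1 , inj₁ 0 , []) ++
          descriptionTokens (5 , inj₁ 2 , []))

  emptyCell : Maybe Bool → Cell
  emptyCell c = c , zero , zero , zero

  incrementCounter : Bool → Maybe Bool → Bool × Maybe Bool
  incrementCounter c     nothing      = c , nothing
  incrementCounter false (just e)     = false , just e
  incrementCounter true  (just false) = false , just true
  incrementCounter true  (just true)  = true , just false

  counterPass : Pass
  counterPass = record
    { width      = 0
    ; out        = λ _ _ _ → []
    ; out-length = λ _ _ _ → z≤n
    ; update     = λ r i (e , a) → let (c , e′) = incrementCounter (carry r) e in setCarry c r , e′ , a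
    }

  countOne : Prog
  countOne = sweep (setCarry true) counterPass
    (when isCarry thenₚ appendCells (map emptyCell (expand (true ∷ []))) elseₚ act idle)

  -- Counting the input symbols in binary lays out the row at exactly its final length. The counter
  -- starts as the numeral of 0, which already has one digit.
  measure : Prog
  measure = act (λ r i s → r , stay , (lend , right) , nothing) ⨾
            appendCells (map emptyCell (expand (false ∷ []))) ⨾ back ⨾ moveHead right ⨾
            while notEnd (countOne ⨾ moveHead right) ⨾ rewindInput

  program : Prog
  program = measure ⨾ emitExtras ⨾ emitGrid ⨾ text (number 0)

  -- Execution of the program.

  module Run (x : Word) where

    open SweepExec x
    open Graph x

    text-exec : ∀ ts σ → text ts ∶ σ ⇒ σ ∣ word ts
    text-exec ts σ = emit-exec _ _ σ ≤-refl

    modify-exec : ∀ f r h t → modify f ∶ ⟨ r , h , t ⟩ ⇒ ⟨ f r , h , t ⟩ ∣ []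
    modify-exec f r h t = act-exec _

    moveHead-exec : ∀ μ r h t → moveHead μ ∶ ⟨ r , h , t ⟩ ⇒ ⟨ r , moveInput x μ h , t ⟩ ∣ []
    moveHead-exec μ r h t = act-exec _

    config : ∀ {m} → Vec (Maybe Bool) m → Reg → ℕ → Key m → Store
    config cs r h k = ⟨ r , h , rest (layout cs k) ⟩

    module _ {m : ℕ} (cs : Vec (Maybe Bool) m) where

      emitTrack-exec : ∀ tr δ r h k → emitTrack tr δ ∶ config cs r h k ⇒
        config cs (setCarry (proj₁ (shift (δ (first r) (readInput x h)) true (getᵏ tr k))) r) h k
        ∣ digitTokens (codes (move (δ (first r) (readInput x h)) (getᵏ tr k)))
      emitTrack-exec tr δ r h k = emits≡
        (trans (++-identityʳ _) (trans (output-layout _ (setCarry true r) cs k) (outs-codes (move _ (getᵏ tr k)))))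
        (sweep-exec (ends≡ (cong₂ (λ r′ as → ⟨ r′ , h , tape (map cell as ʳ++ lend ∷ []) rend [] ⟩)
          (finalReg-layout _ (setCarry true r) cs k) (cells-layout _ (setCarry true r) cs k refl)) (act-exec _)))
        where open CodePass tr δ

      testOverflow-exec : ∀ tr r h k → testOverflow tr ∶ config cs r h k ⇒
        config cs (setCarry (overflow (getᵏ tr k)) r) h k ∣ []
      testOverflow-exec tr r h k = emits≡
        (trans (++-identityʳ _) (trans (output-layout _ (setCarry true r) cs k) (outs-[] (move up (getᵏ tr k)))))
        (sweep-exec (ends≡ (cong₂ (λ r′ as → ⟨ r′ , h , tape (map cell as ʳ++ lend ∷ []) rend [] ⟩)
          (finalReg-layout _ (setCarry true r) cs k) (cells-layout _ (setCarry true r) cs k refl)) (act-exec _)))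
        where open SilentPass tr upDir

      advance-exec : ∀ tr r h k → advance tr ∶ config cs r h k ⇒
        config cs (setCarry (overflow (getᵏ tr k)) r) h (putᵏ tr (move up (getᵏ tr k)) k) ∣ []
      advance-exec tr r h k = emits≡
        (trans (++-identityʳ _) (trans (output-layout _ (setCarry true r) cs k) (outs-[] (move up (getᵏ tr k)))))
        (sweep-exec (ends≡ (cong₂ (λ r′ as → ⟨ r′ , h , tape (map cell as ʳ++ lend ∷ []) rend [] ⟩)
          (finalReg-layout _ (setCarry true r) cs k) (cells-put _ (setCarry true r) cs k)) (act-exec _)))
        where open WritePass tr upDir

    header-cells : ∀ d i r {m} (cs : Vec (Maybe Bool) m) k → Pass.cells (headerPass d) i r (layout cs k) ≡ layout cs k
    header-cells d i r []       k                       = refl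
    header-cells d i r (c ∷ cs) (t ∷ τ , j ∷ h , e ∷ s) = cong (_ ∷_) (header-cells d i _ cs (τ , h , s))

    header-output-tail : ∀ d i r {m} (cs : Vec (Maybe Bool) m) k → carry r ≡ false →
      Pass.output (headerPass d) i r (layout cs k) ≡ digitTokens (codes (Vec.replicate m star))
    header-output-tail d i r []       k                       eq   = refl
    header-output-tail d i r {suc m} (c ∷ cs) (t ∷ τ , j ∷ h , e ∷ s) eq rewrite eq =
      trans (cong (codeTokens star ++_) (header-output-tail d i _ cs (τ , h , s) refl))
            (sym (digitTokens-++ (oneHot star) (codes (Vec.replicate m star))))

    header-output : ∀ d i r {m} (cs : Vec (Maybe Bool) m) k →
      Pass.output (headerPass d) i (setCarry true r) (layout cs k) ≡ digitTokens (codes (header d m))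
    header-output d i r []       k = refl
    header-output d i r {suc m} (c ∷ cs) (t ∷ τ , j ∷ h , e ∷ s) =
      trans (cong (codeTokens d ++_) (header-output-tail d i _ cs (τ , h , s) refl))
            (sym (digitTokens-++ (oneHot d) (codes (Vec.replicate m star))))

    evolve-cells : ∀ c i r {m} (cs : Vec (Maybe Bool) m) k → Pass.cells (evolvePass c) i r (layout cs k) ≡ layout cs k
    evolve-cells c i r []       k                       = refl
    evolve-cells c i r (e ∷ cs) (t ∷ τ , j ∷ h , d ∷ s) = cong (_ ∷_) (evolve-cells c i _ cs (τ , h , s))

    -- The output lags one column behind the head. Generalising over the pending column `q` makes
    -- the induction work, and the final `pending` without a right neighbour catches up.
    evolve-output-tail : ∀ c i r {m} (cs : Vec (Maybe Bool) m) τ h s q → last₁ r ≡ just q →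
      let open Pass (evolvePass c); r′ = finalReg i r (layout cs (τ , h , s)) in
      output i r (layout cs (τ , h , s)) ++ pending c r′ i (last₁ r′) nothing ≡
      digitTokens (codes (evolve i c (first r) (last₂ r) (q ∷ s)))
    evolve-output-tail c i r [] τ h [] q eq rewrite eq =
      cong digitTokens (sym (++-identityʳ (oneHot (φ i c (first r) (last₂ r) q nothing))))
    evolve-output-tail c i r (e ∷ cs) (t ∷ τ) (j ∷ h) (d ∷ s) q eq rewrite eq =
      trans (++-assoc (codeTokens (φ i c (first r) (last₂ r) q (just d))) _ _)
      (trans (cong (codeTokens (φ i c (first r) (last₂ r) q (just d)) ++_)
               (evolve-output-tail c i _ cs τ h s d refl))
             (sym (digitTokens-++ (oneHot (φ i c (first r) (last₂ r) q (just d))) _)))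

    evolve-output : ∀ c i r {m} (cs : Vec (Maybe Bool) m) τ h s →
      let open Pass (evolvePass c); r₀ = record r { last₁ = nothing ; last₂ = nothing }
          r′ = finalReg i r₀ (layout cs (τ , h , s)) in
      output i r₀ (layout cs (τ , h , s)) ++ pending c r′ i (last₁ r′) nothing ≡
      digitTokens (codes (evolve i c (first r) nothing s))
    evolve-output c i r []       τ       h       []      = refl
    evolve-output c i r (e ∷ cs) (t ∷ τ) (j ∷ h) (d ∷ s) = evolve-output-tail c i _ cs τ h s d refl

    evolve-first : ∀ c i r as → first (Pass.finalReg (evolvePass c) i r as) ≡ first r
    evolve-first c i r []       = refl
    evolve-first c i r (a ∷ as) = evolve-first c i _ as

    header-first : ∀ d i r as → first (Pass.finalReg (headerPass d) i r as) ≡ first r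
    header-first d i r []       = refl
    header-first d i r (a ∷ as) = header-first d i _ as

    -- The first digit d is the only register that has to survive.
    Emits : ∀ {m} → Vec (Maybe Bool) m → ℕ → Key m → Digit → Prog → Word → Set
    Emits cs h k d p w = ∀ r → first r ≡ d →
      ∃[ r′ ] (first r′ ≡ d × (p ∶ config cs r h k ⇒ config cs r′ h k ∣ w))

    module _ {m : ℕ} {cs : Vec (Maybe Bool) m} {h : ℕ} {k : Key m} {d : Digit} where

      infixr 4 _⨾ₘ_

      _⨾ₘ_ : ∀ {p q w w′} → Emits cs h k d p w → Emits cs h k d q w′ → Emits cs h k d (p ⨾ q) (w ++ w′)
      (e ⨾ₘ f) r eq = let (r₁ , eq₁ , e₁) = e r eq
                          (r₂ , eq₂ , e₂) = f r₁ eq₁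
                      in r₂ , eq₂ , e₁ ⨾ₑ e₂

      Emits≡ : ∀ {p w w′} → w ≡ w′ → Emits cs h k d p w → Emits cs h k d p w′
      Emits≡ refl e = e

      text-emits : ∀ ts → Emits cs h k d (text ts) (word ts)
      text-emits ts r eq = r , eq , text-exec ts _

      track-emits : ∀ tr δ → Emits cs h k d (emitTrack tr δ)
        (digitTokens (codes (move (δ d (readInput x h)) (getᵏ tr k))))
      track-emits tr δ r refl = _ , refl , emitTrack-exec cs tr δ r h k

      header-emits : ∀ e → Emits cs h k d (emitHeader e) (digitTokens (codes (header e m)))
      header-emits e r refl = r′ , header-first e i (setCarry true r) (layout cs k)
        , emits≡ (trans (++-identityʳ _) (header-output e i r cs k))
            (sweep-exec (ends≡ (cong (λ as → ⟨ r′ , h , tape (map cell as ʳ++ lend ∷ []) rend [] ⟩)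
              (header-cells e i (setCarry true r) cs k)) (act-exec _)))
        where
        i  = readInput x h
        r′ = Pass.finalReg (headerPass e) i (setCarry true r) (layout cs k)

      evolved-emits : ∀ c → Emits cs h k d (emitEvolved c)
        (digitTokens (codes (evolve (readInput x h) c d nothing (getᵏ s-track k))))
      evolved-emits c r refl = r′ , evolve-first c i r₀ (layout cs k)
        , emits≡ (evolve-output c i r cs (proj₁ k) (proj₁ (proj₂ k)) (proj₂ (proj₂ k)))
            (sweep-exec (ends≡ (cong (λ as → ⟨ r′ , h , tape (map cell as ʳ++ lend ∷ []) rend [] ⟩)
              (evolve-cells c i r₀ cs k))
              (emit-exec (base * 4) (λ r i _ → pending c r i (last₁ r) nothing) _
                (pending-length c r′ i (last₁ r′) nothing))))
        where
        i  = readInput x h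
        r₀ = record r { last₁ = nothing ; last₂ = nothing }
        r′ = Pass.finalReg (evolvePass c) i r₀ (layout cs k)

      name-emits : ∀ δτ δh {p} (s′ : Vec Digit m) → let i = readInput x h in
        Emits cs h k d p (digitTokens (codes s′)) →
        Emits cs h k d (emitName δτ δh p)
          (word (number (keyName (move (δτ d i) (proj₁ k) , move (δh d i) (proj₁ (proj₂ k)) , s′))))
      name-emits δτ δh s′ e = Emits≡ (sym (trans (cong word (number-keyName key))
            (cong (tokenBits (digit true) ++_)
              (trans (digitTokens-++ (codes (proj₁ key)) _)
                (cong (digitTokens (codes (proj₁ key)) ++_) (digitTokens-++ (codes (proj₁ (proj₂ key))) (codes s′)))))))
          (text-emits (digit true ∷ []) ⨾ₘ track-emits τ-track δτ ⨾ₘ track-emits h-track δh ⨾ₘ e)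
        where
        i = readInput x h
        key = move (δτ d i) (proj₁ k) , move (δh d i) (proj₁ (proj₂ k)) , s′

    move-none : ∀ {m} (v : Vec Digit m) → move none v ≡ v
    move-none v = cong proj₂ (shift-none true v)

    plain-name-emits : ∀ {m cs h d} {k : Key m} {p} (s′ : Vec Digit m) →
      Emits cs h k d p (digitTokens (codes s′)) →
      Emits cs h k d (emitName noDir noDir p) (word (number (keyName (proj₁ k , proj₁ (proj₂ k) , s′))))
    plain-name-emits {k = τ , i , s} s′ e =
      Emits≡ (cong₂ (λ v w → word (number (keyName (v , w , s′)))) (move-none τ) (move-none i))
             (name-emits noDir noDir s′ e)

    loadFirst-exec : ∀ {m} cs r h (k : Key m) → 0 < m → loadFirst ∶ config cs r h k ⇒
      config cs (record r { first = firstDigit (getᵏ s-track k) }) h k ∣ []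
    loadFirst-exec (c ∷ cs) r h (t ∷ τ , i ∷ v , d ∷ s) _ = act-exec _ ⨾ₑ act-exec _

    module _ {m : ℕ} (0<m : 0 < m) (cs : Vec (Maybe Bool) m) where

      module _ (k : Key m) where

        private
          τ = proj₁ k
          h = proj₁ (proj₂ k)
          s = proj₂ (proj₂ k)
          -- The position of the input head, which has followed the count on `h-track`; the symbol
          -- there is `symbol h`.
          i = val h ⊓ suc (length x)
          d = firstDigit s

          predecessor-emits : ∀ c → Emits cs i k d (emitPredecessor c)
            (word (comma ∷ []) ++ word (number (keyName (nextKey c k))))
          predecessor-emits c = text-emits (comma ∷ []) ⨾ₘ name-emits upDir (dir c)
            (evolve (symbol h) c d nothing s) (evolved-emits c)

          own-name-emits : Emits cs i k d (emitName noDir noDir (emitTrack s-track noDir)) (word (number (keyName k)))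
          own-name-emits = plain-name-emits s
            (Emits≡ (cong (λ v → digitTokens (codes v)) (move-none s)) (track-emits s-track noDir))

          node-word : ∀ P Q → word ((P ++ comma ∷ Q ++ []) ++ semicolon ∷ []) ≡
                      (word P ++ word (comma ∷ []) ++ word Q) ++ word (semicolon ∷ [])
          node-word P Q = trans (word-++ (P ++ comma ∷ Q ++ []) (semicolon ∷ []))
            (cong (_++ word (semicolon ∷ [])) (trans (word-++ P (comma ∷ Q ++ []))
              (cong (λ R → word P ++ word (comma ∷ []) ++ word R) (++-identityʳ Q))))

          leaf-length : ∀ e → length (leafWord e) ≤ 8
          leaf-length e with accepts e
          ... | true  = ≤-refl
          ... | false = s≤s (s≤s (s≤s (s≤s z≤n)))

          leaf-word : word (comma ∷ []) ++ leafWord d ++ word (semicolon ∷ []) ≡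
                      word (comma ∷ number (leafLabel d) ++ semicolon ∷ [])
          leaf-word with accepts d
          ... | true  = refl
          ... | false = refl

          label-exec : ∀ r → first r ≡ d → carry r ≡ overflow τ → ∃[ r′ ]
            ((emitLabel ⨾ text (semicolon ∷ [])) ∶ config cs r i k ⇒ config cs r′ i k ∣
              (if overflow τ then leafWord d ++ word (semicolon ∷ [])
               else word (op (binary times) ∷ comma ∷
                 (number (keyName (nextKey false k)) ++ comma ∷
                   number (keyName (nextKey true k)) ++ []) ++ semicolon ∷ [])))
          label-exec r refl eq with overflow τ
          ... | true  = r , (if-true eq (emit-exec 8 _ _ (leaf-length (first r))) ⨾ₑ text-exec (semicolon ∷ []) _)
          ... | false =
            let (r′ , _ , e) = (text-emits (op (binary times) ∷ []) ⨾ₘ predecessor-emits false ⨾ₘ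
                  predecessor-emits true) r refl
            in r′ , emits≡ (cong (λ w → word (op (binary times) ∷ comma ∷ []) ++ w)
                 (sym (node-word (number (keyName (nextKey false k))) (number (keyName (nextKey true k))))))
                 (if-false eq e ⨾ₑ text-exec (semicolon ∷ []) _)

          gate-word : word (number (keyName k)) ++ word (comma ∷ []) ++
            (if overflow τ then leafWord d ++ word (semicolon ∷ [])
             else word (op (binary times) ∷ comma ∷
               (number (keyName (nextKey false k)) ++ comma ∷
                   number (keyName (nextKey true k)) ++ []) ++ semicolon ∷ []))
            ≡ word (descriptionTokens (describe k))
          gate-word with overflow τ
          ... | true  = trans (cong (word (number (keyName k)) ++_) leaf-word) (sym (word-++ (number (keyName k)) _))
          ... | false = sym (word-++ (number (keyName k)) _)

        gate-exec : ∀ r → ∃[ r′ ]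
          (emitGate ∶ config cs r i k ⇒ config cs r′ i k ∣ word (descriptionTokens (describe k)))
        gate-exec r =
          let (r₁ , eq₁ , e₁) = own-name-emits (record r { first = d }) refl
              (r₂ , eq₂ , e₂) = text-emits (comma ∷ []) r₁ eq₁
              (r₃ , e₃)       = label-exec (setCarry (overflow τ) r₂) eq₂ refl
          in r₃ , emits≡ gate-word
               (loadFirst-exec cs r i k 0<m ⨾ₑ e₁ ⨾ₑ e₂ ⨾ₑ testOverflow-exec cs τ-track r₂ i k ⨾ₑ e₃)

    outFrom : (ℕ → Word) → ℕ → ℕ → Word
    outFrom out i zero    = []
    outFrom out i (suc d) = out i ++ outFrom out (suc i) d

    outFrom-applyUpTo : ∀ out f i d → (∀ j → f j ≡ i + j) → outFrom out i d ≡ concatMap out (applyUpTo f d)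
    outFrom-applyUpTo out f i zero    eq = refl
    outFrom-applyUpTo out f i (suc d) eq = cong₂ _++_ (cong out (sym (trans (eq 0) (+-identityʳ i))))
      (outFrom-applyUpTo out (f ∘ suc) (suc i) d (λ j → trans (eq (suc j)) (+-suc i j)))

    module _ (p : Prog) (h : ℕ → ℕ) (t : ℕ → Tape Sym) (out : ℕ → Word) (N : ℕ)
             (body : ∀ i → i < N → ∀ r → ∃[ r′ ]
               ((suc i < N → carry r′ ≡ false) × (suc i ≡ N → carry r′ ≡ true) ×
                (p ∶ ⟨ r , h i , t i ⟩ ⇒ ⟨ r′ , h (suc i) , t (suc i) ⟩ ∣ out i))) where

      -- Between rounds only the carry of the register is known: it stays false until the last of
      -- the `N` rounds.
      loop-exec : ∀ d i r → i + suc d ≡ N → carry r ≡ false → ∃[ r′ ]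
        (while isNotCarry p ∶ ⟨ r , h i , t i ⟩ ⇒ ⟨ r′ , h N , t N ⟩ ∣ outFrom out i (suc d))
      loop-exec zero i r eq c with body i (≤-reflexive (trans (+-comm 1 i) eq)) r
      ... | r′ , _ , last , e with trans (+-comm 1 i) eq
      ...   | refl = r′ , while-true (cong not c) e (while-false (cong not (last refl)))
      loop-exec (suc d) i r eq c with body i
        (≤-trans (m≤m+n (suc i) (suc d)) (≤-reflexive (trans (sym (+-suc i (suc d))) eq))) r
      ... | r′ , go , _ , e =
        let eq′ = trans (sym (+-suc i (suc d))) eq
            lt  = ≤-trans (≤-reflexive (+-comm 1 (suc i)))
              (≤-trans (+-monoʳ-≤ (suc i) (s≤s {n = d} z≤n)) (≤-reflexive eq′))
            (r″ , e′) = loop-exec d (suc i) r′ eq′ (go lt)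
        in r″ , while-true (cong not c) e e′

      odometer-exec : 0 < N → ∀ r → ∃[ r′ ]
        (odometer p ∶ ⟨ r , h 0 , t 0 ⟩ ⇒ ⟨ r′ , h N , t N ⟩ ∣ concatMap out (upTo N))
      odometer-exec (s≤s {n = d} _) r =
        let (r′ , e) = loop-exec d 0 (setCarry false r) refl refl
        in r′ , emits≡ (outFrom-applyUpTo out (λ j → j) 0 N (λ _ → refl))
             (modify-exec (setCarry false) r (h 0) (t 0) ⨾ₑ e)

    rewindInput-exec : ∀ h r t → rewindInput ∶ ⟨ r , h , t ⟩ ⇒ ⟨ r , 0 , t ⟩ ∣ []
    rewindInput-exec zero    r t = while-false refl
    rewindInput-exec (suc h) r t = while-true (running x h) (act-exec _) (rewindInput-exec h r t)
      where
      running : ∀ x h → notStart r (readInput x (suc h)) (Tape.current t) ≡ true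
      running []      h       = refl
      running (c ∷ x) zero    = refl
      running (c ∷ x) (suc h) = running x h

    module _ {m : ℕ} (0<m : 0 < m) (cs : Vec (Maybe Bool) m) where

      private
        N = base ^ m
        n = length x

        0<N : 0 < N
        0<N = m^n>0 base m

        overflow-carry : ∀ i → i < N →
          (suc i < N → overflow (digits m i) ≡ false) × (suc i ≡ N → overflow (digits m i) ≡ true)
        overflow-carry i lt =
          (λ lt′ → overflow-step (digits m i) (subst (λ j → suc j < N) (sym (val-digits m lt)) lt′)) ,
          (λ eq → overflow-last (digits m i) (trans (cong suc (val-digits m lt)) eq))

        wrap : digits m N ≡ zeros m
        wrap with N in eq | 0<N
        ... | suc i | _ = digits-wrap m (sym eq)

        gateWord : Key m → Word
        gateWord k = word (descriptionTokens (describe k))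

        D : ℕ → Vec Digit m
        D = digits m

      row : Vec Digit m → Vec Digit m → Word
      row τ h = concatMap (λ s → gateWord (τ , h , s)) (strings m)

      layer : Vec Digit m → Word
      layer τ = concatMap (row τ) (strings m)

      sLoop-exec : ∀ τ h r → let i = val h ⊓ suc n in ∃[ r′ ]
        (emitRow ∶ config cs r i (τ , h , zeros m) ⇒ config cs r′ i (τ , h , zeros m) ∣ row τ h)
      sLoop-exec τ h r =
        let (r′ , e) = odometer-exec (emitGate ⨾ advance s-track) (λ _ → i) (λ j → rest (layout cs (τ , h , D j)))
                         (λ j → gateWord (τ , h , D j)) N body 0<N r
        in r′ , ends≡ (cong (λ v → config cs r′ i (τ , h , v)) wrap)
                  (emits≡ (sym (concatMap-map (λ s → gateWord (τ , h , s)) D (upTo N))) e)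
        where
        i = val h ⊓ suc n
        body : ∀ j → j < N → ∀ r → ∃[ r′ ] ((suc j < N → carry r′ ≡ false) × (suc j ≡ N → carry r′ ≡ true) ×
          ((emitGate ⨾ advance s-track) ∶ config cs r i (τ , h , D j) ⇒ config cs r′ i (τ , h , D (suc j)) ∣
            gateWord (τ , h , D j)))
        body j lt r =
          let (r₁ , e) = gate-exec 0<m cs (τ , h , D j) r
              (p , q)  = overflow-carry j lt
          in setCarry (overflow (D j)) r₁ , p , q ,
             emits≡ (++-identityʳ _) (e ⨾ₑ advance-exec cs s-track r₁ i (τ , h , D j))

      hLoop-exec : ∀ τ r → ∃[ r′ ]
        (emitLayer ∶
          config cs r 0 (τ , zeros m , zeros m) ⇒ config cs r′ (N ⊓ suc n) (τ , zeros m , zeros m) ∣ layer τ)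
      hLoop-exec τ r =
        let (r′ , e) = odometer-exec (emitRow ⨾ advance h-track ⨾ moveHead right)
                         (_⊓ suc n) (λ j → rest (layout cs (τ , D j , zeros m))) (λ j → row τ (D j)) N body 0<N r
        in r′ , ends≡ (cong (λ v → config cs r′ (N ⊓ suc n) (τ , v , zeros m)) wrap)
                  (emits≡ (sym (concatMap-map (row τ) D (upTo N))) e)
        where
        -- The head stays on ⊣ while the position string counts on.
        clamp : ∀ j → suc (j ⊓ suc n) ⊓ suc n ≡ suc j ⊓ suc n
        clamp j with ≤-total j n
        ... | inj₁ j≤n = cong (λ z → suc z ⊓ suc n) (m≤n⇒m⊓n≡m (≤-trans j≤n (n≤1+n n)))
        ... | inj₂ n≤j = trans (m≥n⇒m⊓n≡n (s≤s (⊓-glb n≤j (n≤1+n n)))) (sym (m≥n⇒m⊓n≡n (s≤s n≤j)))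

        body : ∀ j → j < N → ∀ r → ∃[ r′ ] ((suc j < N → carry r′ ≡ false) × (suc j ≡ N → carry r′ ≡ true) ×
          ((emitRow ⨾ advance h-track ⨾ moveHead right) ∶
            config cs r (j ⊓ suc n) (τ , D j , zeros m) ⇒ config cs r′ (suc j ⊓ suc n) (τ , D (suc j) , zeros m) ∣
              row τ (D j)))
        body j lt r =
          let at-j     = cong (_⊓ suc n) (val-digits m lt)
              (r₁ , e) = sLoop-exec τ (D j) r
              (p , q)  = overflow-carry j lt
          in setCarry (overflow (D j)) r₁ , p , q ,
             subst₂ (λ a a′ → (emitRow ⨾ advance h-track ⨾ moveHead right) ∶ config cs r a (τ , D j , zeros m) ⇒
                 config cs (setCarry (overflow (D j)) r₁) a′ (τ , D (suc j) , zeros m) ∣ row τ (D j))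
               at-j (trans (cong (λ a → suc a ⊓ suc n) at-j) (clamp j))
               (emits≡ (++-identityʳ _) (e ⨾ₑ advance-exec cs h-track r₁ _ (τ , D j , zeros m) ⨾ₑ
                 moveHead-exec right _ _ _))

      emitGrid-exec : ∀ r → ∃[ r′ ] (emitGrid ∶ config cs r 0 (zeros m , zeros m , zeros m) ⇒
        config cs r′ 0 (zeros m , zeros m , zeros m) ∣ concatMap layer (strings m))
      emitGrid-exec r =
        let (r′ , e) = odometer-exec _ (λ _ → 0) (λ j → rest (layout cs (D j , zeros m , zeros m)))
              (λ j → layer (D j)) N body 0<N r
        in r′ , ends≡ (cong (λ v → config cs r′ 0 (v , zeros m , zeros m)) wrap)
                  (emits≡ (sym (concatMap-map layer D (upTo N))) e)
        where
        body : ∀ j → j < N → ∀ r → ∃[ r′ ] ((suc j < N → carry r′ ≡ false) × (suc j ≡ N → carry r′ ≡ true) ×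
          ((emitLayer ⨾ rewindInput ⨾ advance τ-track) ∶
            config cs r 0 (D j , zeros m , zeros m) ⇒ config cs r′ 0 (D (suc j) , zeros m , zeros m) ∣ layer (D j)))
        body j lt r =
          let (r₁ , e) = hLoop-exec (D j) r
              (p , q)  = overflow-carry j lt
          in setCarry (overflow (D j)) r₁ , p , q ,
             emits≡ (++-identityʳ _) (e ⨾ₑ rewindInput-exec _ r₁ _ ⨾ₑ advance-exec cs τ-track r₁ 0
               (D j , zeros m , zeros m))

-- Correctness and space bound of the transducer.

word-concatMap : ∀ {A : Set} (g : A → List Token) as → word (concatMap g as) ≡ concatMap (word ∘ g) as
word-concatMap g []       = refl
word-concatMap g (a ∷ as) = trans (word-++ (g a) (concatMap g as)) (cong (word (g a) ++_) (word-concatMap g as))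

concatMap-cartesianProduct : ∀ {A B : Set} {C : Set} (f : A × B → List C) as bs →
  concatMap f (cartesianProduct as bs) ≡ concatMap (λ a → concatMap (λ b → f (a , b)) bs) as
concatMap-cartesianProduct f []       bs = refl
concatMap-cartesianProduct f (a ∷ as) bs =
  trans (concatMap-++ f (map (a ,_) bs) (cartesianProduct as bs))
        (cong₂ _++_ (concatMap-map f (a ,_) bs) (concatMap-cartesianProduct f as bs))

module Correctness (b K : ℕ) (rule : Rule b) where

  open Rule rule
  open Digits b
  open Sweeps b
  open Reduction b K rule

  expand-length : ∀ bs → length (expand bs) ≡ length bs * suc K
  expand-length []       = refl
  expand-length (c ∷ bs) = cong suc (trans (length-++ (replicate K nothing))
    (cong₂ _+_ (length-replicate K) (expand-length bs)))

  layout-empty : ∀ cs → let m = length cs in map emptyCell cs ≡ layout (Vec.fromList cs) (zeros m , zeros m , zeros m)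
  layout-empty []       = refl
  layout-empty (c ∷ cs) = cong (emptyCell c ∷_) (layout-empty cs)

  module _ (x : Word) where

    open SweepExec x
    open Graph x
    open Run x

    private
      n = length x
      module C = Pass counterPass

    counter-padding : ∀ i r j cs → let as = map emptyCell cs in
      C.cells i r (map emptyCell (replicate j nothing ++ cs)) ≡ map emptyCell (replicate j nothing) ++ C.cells i r as ×
      C.finalReg i r (map emptyCell (replicate j nothing ++ cs)) ≡ C.finalReg i r as
    counter-padding i r zero    cs = refl , refl
    counter-padding i r (suc j) cs = let (p , q) = counter-padding i r j cs in cong (_ ∷_) p , q

    counter-idle : ∀ i r bs → carry r ≡ false → let as = map emptyCell (expand bs) in
      C.cells i r as ≡ as × C.finalReg i r as ≡ r
    counter-idle i r []       eq = refl , refl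
    counter-idle i r (c ∷ bs) refl =
      let (p , q)   = counter-padding i r K (expand bs)
          (p′ , q′) = counter-idle i r bs refl
      in cong (_ ∷_) (trans p (trans (cong (map emptyCell (replicate K nothing) ++_) p′)
           (sym (map-++ emptyCell (replicate K nothing) (expand bs)))))
       , trans q q′

    -- The alternatives are the two branches of `countOne`: if the carry survives all bits, the new
    -- leading bit is missing and is appended together with its padding.
    counter-increment : ∀ i r bs → carry r ≡ true → let as = map emptyCell (expand bs) in
      (carry (C.finalReg i r as) ≡ false × C.cells i r as ≡ map emptyCell (expand (increment bs))) ⊎
      (carry (C.finalReg i r as) ≡ true ×
       C.cells i r as ++ map emptyCell (expand (true ∷ [])) ≡ map emptyCell (expand (increment bs)))
    counter-increment i r []           eq = inj₂ (eq , refl)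
    counter-increment i r (false ∷ bs) refl =
      let (p , q)   = counter-padding i (setCarry false r) K (expand bs)
          (p′ , q′) = counter-idle i (setCarry false r) bs refl
      in inj₁ (cong carry (trans q q′)
             , cong (_ ∷_) (trans p (trans (cong (map emptyCell (replicate K nothing) ++_) p′)
                 (sym (map-++ emptyCell (replicate K nothing) (expand bs))))))
    counter-increment i r (true ∷ bs)  refl with counter-padding i r K (expand bs) | counter-increment i r bs refl
    ... | p , q | inj₁ (q′ , p′) = inj₁ (trans (cong carry q) q′
             , cong (_ ∷_) (trans p (trans (cong (map emptyCell (replicate K nothing) ++_) p′)
                 (sym (map-++ emptyCell (replicate K nothing) (expand (increment bs)))))))
    ... | p , q | inj₂ (q′ , p′) = inj₂ (trans (cong carry q) q′
             , cong (_ ∷_) (trans (cong (_++ map emptyCell (expand (true ∷ []))) p)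
                 (trans (++-assoc (map emptyCell (replicate K nothing)) _ _)
                 (trans (cong (map emptyCell (replicate K nothing) ++_) p′)
                 (sym (map-++ emptyCell (replicate K nothing) (expand (increment bs))))))))

    counter-output : ∀ i r as → C.output i r as ≡ []
    counter-output i r []       = refl
    counter-output i r (a ∷ as) = counter-output i _ as

    countOne-exec : ∀ r h bs → ∃[ r′ ] (countOne ∶ ⟨ r , h , rest (map emptyCell (expand bs)) ⟩ ⇒
      ⟨ r′ , h , rest (map emptyCell (expand (increment bs))) ⟩ ∣ [])
    countOne-exec r h bs = r₁ , emits≡ (trans (++-identityʳ _) (counter-output i (setCarry true r) as))
      (sweep-exec middle)
      where
      i  = readInput x h
      as = map emptyCell (expand bs)
      r₁ = C.finalReg i (setCarry true r) as
      grow = map emptyCell (expand (true ∷ []))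
      middle : when isCarry thenₚ appendCells grow elseₚ act idle ∶
        ⟨ r₁ , h , tape (map cell (C.cells i (setCarry true r) as) ʳ++ lend ∷ []) rend [] ⟩ ⇒
        ⟨ r₁ , h , tape (map cell (map emptyCell (expand (increment bs))) ʳ++ lend ∷ []) rend [] ⟩ ∣ []
      middle with counter-increment i (setCarry true r) bs refl
      ... | inj₁ (c , eq) = if-false c (ends≡
           (cong (λ cs → ⟨ r₁ , h , tape (map cell cs ʳ++ lend ∷ []) rend [] ⟩) eq) (act-exec _))
      ... | inj₂ (c , eq) = if-true c (ends≡ (cong (λ ls → ⟨ r₁ , h , tape ls rend [] ⟩)
        (trans (sym (++-ʳ++ (map cell (C.cells i (setCarry true r) as))))
        (trans (cong (_ʳ++ lend ∷ []) (sym (map-++ cell (C.cells i (setCarry true r) as) grow)))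
               (cong (λ cs → map cell cs ʳ++ lend ∷ []) eq))))
        (appendCells-exec _ grow rend))

    -- Input position `suc i` goes with counter value `i`, because position 0 holds ⊢.
    counting-exec : ∀ d i r → i + d ≡ n → ∃[ r′ ]
      (while notEnd (countOne ⨾ moveHead right) ∶ ⟨ r , suc i , rest (map emptyCell (expand (binaryLSB i))) ⟩ ⇒
        ⟨ r′ , suc n , rest (map emptyCell (counters x)) ⟩ ∣ [])
    counting-exec zero i r eq rewrite trans (sym (+-identityʳ i)) eq = r , while-false (atEnd x)
      where
      atEnd : ∀ y → notEnd r (readInput y (suc (length y))) lend ≡ false
      atEnd []      = refl
      atEnd (c ∷ y) = atEnd y
    counting-exec (suc d) i r eq =
      let i<n       = ≤-trans (m≤m+n (suc i) d) (≤-reflexive (trans (sym (+-suc i d)) eq))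
          (r₁ , e₁) = countOne-exec r (suc i) (binaryLSB i)
          (r₂ , e₂) = counting-exec d (suc i) r₁ (trans (sym (+-suc i d)) eq)
      in r₂ , while-true (inside x i<n) (e₁ ⨾ₑ moveHead-exec right _ _ _)
                (subst (λ h → while notEnd (countOne ⨾ moveHead right) ∶
                   ⟨ r₁ , h , rest (map emptyCell (expand (binaryLSB (suc i)))) ⟩ ⇒
                          ⟨ r₂ , suc n , rest (map emptyCell (counters x)) ⟩ ∣ []) (sym (m≤n⇒m⊓n≡m (s≤s i<n))) e₂)
      where
      inside : ∀ y {i} → i < length y → notEnd r (readInput y (suc i)) lend ≡ true
      inside (c ∷ y) {zero}  _        = refl
      inside (c ∷ y) {suc i} (s≤s lt) = inside y lt

    r₀ : Reg
    r₀ = reg⟨ false , zero , nothing , nothing ⟩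

    measure-exec : ∃[ r′ ]
      (measure ∶ ⟨ r₀ , 0 , tape [] blank [] ⟩ ⇒ ⟨ r′ , 0 , rest (map emptyCell (counters x)) ⟩ ∣ [])
    measure-exec =
      let (r₁ , e) = counting-exec n 0 r₀ refl
      in r₁ , (act-exec _ ⨾ₑ appendCells-exec (lend ∷ []) cs blank ⨾ₑ rewind-exec cs ⨾ₑ moveHead-exec right _ _ _ ⨾ₑ
               e ⨾ₑ rewindInput-exec (suc n) r₁ _)
      where cs = map emptyCell (expand (false ∷ []))

    private
      m  = width x
      cs = Vec.fromList (counters x)
      z  = zeros m
      A  = number (keyName (startKey m))
      D  = number (keyName (starKey m))
      G  = concatMap descriptionTokens (map describe grid)

    0<width : 0 < m
    0<width = subst (0 <_) (sym (expand-length (binaryLSB n))) (≤-trans (bitLength>0 n) (m≤m*n (bitLength n) (suc K)))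

    header-name-emits : ∀ d e → Emits cs 0 (z , z , z) d (emitName noDir noDir (emitHeader e))
      (word (number (keyName (z , z , header e m))))
    header-name-emits d e = plain-name-emits (header e m) (header-emits e)

    extras₁ extras₂ extras₃ : List Token
    extras₁ = number 0 ++ semicolon ∷
              descriptionTokens (0 , inj₂ (binary times) , 1 ∷ 2 ∷ []) ++
              descriptionTokens (2 , inj₂ (binary divide) , 3 ∷ 4 ∷ []) ++
              number 3 ++ comma ∷ op (binary times) ∷ comma ∷ []
    extras₂ = semicolon ∷ number 4 ++ comma ∷ op (binary times) ∷ comma ∷ []
    extras₃ = comma ∷ number 5 ++ semicolon ∷ descriptionTokens (1 , inj₁ 0 , []) ++ descriptionTokens (5 , inj₁ 2 , [])

    extras-exec : ∀ r → ∃[ r′ ] (emitExtras ∶ config cs r 0 (z , z , z) ⇒ config cs r′ 0 (z , z , z) ∣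
      word extras₁ ++ word A ++ word (comma ∷ []) ++ word A ++ word extras₂ ++ word D ++ word extras₃)
    extras-exec r =
      let (r′ , _ , e) = (text-emits extras₁ ⨾ₘ header-name-emits (first r) init ⨾ₘ text-emits (comma ∷ []) ⨾ₘ
                          header-name-emits (first r) init ⨾ₘ text-emits extras₂ ⨾ₘ
                          header-name-emits (first r) star ⨾ₘ text-emits extras₃) r refl
      in r′ , e

    grid-word : concatMap (layer 0<width cs) (strings m) ≡ word G
    grid-word = sym (begin
      word G
        ≡⟨ word-concatMap descriptionTokens (map describe grid) ⟩
      concatMap (word ∘ descriptionTokens) (map describe grid)
        ≡⟨ concatMap-map (word ∘ descriptionTokens) describe grid ⟩
      concatMap gateWord grid
        ≡⟨ concatMap-cartesianProduct gateWord (strings m) (cartesianProduct (strings m) (strings m)) ⟩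
      concatMap (λ τ → concatMap (λ k → gateWord (τ , k)) (cartesianProduct (strings m) (strings m))) (strings m)
        ≡⟨ concatMap-cong (λ τ → concatMap-cartesianProduct (λ k → gateWord (τ , k)) (strings m) (strings m))
          (strings m) ⟩
      concatMap (layer 0<width cs) (strings m) ∎)
      where
      open ≡-Reasoning
      gateWord : Key m → Word
      gateWord k = word (descriptionTokens (describe k))

    reassociate : ∀ (a y s r z : List Token) → (((a ++ y) ++ s) ++ r) ++ z ≡ a ++ y ++ s ++ r ++ z
    reassociate a y s r z = trans (++-assoc ((a ++ y) ++ s) r z)
      (trans (++-assoc (a ++ y) s (r ++ z)) (++-assoc a y (s ++ r ++ z)))

    -- Associativity only: the tokens are regrouped into the pieces that the program writes one
    -- after another.
    tokens-split : headerTokens 0 descriptions ++ number 0 ≡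
      extras₁ ++ A ++ comma ∷ A ++ extras₂ ++ D ++ extras₃ ++ G ++ number 0
    tokens-split = cong (extras₁ ++_)
      (trans (reassociate A (comma ∷ A ++ []) (semicolon ∷ []) (remaining 3) (number 0))
      (cong (λ ts → A ++ comma ∷ ts)
        (trans (cong (_++ semicolon ∷ remaining 3 ++ number 0) (++-identityʳ A))
        (cong (λ ts → A ++ extras₂ ++ ts)
          (reassociate D (comma ∷ number 5 ++ []) (semicolon ∷ []) (remaining 4) (number 0))))))
      where
      remaining : ℕ → List Token
      remaining j = concatMap descriptionTokens (List.drop j extraDescriptions ++ map describe grid)

    reduction-word : reduction x ≡
      (word extras₁ ++ word A ++ word (comma ∷ []) ++ word A ++ word extras₂ ++ word D ++ word extras₃) ++
      word G ++ word (number 0)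
    reduction-word = trans (cong word tokens-split) (cong (word extras₁ ++_)
      (trans (split A _) (trans (cong (λ w → word A ++ word (comma ∷ []) ++ w)
        (trans (split A _) (trans (cong (λ w → word A ++ word extras₂ ++ w)
          (trans (split D _) (trans (cong (λ w → word D ++ word extras₃ ++ w) (word-++ G (number 0)))
            (sym (++-assoc (word D) (word extras₃) _)))))
          (sym (++-assoc (word A) (word extras₂ ++ word D ++ word extras₃) _)))))
        (sym (++-assoc (word A) (word (comma ∷ []) ++ word A ++ word extras₂ ++ word D ++ word extras₃) _)))))
      where
      split : ∀ ts us → word (ts ++ us) ≡ word ts ++ word us
      split = word-++

    program-exec : ∃[ r′ ] (program ∶ ⟨ r₀ , 0 , tape [] blank [] ⟩ ⇒ config cs r′ 0 (z , z , z) ∣ reduction x)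
    program-exec =
      let (r₁ , e₁) = measure-exec
          (r₂ , e₂) = extras-exec r₁
          (r₃ , e₃) = emitGrid-exec 0<width cs r₂
      in r₃ , emits≡ (trans (cong (λ w →
           (word extras₁ ++ word A ++ word
             (comma ∷ []) ++ word A ++ word extras₂ ++ word D ++ word extras₃) ++ w ++ word (number 0)) grid-word)
                            (sym reduction-word))
                (ends≡ (cong (λ as → ⟨ r₁ , 0 , rest as ⟩) (layout-empty (counters x))) e₁ ⨾ₑ e₂ ⨾ₑ e₃ ⨾ₑ
                  text-exec (number 0) _)

    -- `suc K` cells for each counter bit, of which there are at most one more than the logarithm,
    -- and 2 for the end markers.
    config-size : ∀ r h → tapeSize (work (config cs r h (z , z , z))) ≤ (suc K + 2) * ⌊log₂ n ⌋ + (suc K + 2)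
    config-size r h = begin
      suc (length (map cell (layout cs (z , z , z)) ++ rend ∷ []))
        ≡⟨ cong suc (trans (length-++ (map cell (layout cs (z , z , z))))
          (cong (_+ 1) (trans (length-map cell (layout cs (z , z , z))) (layout-length cs (z , z , z))))) ⟩
      suc (m + 1)
        ≡⟨ sym (+-suc m 1) ⟩
      m + 2
        ≡⟨ cong (_+ 2) (expand-length (binaryLSB n)) ⟩
      bitLength n * suc K + 2
        ≤⟨ +-monoˡ-≤ 2 (*-monoˡ-≤ (suc K) (bitLength≤1+log₂ n)) ⟩
      suc ⌊log₂ n ⌋ * suc K + 2
        ≤⟨ +-monoʳ-≤ (suc ⌊log₂ n ⌋ * suc K) (m≤n*m 2 (suc ⌊log₂ n ⌋)) ⟩
      suc ⌊log₂ n ⌋ * suc K + suc ⌊log₂ n ⌋ * 2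
        ≡⟨ sym (*-distribˡ-+ (suc ⌊log₂ n ⌋) (suc K) 2) ⟩
      suc ⌊log₂ n ⌋ * (suc K + 2)
        ≡⟨ trans (+-comm (suc K + 2) _) (cong (_+ (suc K + 2)) (*-comm ⌊log₂ n ⌋ (suc K + 2))) ⟩
      (suc K + 2) * ⌊log₂ n ⌋ + (suc K + 2) ∎
      where
      open ≤-Reasoning
      layout-length : ∀ {m} (cs : Vec (Maybe Bool) m) k → length (layout cs k) ≡ m
      layout-length []       k                       = refl
      layout-length (c ∷ cs) (t ∷ τ , j ∷ h , d ∷ s) = cong suc (layout-length cs (τ , h , s))

  reduction-logSpace : LogSpaceComputable reduction
  reduction-logSpace = compile reduction (suc K + 2)
      (λ x → _ , proj₂ (program-exec x) , config-size x (proj₁ (program-exec x)) 0)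
    where open Compile blank Reg-finite Sym-finite reg⟨ false , zero , nothing , nothing ⟩ program

-- Unique readability of the encoding

readToken : Bool → Bool → Bool → Bool → Token
readToken false false false b     = digit b
readToken false false true  false = comma
readToken false false true  true  = semicolon
readToken true  false false false = op complement
readToken true  false false true  = op (binary union)
readToken true  false true  false = op (binary intersection)
readToken true  false true  true  = op (binary plus)
readToken true  true  false false = op (binary times)
readToken _     _     _     _     = op (binary divide)

readTokens : Word → List Token
readTokens (a ∷ b ∷ c ∷ d ∷ w) = readToken a b c d ∷ readTokens w
readTokens _                   = []

readTokens-word : ∀ ts → readTokens (word ts) ≡ ts
readTokens-word []                             = refl
readTokens-word (digit b ∷ ts)                 = cong (digit b ∷_) (readTokens-word ts)
readTokens-word (comma ∷ ts)                   = cong (_ ∷_) (readTokens-word ts)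
readTokens-word (semicolon ∷ ts)               = cong (_ ∷_) (readTokens-word ts)
readTokens-word (op complement ∷ ts)           = cong (_ ∷_) (readTokens-word ts)
readTokens-word (op (binary union) ∷ ts)       = cong (_ ∷_) (readTokens-word ts)
readTokens-word (op (binary intersection) ∷ ts) = cong (_ ∷_) (readTokens-word ts)
readTokens-word (op (binary plus) ∷ ts)        = cong (_ ∷_) (readTokens-word ts)
readTokens-word (op (binary times) ∷ ts)       = cong (_ ∷_) (readTokens-word ts)
readTokens-word (op (binary divide) ∷ ts)      = cong (_ ∷_) (readTokens-word ts)

word-injective : ∀ {ts us} → word ts ≡ word us → ts ≡ us
word-injective {ts} {us} eq = trans (sym (readTokens-word ts)) (trans (cong readTokens eq) (readTokens-word us))

data Separator : Token → Set where
  comma     : Separator comma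
  semicolon : Separator semicolon

-- A separator is not a digit, so it shows where the numeral ends.
digits-unique : ∀ xs ys {t u r s} → Separator t → Separator u →
  map digit xs ++ t ∷ r ≡ map digit ys ++ u ∷ s → xs ≡ ys × t ∷ r ≡ u ∷ s
digits-unique []       []       _     _     eq = refl , eq
digits-unique []       (y ∷ ys) comma _     ()
digits-unique []       (y ∷ ys) semicolon _ ()
digits-unique (x ∷ xs) []       _ comma     ()
digits-unique (x ∷ xs) []       _ semicolon ()
digits-unique (x ∷ xs) (y ∷ ys) p q eq with ∷-injective eq
... | refl , eq′ = let (e , f) = digits-unique xs ys p q eq′ in cong (x ∷_) e , f

number-unique : ∀ m n {t u r s} → Separator t → Separator u →
  number m ++ t ∷ r ≡ number n ++ u ∷ s → m ≡ n × t ∷ r ≡ u ∷ s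
number-unique m n p q eq = let (e , f) = digits-unique (toBinary m) (toBinary n) p q eq in toBinary-injective e , f

digit-injective : ∀ {b c} → digit b ≡ digit c → b ≡ c
digit-injective refl = refl

nameTokens-separator : ∀ ps r → ∃[ t ] ∃[ r′ ] (Separator t × nameTokens ps ++ semicolon ∷ r ≡ t ∷ r′)
nameTokens-separator []       r = _ , _ , semicolon , refl
nameTokens-separator (p ∷ ps) r = _ , _ , comma , refl

nameTokens-unique : ∀ ps qs {r s} → nameTokens ps ++ semicolon ∷ r ≡ nameTokens qs ++ semicolon ∷ s → ps ≡ qs × r ≡ s
nameTokens-unique []       []       eq = refl , ∷-injectiveʳ eq
nameTokens-unique (p ∷ ps) (q ∷ qs) {r} {s} eq
  with nameTokens-separator ps r | nameTokens-separator qs s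
... | _ , _ , c , e | _ , _ , d , f =
  let (p≡q , eq′) = number-unique p q c d (trans (cong (number p ++_) (sym e))
         (trans (sym (++-assoc (number p) (nameTokens ps) _)) (trans (∷-injectiveʳ eq)
         (trans (++-assoc (number q) (nameTokens qs) _) (cong (number q ++_) f)))))
      (ps≡qs , r≡s) = nameTokens-unique ps qs (trans e (trans eq′ (sym f)))
  in cong₂ _∷_ p≡q ps≡qs , r≡s

label-unique : ∀ k l {t u r s} → Separator t → Separator u →
  descriptionLabel k ++ t ∷ r ≡ descriptionLabel l ++ u ∷ s → k ≡ l × t ∷ r ≡ u ∷ s
label-unique (inj₁ a) (inj₁ b) p q eq = let (e , f) = number-unique a b p q eq in cong inj₁ e , f
label-unique (inj₂ o) (inj₂ .o) p q refl = refl , refl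
label-unique (inj₁ a) (inj₂ o) p q eq with toBinary a
label-unique (inj₁ a) (inj₂ o) ()        q refl | []
label-unique (inj₁ a) (inj₂ o) p q () | b ∷ bs
label-unique (inj₂ o) (inj₁ a) p q eq with toBinary a
label-unique (inj₂ o) (inj₁ a) p ()        refl | []
label-unique (inj₂ o) (inj₁ a) p q () | b ∷ bs

description-++ : ∀ n l ps r → descriptionTokens (n , l , ps) ++ r ≡
  number n ++ comma ∷ descriptionLabel l ++ nameTokens ps ++ semicolon ∷ r
description-++ n l ps r = trans (++-assoc (number n) _ r) (cong (λ ts → number n ++ comma ∷ ts)
  (trans (++-assoc (descriptionLabel l) _ r) (cong (descriptionLabel l ++_) (++-assoc (nameTokens ps) _ r))))

description-unique : ∀ d e {r s} → descriptionTokens d ++ r ≡ descriptionTokens e ++ s → d ≡ e × r ≡ s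
description-unique (n , l , ps) (n′ , l′ , ps′) {r} {s} eq
  with nameTokens-separator ps r | nameTokens-separator ps′ s
... | _ , _ , c , e | _ , _ , d , f
  with number-unique n n′ comma comma (trans (sym (description-++ n l ps r)) (trans eq (description-++ n′ l′ ps′ s)))
... | refl , eq₁
  with label-unique l l′ c d (trans (cong (descriptionLabel l ++_) (sym e))
    (trans (∷-injectiveʳ eq₁) (cong (descriptionLabel l′ ++_) f)))
... | refl , eq₂
  with nameTokens-unique ps ps′ (trans e (trans eq₂ (sym f)))
... | refl , r≡s = refl , r≡s

-- No separator announces the final number, but every description contains a comma and the final
-- number does not, so the end of the gate list is recognisable.
descriptions-unique : ∀ ds es b c → concatMap descriptionTokens ds ++ number b ≡
  concatMap descriptionTokens es ++ number c →
  ds ≡ es × b ≡ c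
descriptions-unique [] [] b c eq = refl , toBinary-injective (map-injective digit-injective eq)
descriptions-unique [] ((n , l , ps) ∷ es) b c eq = ⊥-elim (no-comma (toBinary b) (toBinary n)
    (trans eq (trans (++-assoc (descriptionTokens (n , l , ps)) _ _) (description-++ n l ps _))))
  where
  no-comma : ∀ xs ys {r} → ¬ map digit xs ≡ map digit ys ++ comma ∷ r
  no-comma (x ∷ xs) (y ∷ ys) eq = no-comma xs ys (∷-injectiveʳ eq)
  no-comma []       []       ()
  no-comma []       (_ ∷ _)  ()
descriptions-unique (d ∷ ds) [] b c eq =
  let (e , f) = descriptions-unique [] (d ∷ ds) c b (sym eq) in sym e , sym f
descriptions-unique (d ∷ ds) (e ∷ es) b c eq
  with description-unique d e (trans (sym (++-assoc (descriptionTokens d) _ _))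
    (trans eq (++-assoc (descriptionTokens e) _ _)))
... | refl , eq′ = let (p , q) = descriptions-unique ds es b c eq′ in cong (d ∷_) p , q

header-unique : ∀ o o′ ds es b c → headerTokens o ds ++ number b ≡ headerTokens o′ es ++ number c →
  o ≡ o′ × ds ≡ es × b ≡ c
header-unique o o′ ds es b c eq =
  let (p , q) = number-unique o o′ semicolon semicolon (trans (sym (++-assoc (number o) _ (number b)))
                  (trans eq (++-assoc (number o′) _ (number c))))
  in p , descriptions-unique ds es b c (∷-injectiveʳ q)

-- Circuits and their gate descriptions.

labelOf : ∀ {O V} → Gate O V → ℕ ⊎ Op
labelOf (input a)         = inj₁ a
labelOf (negate _ _)      = inj₂ complement
labelOf (combine σ _ _ _) = inj₂ (binary σ)

module _ {O : Pred Op 0ℓ} (C : Circuit O) where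

  open Circuit C

  describeGate : Fin size → Description
  describeGate g = name g , labelOf (gate g) , map name (preds (gate g))

  gateTokens-description : ∀ g → gateTokens C g ≡ descriptionTokens (describeGate g)
  gateTokens-description g with gate g
  ... | input a         = refl
  ... | negate _ p      = refl
  ... | combine σ _ p q = refl

  encode-header : ∀ gs b → encode C gs b ≡ word (headerTokens (name output) (map describeGate gs) ++ number b)
  encode-header gs b = cong (λ ts → word ((number (name output) ++ semicolon ∷ ts) ++ number b))
    (trans (concatMap-cong gateTokens-description gs) (sym (concatMap-map descriptionTokens describeGate gs)))

mapGate : ∀ {O V W} → (V → W) → Gate O V → Gate O W
mapGate f (input a)         = input a
mapGate f (negate o p)      = negate o (f p)
mapGate f (combine σ o p q) = combine σ o (f p) (f q)

labelOf-mapGate : ∀ {O V W} (f : V → W) (γ : Gate O V) → labelOf (mapGate f γ) ≡ labelOf γ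
labelOf-mapGate f (input a)         = refl
labelOf-mapGate f (negate o p)      = refl
labelOf-mapGate f (combine σ o p q) = refl

preds-mapGate : ∀ {O V W} (f : V → W) (γ : Gate O V) → preds (mapGate f γ) ≡ map f (preds γ)
preds-mapGate f (input a)         = refl
preds-mapGate f (negate o p)      = refl
preds-mapGate f (combine σ o p q) = refl

lookup-injective : ∀ {A : Set} {xs : List A} → Unique xs → ∀ {i j} → lookup xs i ≡ lookup xs j → i ≡ j
lookup-injective (px ∷ u) {zero}  {zero}  eq = refl
lookup-injective (px ∷ u) {zero}  {suc j} eq = ⊥-elim (All.lookup px (∈-lookup j) eq)
lookup-injective (px ∷ u) {suc i} {zero}  eq = ⊥-elim (All.lookup px (∈-lookup i) (sym eq))
lookup-injective (px ∷ u) {suc i} {suc j} eq = cong suc (lookup-injective u eq)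

-- A level that strictly increases from a gate to its predecessors excludes cycles; if the list is
-- sorted by level as well, no gate can follow one of its predecessors.
module FromList {O : Pred Op 0ℓ} {A : Set} (L : List A) (complete : ∀ a → a ∈ˡ L) (unique : Unique L)
                (nm : A → ℕ) (nm-injective : ∀ {a b} → nm a ≡ nm b → a ≡ b) (γ : A → Gate O A)
                (level : A → ℕ) (level-< : ∀ a p → p ∈ˡ preds (γ a) → level a < level p)
                (sorted : AllPairs (λ a b → level a ≤ level b) L) (out : A) where

  index : A → Fin (length L)
  index a = Any.index (complete a)

  lookup-of-index : ∀ a → lookup L (index a) ≡ a
  lookup-of-index a = sym (lookup-index (complete a))

  gateAt : Fin (length L) → Gate O (Fin (length L))
  gateAt i = mapGate index (γ (lookup L i))

  level-edge : ∀ {p g} → Edge gateAt p g → level (lookup L g) < level (lookup L p)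
  level-edge {p} {g} e with ∈-map⁻ index (subst (p ∈ˡ_) (preds-mapGate index (γ (lookup L g))) e)
  ... | q , q∈ , refl = subst (λ a → level (lookup L g) < level a) (sym (lookup-of-index q)) (level-< _ q q∈)

  level-path : ∀ {p g} → TransClosure (Edge gateAt) p g → level (lookup L g) < level (lookup L p)
  level-path [ e ]    = level-edge e
  level-path (e ∷ es) = <-trans (level-path es) (level-edge e)

  circuit : Circuit O
  circuit = record
    { size           = length L
    ; name           = λ i → nm (lookup L i)
    ; name-injective = λ eq → lookup-injective unique (nm-injective eq)
    ; gate           = gateAt
    ; output         = index out
    ; acyclic        = λ c → <-irrefl refl (level-path c)
    }

  describe : A → Description
  describe a = nm a , labelOf (γ a) , map nm (preds (γ a))

  describeGate-lookup : ∀ i → describeGate circuit i ≡ describe (lookup L i)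
  describeGate-lookup i = cong₂ (λ l ps → nm (lookup L i) , l , ps) (labelOf-mapGate index (γ (lookup L i)))
    (trans (cong (map (nm ∘ lookup L)) (preds-mapGate index (γ (lookup L i))))
    (trans (sym (map-∘ (preds (γ (lookup L i)))))
           (map-cong (λ a → cong nm (lookup-of-index a)) (preds (γ (lookup L i))))))

  lookup-allFin : map (lookup L) (allFin (length L)) ≡ L
  lookup-allFin = trans (map-tabulate (λ i → i) (lookup L)) (tabulate-lookup L)

  descriptions : map (describeGate circuit) (allFin (length L)) ≡ map describe L
  descriptions = trans (map-cong describeGate-lookup (allFin (length L)))
    (trans (map-∘ (allFin (length L))) (cong (map describe) lookup-allFin))

  reverseTopological : Circuit.ReverseTopological circuit (allFin (length L))
  reverseTopological = ↭-refl , AllPairs.map (λ le e → <⇒≱ (level-edge e) le)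
    (AllPairs.map⁻ (subst (AllPairs _) (sym lookup-allFin) sorted))

  circuit-encode : ∀ b → encode circuit (allFin (length L)) b ≡
    word (headerTokens (nm out) (map describe L) ++ number b)
  circuit-encode b = trans (encode-header circuit (allFin (length L)) b)
    (cong₂ (λ a ds → word (headerTokens (nm a) ds ++ number b)) (lookup-of-index out) descriptions)

-- Values of gates that are known only by their descriptions.

private
  module ⇔ {A B : Set} (e : A ⇔ B) = Equivalence e

⊗-comm : ∀ {A B : Pred ℕ 0ℓ} {n} → (A ⊗ B) n → (B ⊗ A) n
⊗-comm (a , b , a∈ , b∈ , eq) = b , a , b∈ , a∈ , trans eq (*-comm a b)

⊗-mono : ∀ {A A′ B B′ : Pred ℕ 0ℓ} → (∀ n → A n → A′ n) → (∀ n → B n → B′ n) → ∀ n → (A ⊗ B) n → (A′ ⊗ B′) n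
⊗-mono f g n (a , b , a∈ , b∈ , eq) = a , b , f a a∈ , g b b∈ , eq

⊘-mono : ∀ {A A′ B B′ : Pred ℕ 0ℓ} → (∀ n → A n → A′ n) → (∀ n → B n → B′ n) → ∀ n → (A ⊘ B) n → (A′ ⊘ B′) n
⊘-mono f g n (a , b , a∈ , b∈ , b≢0 , eq) = a , b , f a a∈ , g b b∈ , b≢0 , eq

-- `C` is an arbitrary circuit with the prescribed descriptions, possibly with its gates indexed
-- differently, so its gates are matched with the intended nodes through their names.
module Semantics {O : Pred Op 0ℓ} {A : Set} (L : List A) (complete : ∀ a → a ∈ˡ L)
                 (nm : A → ℕ) (nm-injective : ∀ {a b} → nm a ≡ nm b → a ≡ b) (γ : A → Gate O A)
                 (C : Circuit O) (gs : List (Fin (Circuit.size C))) (all-gs : ∀ g → g ∈ˡ gs)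
                 (same : map (describeGate C) gs ≡ map (λ a → nm a , labelOf (γ a) , map nm (preds (γ a))) L) where

  open Circuit C

  description-of : ∀ a g → name g ≡ nm a → describeGate C g ≡ (nm a , labelOf (γ a) , map nm (preds (γ a)))
  description-of a g eq with ∈-map⁻ _ (subst (describeGate C g ∈ˡ_) same (∈-map⁺ (describeGate C) (all-gs g)))
  ... | a′ , _ , eq′ = trans eq′ (cong (λ a → nm a , labelOf (γ a) , map nm (preds (γ a)))
                         (nm-injective (trans (sym (cong proj₁ eq′)) eq)))

  -- Quantifying over all accessibility proofs allows for whichever proof `resultAcc` hands to a
  -- predecessor.
  Denotes : A → Pred ℕ 0ℓ → Set
  Denotes a P = ∀ g → name g ≡ nm a → ∀ ac n → resultAcc g ac n ⇔ P n

  label-of : ∀ a g → name g ≡ nm a → labelOf (gate g) ≡ labelOf (γ a)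
  label-of a g eq = cong (λ d → proj₁ (proj₂ d)) (description-of a g eq)

  preds-of : ∀ a g → name g ≡ nm a → map name (preds (gate g)) ≡ map nm (preds (γ a))
  preds-of a g eq = cong (λ d → proj₂ (proj₂ d)) (description-of a g eq)

  denotes-input : ∀ a {v} → γ a ≡ input v → Denotes a (_≡ v)
  denotes-input a {v} eq g named (acc rs) n = eval (gate g) _ (trans (label-of a g named) (cong labelOf eq))
    where
    eval : ∀ δ I → labelOf δ ≡ inj₁ v → evalGate δ I n ⇔ n ≡ v
    eval (input w) I refl = mk⇔ sym sym

  module _ (a p q : A) {P Q : Pred ℕ 0ℓ} (p-denotes : Denotes p P) (q-denotes : Denotes q Q) where

    private
      -- The results of the predecessors are bundled with their properties, so that `eval` can match
      -- on the gate on which their types depend.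
      Arguments : Gate O (Fin size) → Set₁
      Arguments δ = Σ[ I ∈ (∀ p → p ∈ˡ preds δ → Pred ℕ 0ℓ) ]
        (∀ g g∈ → name g ≡ nm p → ∀ n → I g g∈ n ⇔ P n) × (∀ g g∈ → name g ≡ nm q → ∀ n → I g g∈ n ⇔ Q n)

      arguments : ∀ g (rs : ∀ {h} → h ⟶ g → Acc _⟶_ h) → Arguments (gate g)
      arguments g rs = (λ h h⟶g → resultAcc h (rs h⟶g))
        , (λ h h⟶g eq → p-denotes h eq (rs h⟶g)) , (λ h h⟶g eq → q-denotes h eq (rs h⟶g))

      names : ∀ {σ o} → γ a ≡ combine σ o p q → ∀ g → name g ≡ nm a →
              labelOf (gate g) ≡ inj₂ (binary σ) × map name (preds (gate g)) ≡ nm p ∷ nm q ∷ []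
      names eq g named = trans (label-of a g named) (cong labelOf eq)
                       , trans (preds-of a g named) (cong (λ δ → map nm (preds δ)) eq)

    -- Ordering the operands by name may exchange them, which commutativity undoes.
    denotes-times : ∀ {o} → γ a ≡ combine times o p q → Denotes a (P ⊗ Q)
    denotes-times eq g named (acc rs) n =
      eval (gate g) (arguments g rs) (proj₁ (names eq g named)) (proj₂ (names eq g named))
      where
      eval : ∀ δ (args : Arguments δ) → labelOf δ ≡ inj₂ (binary times) → map name (preds δ) ≡ nm p ∷ nm q ∷ [] →
             evalGate δ (proj₁ args) n ⇔ (P ⊗ Q) n
      eval (combine times _ p′ q′) (I , IP , IQ) refl eq with does (name p′ ≤? name q′)
      ... | true  = mk⇔ (⊗-mono (λ k → ⇔.to (IP′ k)) (λ k → ⇔.to (IQ′ k)) n)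
                        (⊗-mono (λ k → ⇔.from (IP′ k)) (λ k → ⇔.from (IQ′ k)) n)
        where
        IP′ = IP p′ (here refl) (∷-injectiveˡ eq)
        IQ′ = IQ q′ (there (here refl)) (∷-injectiveˡ (∷-injectiveʳ eq))
      ... | false = mk⇔ (λ r → ⊗-mono (λ k → ⇔.to (IP′ k)) (λ k → ⇔.to (IQ′ k)) n (⊗-comm {I q′ _} {I p′ _} r))
                        (λ r → ⊗-comm {I p′ _} {I q′ _} (⊗-mono (λ k → ⇔.from (IP′ k)) (λ k → ⇔.from (IQ′ k)) n r))
        where
        IP′ = IP p′ (here refl) (∷-injectiveˡ eq)
        IQ′ = IQ q′ (there (here refl)) (∷-injectiveˡ (∷-injectiveʳ eq))

    -- Division does not commute; the order of the names ensures that `p` stays the dividend.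
    denotes-divide : ∀ {o} → nm p ≤ nm q → γ a ≡ combine divide o p q → Denotes a (P ⊘ Q)
    denotes-divide le eq g named (acc rs) n =
      eval (gate g) (arguments g rs) (proj₁ (names eq g named)) (proj₂ (names eq g named))
      where
      eval : ∀ δ (args : Arguments δ) → labelOf δ ≡ inj₂ (binary divide) → map name (preds δ) ≡ nm p ∷ nm q ∷ [] →
             evalGate δ (proj₁ args) n ⇔ (P ⊘ Q) n
      eval (combine divide _ p′ q′) (I , IP , IQ) refl eq with name p′ ≤ᵇ name q′ in e
      ... | true  = mk⇔ (⊘-mono (λ k → ⇔.to (IP′ k)) (λ k → ⇔.to (IQ′ k)) n)
                        (⊘-mono (λ k → ⇔.from (IP′ k)) (λ k → ⇔.from (IQ′ k)) n)
        where
        IP′ = IP p′ (here refl) (∷-injectiveˡ eq)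
        IQ′ = IQ q′ (there (here refl)) (∷-injectiveˡ (∷-injectiveʳ eq))
      ... | false = ⊥-elim (subst T e (≤⇒≤ᵇ
           (subst₂ _≤_ (sym (∷-injectiveˡ eq)) (sym (∷-injectiveˡ (∷-injectiveʳ eq))) le)))

  denotes-product : ∀ a p q {u v o} → γ a ≡ combine times o p q → Denotes p (_≡ u) → Denotes q (_≡ v) →
    Denotes a (_≡ u * v)
  denotes-product a p q eq dp dq g named ac n with denotes-times a p q dp dq eq g named ac n
  ... | e = mk⇔ (λ r → multiply (⇔.to e r)) (λ eq → ⇔.from e (_ , _ , refl , refl , eq))
    where
    multiply : ∀ {u v n} → ((_≡ u) ⊗ (_≡ v)) n → n ≡ u * v
    multiply (_ , _ , refl , refl , eq) = eq

-- The circuit of configurations and its result.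

data Extra : Set where
  outE quotientE numeratorE denominatorE zeroE twoE : Extra

module Acceptance (b K : ℕ) (rule : Rule b) where

  open Rule rule
  open Digits b
  open Sweeps b using (Key)
  open Reduction b K rule
  open Correctness b K rule

  O : Pred Op 0ℓ
  O = ｛ binary times ｝ ∪ ｛ binary divide ｝

  module _ (x : Word) where

    open Graph x

    private
      m = width x
      S = strings m

    Node : Set
    Node = Extra ⊎ Key m

    extras : List Extra
    extras = outE ∷ quotientE ∷ numeratorE ∷ denominatorE ∷ zeroE ∷ twoE ∷ []

    nodes : List Node
    nodes = map inj₁ extras ++ map inj₂ grid

    extraName : Extra → ℕ
    extraName outE         = 0
    extraName zeroE        = 1
    extraName quotientE    = 2
    extraName numeratorE   = 3
    extraName denominatorE = 4
    extraName twoE         = 5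

    nodeName : Node → ℕ
    nodeName (inj₁ e) = extraName e
    nodeName (inj₂ k) = keyName k

    product quotient : Node → Node → Gate O Node
    product  = combine times (inj₁ refl)
    quotient = combine divide (inj₂ refl)

    keyGate : Key m → Gate O Node
    keyGate k@(τ , h , s) = if overflow τ then input (leafLabel (firstDigit s))
      else product (inj₂ (nextKey false k)) (inj₂ (nextKey true k))

    nodeGate : Node → Gate O Node
    nodeGate (inj₁ outE)         = product (inj₁ zeroE) (inj₁ quotientE)
    nodeGate (inj₁ quotientE)    = quotient (inj₁ numeratorE) (inj₁ denominatorE)
    nodeGate (inj₁ numeratorE)   = product (inj₂ (startKey m)) (inj₂ (startKey m))
    nodeGate (inj₁ denominatorE) = product (inj₂ (starKey m)) (inj₁ twoE)
    nodeGate (inj₁ zeroE)        = input 0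
    nodeGate (inj₁ twoE)         = input 2
    nodeGate (inj₂ k)            = keyGate k

    -- Nondecreasing in the order in which the gates are listed, which is why `zeroE`, listed after
    -- numerator and denominator, has level 2. Configurations follow from 4 on, by time.
    level : Node → ℕ
    level (inj₁ outE)         = 0
    level (inj₁ quotientE)    = 1
    level (inj₁ numeratorE)   = 2
    level (inj₁ denominatorE) = 2
    level (inj₁ zeroE)        = 2
    level (inj₁ twoE)         = 3
    level (inj₂ (τ , _))      = 4 + val τ

    complete : ∀ a → a ∈ˡ nodes
    complete (inj₁ e) = ∈-++⁺ˡ (∈-map⁺ inj₁ (∈-extras e))
      where
      ∈-extras : ∀ e → e ∈ˡ extras
      ∈-extras outE         = here refl
      ∈-extras quotientE    = there (here refl)
      ∈-extras numeratorE   = there (there (here refl))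
      ∈-extras denominatorE = there (there (there (here refl)))
      ∈-extras zeroE        = there (there (there (there (here refl))))
      ∈-extras twoE         = there (there (there (there (there (here refl)))))
    complete (inj₂ (τ , h , s)) = ∈-++⁺ʳ (map inj₁ extras) (∈-map⁺ inj₂
      (∈-cartesianProduct⁺ (∈-strings τ) (∈-cartesianProduct⁺ (∈-strings h) (∈-strings s))))

    strings-sorted : AllPairs (λ v w → val v < val w) S
    strings-sorted = AllPairs.map⁺ (AllPairs.applyUpTo⁺₁ (λ i → i) (base ^ m)
      (λ i<j j<N → subst₂ _<_ (sym (val-digits m (<-trans i<j j<N))) (sym (val-digits m j<N)) i<j))

    strings-unique : Unique S
    strings-unique = AllPairs.map (λ { lt refl → <-irrefl refl lt }) strings-sorted

    unique : Unique nodes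
    unique = Unique.++⁺ (Unique.map⁺ inj₁-injective extras-unique)
      (Unique.map⁺ inj₂-injective (Unique.cartesianProduct⁺ strings-unique
        (Unique.cartesianProduct⁺ strings-unique strings-unique)))
      disjoint
      where
      extras-unique : Unique extras
      extras-unique = ((λ ()) ∷ (λ ()) ∷ (λ ()) ∷ (λ ()) ∷ (λ ()) ∷ []) ∷ ((λ ()) ∷ (λ ()) ∷ (λ ()) ∷ (λ ()) ∷ []) ∷
        ((λ ()) ∷ (λ ()) ∷ (λ ()) ∷ []) ∷ ((λ ()) ∷ (λ ()) ∷ []) ∷ ((λ ()) ∷ []) ∷ [] ∷ []
      disjoint : ∀ {a} → ¬ (a ∈ˡ map inj₁ extras × a ∈ˡ map inj₂ grid)
      disjoint (p , q) with ∈-map⁻ inj₁ p | ∈-map⁻ inj₂ q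
      ... | _ , _ , refl | _ , _ , ()

    sorted-product : ∀ {B : Set} {S : List (Vec Digit m)} (bs : List B) → AllPairs (λ v w → val v < val w) S →
      AllPairs (λ p q → val (proj₁ p) ≤ val (proj₁ q)) (cartesianProduct S bs)
    sorted-product bs []       = []
    sorted-product {S = v ∷ S} bs (a ∷ as) = AllPairs.++⁺ (AllPairs.map⁺ (equal bs)) (sorted-product bs as)
      (All.map⁺ (All.universal (λ _ → All.tabulate
        (λ p∈ → <⇒≤ (All.lookup a (proj₁ (∈-cartesianProduct⁻ S bs p∈))))) bs))
      where
      equal : ∀ bs → AllPairs (λ _ _ → val v ≤ val v) bs
      equal []       = []
      equal (c ∷ cs) = All.universal (λ _ → ≤-refl) cs ∷ equal cs

    sorted : AllPairs (λ a c → level a ≤ level c) nodes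
    sorted = AllPairs.++⁺ extras-sorted
      (AllPairs.map⁺ (AllPairs.map (+-monoʳ-≤ 4) (sorted-product (cartesianProduct S S) strings-sorted)))
      (All.map⁺ {f = inj₁} (All.universal
        (λ e → All.map⁺ (All.universal (λ k → ≤-trans (extra-level e) (m≤m+n 4 _)) grid)) extras))
      where
      extra-level : ∀ e → level (inj₁ e) ≤ 4
      extra-level outE         = z≤n
      extra-level quotientE    = s≤s z≤n
      extra-level numeratorE   = s≤s (s≤s z≤n)
      extra-level denominatorE = s≤s (s≤s z≤n)
      extra-level zeroE        = s≤s (s≤s z≤n)
      extra-level twoE         = s≤s (s≤s (s≤s z≤n))
      2≤2 : 2 ≤ 2
      2≤2 = ≤-refl
      2≤3 : 2 ≤ 3
      2≤3 = n≤1+n 2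
      extras-sorted : AllPairs (λ a c → level a ≤ level c) (map inj₁ extras)
      extras-sorted = (z≤n ∷ z≤n ∷ z≤n ∷ z≤n ∷ z≤n ∷ []) ∷
        (s≤s z≤n ∷ s≤s z≤n ∷ s≤s z≤n ∷ s≤s z≤n ∷ []) ∷
        (2≤2 ∷ 2≤2 ∷ 2≤3 ∷ []) ∷ (2≤2 ∷ 2≤3 ∷ []) ∷ (2≤3 ∷ []) ∷ [] ∷ []

    level-< : ∀ a p → p ∈ˡ preds (nodeGate a) → level a < level p
    level-< (inj₁ outE)         _ (here refl)         = s≤s z≤n
    level-< (inj₁ outE)         _ (there (here refl)) = s≤s z≤n
    level-< (inj₁ quotientE)    _ (here refl)         = s≤s (s≤s z≤n)
    level-< (inj₁ quotientE)    _ (there (here refl)) = s≤s (s≤s z≤n)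
    level-< (inj₁ numeratorE)   _ (here refl)         = s≤s (s≤s (s≤s z≤n))
    level-< (inj₁ numeratorE)   _ (there (here refl)) = s≤s (s≤s (s≤s z≤n))
    level-< (inj₁ denominatorE) _ (here refl)         = s≤s (s≤s (s≤s z≤n))
    level-< (inj₁ denominatorE) _ (there (here refl)) = s≤s (s≤s (s≤s z≤n))
    level-< (inj₂ (τ , h , s))  p p∈ with overflow τ in eq
    level-< (inj₂ (τ , h , s)) _ (here refl)         | false = ≤-reflexive (cong (4 +_) (sym (no-overflow-val τ eq)))
    level-< (inj₂ (τ , h , s)) _ (there (here refl)) | false = ≤-reflexive (cong (4 +_) (sym (no-overflow-val τ eq)))

    -- Three tracks with at least one digit each, whose code has at least two bits. With the leading
    -- one, such a name has at least seven binary digits, whereas the names 0 to 5 have at most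
    -- three.
    nameBits-length : ∀ (k : Key m) → 6 ≤ length (nameBits k)
    nameBits-length (τ , h , s) = ≤-trans (+-mono-≤ two (+-mono-≤ two two)) (≤-reflexive (sym
      (trans (length-++ (codes τ)) (cong₂ _+_ (codes-length τ)
        (trans (length-++ (codes h)) (cong₂ _+_ (codes-length h) (codes-length s)))))))
      where
      two : 2 ≤ m * base
      two = ≤-trans (s≤s (s≤s z≤n)) (*-monoˡ-≤ base (0<width x))

    extraName-keyName : ∀ e k → extraName e ≢ keyName k
    extraName-keyName e k eq = <⇒≱ (short e) (≤-trans (≤-trans (m≤m+n 4 3) (s≤s (nameBits-length k)))
        (≤-reflexive (cong length (sym (trans (cong toBinary eq) (toBinary-fromBits (nameBits k)))))))
      where
      short : ∀ e → length (toBinary (extraName e)) < 4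
      short outE         = s≤s (s≤s z≤n)
      short quotientE    = s≤s (s≤s (s≤s z≤n))
      short numeratorE   = s≤s (s≤s (s≤s z≤n))
      short denominatorE = s≤s (s≤s (s≤s (s≤s z≤n)))
      short zeroE        = s≤s (s≤s z≤n)
      short twoE         = s≤s (s≤s (s≤s (s≤s z≤n)))

    keyName-injective : ∀ (k k′ : Key m) → keyName k ≡ keyName k′ → k ≡ k′
    keyName-injective k@(τ , h , s) k′@(τ′ , h′ , s′) eq =
      let bits = ∷-injectiveʳ (trans (sym (toBinary-fromBits (nameBits k)))
            (trans (cong toBinary eq) (toBinary-fromBits (nameBits k′))))
          (eτ , e₁) = codes-injective τ τ′ bits
          (eh , e₂) = codes-injective h h′ e₁
          (es , _)  = codes-injective s s′ {[]} {[]} (cong (_++ []) e₂)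
      in cong₂ _,_ eτ (cong₂ _,_ eh es)

    extraName-injective : ∀ e e′ → extraName e ≡ extraName e′ → e ≡ e′
    extraName-injective outE         outE         _ = refl
    extraName-injective zeroE        zeroE        _ = refl
    extraName-injective quotientE    quotientE    _ = refl
    extraName-injective numeratorE   numeratorE   _ = refl
    extraName-injective denominatorE denominatorE _ = refl
    extraName-injective twoE         twoE         _ = refl

    nodeName-injective : ∀ {a c} → nodeName a ≡ nodeName c → a ≡ c
    nodeName-injective {inj₁ e} {inj₁ e′} eq = cong inj₁ (extraName-injective e e′ eq)
    nodeName-injective {inj₁ e} {inj₂ k}  eq = ⊥-elim (extraName-keyName e k eq)
    nodeName-injective {inj₂ k} {inj₁ e}  eq = ⊥-elim (extraName-keyName e k (sym eq))
    nodeName-injective {inj₂ k} {inj₂ k′} eq = cong inj₂ (keyName-injective k k′ eq)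

    module F = FromList nodes complete unique nodeName nodeName-injective nodeGate level level-< sorted (inj₁ outE)

    nodes-descriptions : map F.describe nodes ≡ descriptions
    nodes-descriptions = trans (map-++ F.describe (map inj₁ extras) (map inj₂ grid))
      (cong (extraDescriptions ++_) (trans (sym (map-∘ grid)) (map-cong key grid)))
      where
      key : ∀ k → F.describe (inj₂ k) ≡ Graph.describe x k
      key (τ , h , s) with overflow τ
      ... | true  = refl
      ... | false = refl

    pathCount : ℕ → Key m → ℕ
    pathCount zero    (τ , h , s) = if accepts (firstDigit s) then 1 else 0
    pathCount (suc r) k           = pathCount r (nextKey false k) + pathCount r (nextKey true k)

    -- From the first to the last of `base ^ m` points of time there is one step fewer.
    horizon : ℕ
    horizon = pred (base ^ m)

    suc-horizon : suc horizon ≡ base ^ m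
    suc-horizon = suc-pred (base ^ m) {{m^n≢0 base m}}

    module _ (C : Circuit O) (gs : List (Fin (Circuit.size C))) (topological : Circuit.ReverseTopological C gs)
             (same : map (describeGate C) gs ≡ descriptions) where

      open Semantics nodes complete nodeName nodeName-injective nodeGate C gs
        (λ g → ∈-resp-↭ (↭-sym (proj₁ topological)) (∈-allFin g)) (trans same (sym nodes-descriptions))

      -- Induction on the number `r` of steps left on the clock; multiplying powers of 2 adds the
      -- path counts. It covers every string, whether or not it codes a configuration.
      denotes-key : ∀ r k → suc (val (proj₁ k) + r) ≡ base ^ m → Denotes (inj₂ k) (_≡ 2 ^ pathCount r k)
      denotes-key zero k@(τ , h , s) eq =
        denotes-input (inj₂ k) (trans (cong (λ c → if c then input (leafLabel (firstDigit s)) else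
                                product (inj₂ (nextKey false k)) (inj₂ (nextKey true k)))
          (overflow-last τ (trans (cong suc (sym (+-identityʳ _))) eq))) (cong input leaf))
        where
        leaf : leafLabel (firstDigit s) ≡ 2 ^ pathCount 0 k
        leaf with accepts (firstDigit s)
        ... | true  = refl
        ... | false = refl
      denotes-key (suc r) k@(τ , h , s) eq =
        subst (λ v → Denotes (inj₂ k) (_≡ v))
          (sym (^-distribˡ-+-* 2 (pathCount r (nextKey false k)) (pathCount r (nextKey true k))))
          (denotes-product (inj₂ k) (inj₂ (nextKey false k)) (inj₂ (nextKey true k))
            (cong (λ c → if c then input (leafLabel (firstDigit s)) else
                              product (inj₂ (nextKey false k)) (inj₂ (nextKey true k))) no-overflow)
            (denotes-key r (nextKey false k) later) (denotes-key r (nextKey true k) later))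
        where
        no-overflow : overflow τ ≡ false
        no-overflow = overflow-step τ (≤-trans
          (s≤s (≤-trans (≤-reflexive (+-comm 1 (val τ))) (+-monoʳ-≤ (val τ) (s≤s z≤n)))) (≤-reflexive eq))
        later : suc (val (move up τ) + r) ≡ base ^ m
        later = trans (cong (λ v → suc (v + r)) (no-overflow-val τ no-overflow))
          (trans (cong suc (sym (+-suc (val τ) r))) eq)

      private
        a = pathCount horizon (startKey m)
        d = pathCount horizon (starKey m)

        initial-time : suc (val (zeros m) + horizon) ≡ base ^ m
        initial-time = trans (cong (λ v → suc (v + horizon)) (val-zeros m)) suc-horizon

        denotes-numerator : Denotes (inj₁ numeratorE) (_≡ 2 ^ a * 2 ^ a)
        denotes-numerator = denotes-product (inj₁ numeratorE) (inj₂ (startKey m)) (inj₂ (startKey m)) refl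
          (denotes-key horizon (startKey m) initial-time) (denotes-key horizon (startKey m) initial-time)

        denotes-denominator : Denotes (inj₁ denominatorE) (_≡ 2 ^ d * 2)
        denotes-denominator = denotes-product (inj₁ denominatorE) (inj₂ (starKey m)) (inj₁ twoE) refl
          (denotes-key horizon (starKey m) initial-time) (denotes-input (inj₁ twoE) refl)

        denotes-out : Denotes (inj₁ outE) ((_≡ 0) ⊗ ((_≡ 2 ^ a * 2 ^ a) ⊘ (_≡ 2 ^ d * 2)))
        denotes-out = denotes-times (inj₁ outE) (inj₁ zeroE) (inj₁ quotientE) (denotes-input (inj₁ zeroE) refl)
          (denotes-divide (inj₁ quotientE) (inj₁ numeratorE)
            (inj₁ denominatorE) denotes-numerator denotes-denominator (s≤s (s≤s (s≤s z≤n))) refl) refl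

        -- The factor `c` cannot be zero because powers of 2 are positive, so `2 ^ f` is at most
        -- `2 ^ e`.
        power-divides : ∀ e f c → 2 ^ e ≡ c * 2 ^ f → f ≤ e
        power-divides e f c eq = ≮⇒≥ λ e<f → <⇒≱ (^-monoʳ-< 2 (s≤s (s≤s z≤n)) e<f) (divisor c eq)
          where
          divisor : ∀ c → 2 ^ e ≡ c * 2 ^ f → 2 ^ f ≤ 2 ^ e
          divisor zero    eq = ⊥-elim (<-irrefl (sym eq) (m^n>0 2 e))
          divisor (suc c) eq = ≤-trans (m≤m+n (2 ^ f) _) (≤-reflexive (sym eq))

      circuit-accepts : Circuit.name C (Circuit.output C) ≡ 0 → 0 ∈ Circuit.I[C] C ⇔ d < a + a
      circuit-accepts named = mk⇔ to from
        where
        open Circuit C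
        e = denotes-out output named (⟶-wellFounded output) 0
        to : 0 ∈ I[C] → d < a + a
        to p with ⇔.to e p
        ... | _ , c , refl , (_ , _ , refl , refl , _ , eq) , _ =
          power-divides (a + a) (suc d) c (trans (^-distribˡ-+-* 2 a a) (trans eq (cong (c *_) (*-comm (2 ^ d) 2))))
        from : d < a + a → 0 ∈ I[C]
        from lt = ⇔.from e (0 , 2 ^ (a + a ∸ suc d) , refl , (_ , _ , refl , refl , nonzero , equation) , refl)
          where
          nonzero : 2 ^ d * 2 ≢ 0
          nonzero eq = <-irrefl (sym (trans (*-comm 2 (2 ^ d)) eq)) (m^n>0 2 (suc d))
          equation : 2 ^ a * 2 ^ a ≡ 2 ^ (a + a ∸ suc d) * (2 ^ d * 2)
          equation = trans (sym (^-distribˡ-+-* 2 a a)) (trans (cong (2 ^_) (sym (m∸n+n≡m lt)))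
            (trans (^-distribˡ-+-* 2 (a + a ∸ suc d) (suc d)) (cong (2 ^ (a + a ∸ suc d) *_) (*-comm 2 (2 ^ d)))))

    reduction-correct : reduction x ∈ MC O ⇔
      pathCount horizon (starKey m) < pathCount horizon (startKey m) + pathCount horizon (startKey m)
    reduction-correct = mk⇔ to from
      where
      to : reduction x ∈ MC O → _
      to (C , gs , c , topological , eq , c∈)
        -- Unique readability: the witness of membership is an unknown circuit, but its output name,
        -- gate descriptions and queried number must be the intended ones.
        with header-unique 0 (Circuit.name C (Circuit.output C)) descriptions (map (describeGate C) gs) 0 c
               (word-injective (trans eq (encode-header C gs c)))
      ... | named , same , refl = ⇔.to (circuit-accepts C gs topological (sym same) (sym named)) c∈
      from : _ → reduction x ∈ MC O
      from lt = F.circuit , allFin (length nodes) , 0 , F.reverseTopological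
        , sym (trans (F.circuit-encode 0) (cong (λ ds → word (headerTokens 0 ds ++ number 0)) nodes-descriptions))
        , ⇔.from (circuit-accepts F.circuit (allFin (length nodes)) F.reverseTopological
                    (trans F.descriptions nodes-descriptions) (cong nodeName (F.lookup-of-index (inj₁ outE)))) lt

-- The probabilistic machine as a cellular automaton.

module Tapes {Γ : Set} (blank : Γ) where

  nth : List Γ → ℕ → Γ
  nth []      j       = blank
  nth (a ∷ l) zero    = a
  nth (a ∷ l) (suc j) = nth l j

  nth-beyond : ∀ l {j} → length l ≤ j → nth l j ≡ blank
  nth-beyond []      le       = refl
  nth-beyond (a ∷ l) (s≤s le) = nth-beyond l le

  Triple : Set
  Triple = Γ × Γ × Γ

  -- The two halves of the tape are stored side by side, the scanned symbol next to their first cells.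
  tripleAt : ℕ → Tape Γ → Triple
  tripleAt zero    (tape ls a rs) = a , nth ls 0 , nth rs 0
  tripleAt (suc j) (tape ls a rs) = blank , nth ls (suc j) , nth rs (suc j)

  -- A column recognises itself as column 0 by the absence of a left neighbour; only there is the
  -- scanned symbol stored.
  onTop : {A : Set} → Maybe A → Γ → Γ
  onTop nothing  a = a
  onTop (just _) a = blank

  -- The default `a` stands in for a missing neighbour: at column 0 it is the symbol pushed onto a
  -- half of the tape, at the far end a blank.
  previous : (Triple → Γ) → Γ → Maybe Triple → Γ
  previous f a nothing  = a
  previous f a (just t) = f t

  before after : Triple → Γ
  before (_ , l , _) = l
  after  (_ , _ , r) = r

  -- The halves of the tape are stacks with their tops in column 0. A move pops one and pushes the
  -- written symbol onto the other, so all contents shift by one column.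
  newTriple : Γ × Move → Maybe Triple → Triple → Maybe Triple → Triple
  newTriple (b , stay)  p (a , l , r) n = onTop p b , l , r
  newTriple (b , left)  p (a , l , r) n = onTop p l , previous before blank n , previous after b p
  newTriple (b , right) p (a , l , r) n = onTop p r , previous before b p , previous after blank n

  previousTriple : ℕ → Tape Γ → Maybe Triple
  previousTriple zero    t = nothing
  previousTriple (suc j) t = just (tripleAt j t)

  before-tripleAt : ∀ t j → before (tripleAt j t) ≡ nth (Tape.before t) j
  before-tripleAt (tape ls a rs) zero    = refl
  before-tripleAt (tape ls a rs) (suc j) = refl

  after-tripleAt : ∀ t j → after (tripleAt j t) ≡ nth (Tape.after t) j
  after-tripleAt (tape ls a rs) zero    = refl
  after-tripleAt (tape ls a rs) (suc j) = refl

  newTriple-tripleAt : ∀ j act t n →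
    previous before blank n ≡ nth (Tape.before t) (suc j) → previous after blank n ≡ nth (Tape.after t) (suc j) →
    newTriple act (previousTriple j t) (tripleAt j t) n ≡ tripleAt j (writeMove blank act t)
  newTriple-tripleAt zero    (b , stay)  (tape ls a rs)       n p q = refl
  newTriple-tripleAt (suc j) (b , stay)  (tape ls a rs)       n p q = refl
  newTriple-tripleAt zero    (b , left)  (tape [] a rs)       n p q = cong (λ c → blank , c , b) p
  newTriple-tripleAt zero    (b , left)  (tape (l ∷ ls) a rs) n p q = cong (λ c → l , c , b) p
  newTriple-tripleAt (suc j) (b , left)  t@(tape [] a rs)       n p q =
    cong₂ (λ c d → blank , c , d) p (after-tripleAt t j)
  newTriple-tripleAt (suc j) (b , left)  t@(tape (l ∷ ls) a rs) n p q =
    cong₂ (λ c d → blank , c , d) p (after-tripleAt t j)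
  newTriple-tripleAt zero    (b , right) (tape ls a [])       n p q = cong (λ c → blank , b , c) q
  newTriple-tripleAt zero    (b , right) (tape ls a (r ∷ rs)) n p q = cong (λ c → r , b , c) q
  newTriple-tripleAt (suc j) (b , right) t@(tape ls a [])       n p q =
    cong₂ (λ c d → blank , c , d) (before-tripleAt t j) q
  newTriple-tripleAt (suc j) (b , right) t@(tape ls a (r ∷ rs)) n p q =
    cong₂ (λ c d → blank , c , d) (before-tripleAt t j) q

-- The scanned marker alone tells when `moveInput` leaves the head in place, so the position need
-- not be compared with the input length.
clampDir : Move → InputSymbol → Dir
clampDir left  ⊢ = none
clampDir left  _ = down
clampDir stay  _ = none
clampDir right ⊣ = none
clampDir right _ = up

module Automaton (P : ProbabilisticMachine) where

  open ProbabilisticMachine P public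
  open Tapes blank public

  -- Column j of a configuration; the state is kept in column 0.  The columns (nothing , blanks) form
  -- an additional configuration that never moves and always accepts.
  Column : Set
  Column = Maybe State × Vec Triple tapes

  Column-finite : Finite Column
  Column-finite = ×-finite (Maybe-finite stateFinite) (Vec-finite (×-finite ΓFinite (×-finite ΓFinite ΓFinite)) tapes)

  blankColumn : Column
  blankColumn = nothing , Vec.replicate tapes (blank , blank , blank)

  stateAt : ℕ → State → Maybe State
  stateAt zero    q = just q
  stateAt (suc j) q = nothing

  column : Config → ℕ → Column
  column c j = stateAt j (state c) , Vec.map (tripleAt j) (work c)

  columnMove : Bool → Column → InputSymbol → Move
  columnMove coin (nothing , ts) i = stay
  columnMove coin (just q , ts)  i with halting q
  ... | true  = stay
  ... | false = proj₁ (proj₂ (δ q i (Vec.map proj₁ ts) coin))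

  stateOnTop : Maybe Column → State → Maybe State
  stateOnTop nothing  q = just q
  stateOnTop (just _) q = nothing

  newColumn : InputSymbol → Bool → Column → Maybe Column → Column → Maybe Column → Column
  newColumn i coin (nothing , _) p s n = blankColumn
  newColumn i coin (just q , ts) p s n with halting q
  ... | true  = s
  ... | false = let (q′ , _ , as , _) = δ q i (Vec.map proj₁ ts) coin in
    stateOnTop p q′ ,
    Vec.tabulate λ k → newTriple (Vec.lookup as k) (Maybe.map (λ c → Vec.lookup (proj₂ c) k) p) (Vec.lookup (proj₂ s) k)
                                 (Maybe.map (λ c → Vec.lookup (proj₂ c) k) n)

  columnAccepts : Column → Bool
  columnAccepts (nothing , _) = true
  columnAccepts (just q , _)  = halting q ∧ accepting q

  scanned : ∀ c → Vec.map proj₁ (proj₂ (column c 0)) ≡ Vec.map Tape.current (work c)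
  scanned c = sym (Vec.map-∘ proj₁ (tripleAt 0) (work c))

  Fits : ℕ → Config → Set
  Fits w c = ∀ k → length (Tape.before (Vec.lookup (work c) k)) ≤ w × length (Tape.after (Vec.lookup (work c) k)) ≤ w

  previousColumn : Config → ℕ → Maybe Column
  previousColumn c zero    = nothing
  previousColumn c (suc j) = just (column c j)

  -- The right neighbour may be missing only where half-tapes of length at most `w` have ended.
  data NextColumn (w : ℕ) (c : Config) (j : ℕ) : Maybe Column → Set where
    inside : NextColumn w c j (just (column c (suc j)))
    end    : w ≤ suc j → NextColumn w c j nothing

  -- That the configuration before the step fits guarantees that half-tape contents missing beyond
  -- the last column would be blank, which is the default of the rule.
  newColumn-column : ∀ x {w} c coin j {n} → Fits w c → NextColumn w c j n →
    newColumn (readInput x (head c)) coin (column c 0) (previousColumn c j) (column c j) n ≡ column (step x c coin) j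
  newColumn-column x {w} c coin j {n} fits next with halting (state c)
  ... | true  = refl
  ... | false rewrite scanned c = cong₂ _,_ (top j) (trans (tabulate-cong cell)
          (tabulate∘lookup (Vec.map (tripleAt j) (Vec.zipWith (writeMove blank) as (work c)))))
    where
    q′ = proj₁ (action x c coin)
    as = proj₁ (proj₂ (proj₂ (action x c coin)))

    top : ∀ j → stateOnTop (previousColumn c j) q′ ≡ stateAt j q′
    top zero    = refl
    top (suc j) = refl

    prev : ∀ k j → Maybe.map (λ s → Vec.lookup (proj₂ s) k) (previousColumn c j) ≡
      previousTriple j (Vec.lookup (work c) k)
    prev k zero    = refl
    prev k (suc j) = cong just (lookup-map k (tripleAt j) (work c))

    next-cell : ∀ k (f : Triple → Γ) l → length l ≤ w → (∀ j → f (tripleAt j (Vec.lookup (work c) k)) ≡ nth l j) →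
      ∀ {n} → NextColumn w c j n → previous f blank (Maybe.map (λ s → Vec.lookup (proj₂ s) k) n) ≡ nth l (suc j)
    next-cell k f l le eq inside  = trans (cong f (lookup-map k (tripleAt (suc j)) (work c))) (eq (suc j))
    next-cell k f l le eq (end w≤) = sym (nth-beyond l (≤-trans le w≤))

    cell : ∀ k → newTriple (Vec.lookup as k) (Maybe.map (λ s → Vec.lookup (proj₂ s) k) (previousColumn c j))
                   (Vec.lookup (Vec.map (tripleAt j) (work c)) k) (Maybe.map (λ s → Vec.lookup (proj₂ s) k) n) ≡
                 Vec.lookup (Vec.map (tripleAt j) (Vec.zipWith (writeMove blank) as (work c))) k
    cell k = trans (cong₂ (λ p s → newTriple (Vec.lookup as k) p s (Maybe.map (λ s → Vec.lookup (proj₂ s) k) n))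
                       (prev k j) (lookup-map k (tripleAt j) (work c)))
      (trans (newTriple-tripleAt j (Vec.lookup as k) t _
               (next-cell k before (Tape.before t) (proj₁ (fits k)) (before-tripleAt t) next)
               (next-cell k after (Tape.after t) (proj₂ (fits k)) (after-tripleAt t) next))
      (sym (trans (lookup-map k (tripleAt j) (Vec.zipWith (writeMove blank) as (work c)))
                  (cong (tripleAt j) (lookup-zipWith (writeMove blank) k as (work c))))))
      where t = Vec.lookup (work c) k

  step-head : ∀ x c coin → head (step x c coin) ≡
    moveInput x (columnMove coin (column c 0) (readInput x (head c))) (head c)
  step-head x c coin with halting (state c)
  ... | true  = refl
  ... | false rewrite scanned c = refl

  accCount : Word → Config → ℕ → ℕ
  accCount x c zero    = if halting (state c) ∧ accepting (state c) then 1 else 0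
  accCount x c (suc t) = accCount x (step x c false) t + accCount x (step x c true) t

  run-snoc : ∀ x coins coin → run x initial (coins ++ coin ∷ []) ≡ step x (run x initial coins) coin
  run-snoc x coins coin = foldl-++ (step x) initial coins (coin ∷ [])

  tapes-fit : ∀ {w} c → space c ≤ w → Fits w c
  tapes-fit c le k = let (p , q) = bounds (work c) k in ≤-trans p le , ≤-trans q le
    where
    bounds : ∀ {m} (ts : Vec (Tape Γ) m) k → let s = Vec.sum (Vec.map tapeSize ts) in
      length (Tape.before (Vec.lookup ts k)) ≤ s × length (Tape.after (Vec.lookup ts k)) ≤ s
    bounds (tape ls a rs ∷ ts) zero    = ≤-trans (m≤m+n (length ls) _) (m≤m+n _ _)
                                       , ≤-trans (≤-trans (n≤1+n _) (m≤n+m (suc (length rs)) (length ls))) (m≤m+n _ _)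
    bounds (t ∷ ts) (suc k) = let (p , q) = bounds ts k in
      ≤-trans p (m≤n+m _ (tapeSize t)) , ≤-trans q (m≤n+m _ (tapeSize t))

readInput-⊣ : ∀ x → readInput x (suc (length x)) ≡ ⊣
readInput-⊣ []      = refl
readInput-⊣ (c ∷ x) = readInput-⊣ x

clampDir-left : ∀ x i → clampDir left (readInput x (suc i)) ≡ down
clampDir-left []      i       = refl
clampDir-left (c ∷ x) zero    = refl
clampDir-left (c ∷ x) (suc i) = clampDir-left x i

clampDir-right : ∀ x i → i ≤ length x → clampDir right (readInput x i) ≡ up
clampDir-right x       zero          _        = refl
clampDir-right (c ∷ x) (suc zero)    _        = refl
clampDir-right (c ∷ x) (suc (suc i)) (s≤s le) = clampDir-right x (suc i) le
clampDir-right []      (suc i)       ()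

-- Configurations as strings of digits, and their path counts.

module Coding (P : ProbabilisticMachine) (b K : ℕ) (iso : Automaton.Column P ↔ Fin (suc (suc b))) where

  open Automaton P
  open Digits b

  enc : Column → Digit
  enc = Inverse.to iso

  dec : Digit → Column
  dec = Inverse.from iso

  dec-enc : ∀ c → dec (enc c) ≡ c
  dec-enc = Inverse.strictlyInverseʳ iso

  digitDir : Bool → Digit → InputSymbol → Dir
  digitDir coin d i = clampDir (columnMove coin (dec d) i) i

  newDigit : InputSymbol → Bool → Digit → Maybe Digit → Digit → Maybe Digit → Digit
  newDigit i coin s₀ p s n = enc (newColumn i coin (dec s₀) (Maybe.map dec p) (dec s) (Maybe.map dec n))

  digitAccepts : Digit → Bool
  digitAccepts d = columnAccepts (dec d)

  initDigit starDigit : Digit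
  initDigit = enc (column initial 0)
  starDigit = enc blankColumn

  rule : Rule b
  rule = record
    { dir = digitDir ; φ = newDigit ; accepts = digitAccepts ; init = initDigit ; star = starDigit }

  open Reduction b K rule public
  open Acceptance b K rule public

  columns : Config → ∀ m → ℕ → Vec Digit m
  columns c zero    j = []
  columns c (suc m) j = enc (column c j) ∷ columns c m (suc j)

  columns-initial : ∀ m j → columns initial m (suc j) ≡ Vec.replicate m starDigit
  columns-initial zero    j = refl
  columns-initial (suc m) j =
    cong₂ _∷_ (cong (λ ts → enc (nothing , ts)) (map-replicate (tripleAt (suc j)) _ tapes)) (columns-initial m (suc j))

  header-initial : ∀ m → header initDigit m ≡ columns initial m 0
  header-initial zero    = refl
  header-initial (suc m) = cong (initDigit ∷_) (sym (columns-initial m 0))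

  header-star : ∀ m → header starDigit m ≡ Vec.replicate m starDigit
  header-star zero    = refl
  header-star (suc m) = refl

  module _ (x : Word) where

    open Graph x

    private n = length x

    evolve-columns : ∀ {w} c coin m j → Fits w c → j + m ≡ w →
      evolve (readInput x (head c)) coin (enc (column c 0)) (Maybe.map enc (previousColumn c j)) (columns c m j) ≡
      columns (step x c coin) m j
    evolve-columns c coin zero    j fits eq = refl
    evolve-columns {w} c coin (suc m) j fits eq = cong₂ _∷_ (cong enc updated)
        (evolve-columns c coin m (suc j) fits (trans (sym (+-suc j m)) eq))
      where
      decode-previous : ∀ j → Maybe.map dec (Maybe.map enc (previousColumn c j)) ≡ previousColumn c j
      decode-previous zero    = refl
      decode-previous (suc j) = cong just (dec-enc (column c j))

      next : ∀ m → j + suc m ≡ w → NextColumn w c j (Maybe.map dec (nextDigit (columns c m (suc j))))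
      next zero    eq = end (≤-reflexive (trans (sym eq) (+-comm j 1)))
      next (suc m) eq = subst (NextColumn w c j) (cong just (sym (dec-enc (column c (suc j))))) inside

      follow : Maybe Column
      follow = Maybe.map dec (nextDigit (columns c m (suc j)))

      updated : newColumn (readInput x (head c)) coin (dec (enc (column c 0)))
               (Maybe.map dec (Maybe.map enc (previousColumn c j))) (dec (enc (column c j))) follow ≡
             column (step x c coin) j
      updated = trans (cong₂ (λ s p → newColumn (readInput x (head c)) coin s p (dec (enc (column c j))) follow)
                     (dec-enc (column c 0)) (decode-previous j))
             (trans (cong (λ s → newColumn (readInput x (head c)) coin (column c 0) (previousColumn c j) s follow)
               (dec-enc (column c j)))
                    (newColumn-column x c coin j fits (next m eq)))

    -- On the markers `clampDir` makes an outward move trivial. Elsewhere a left move cancels the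
    -- increment in `digits m (suc i)`, and a right move adds one.
    move-head : ∀ m μ i → i ≤ suc n → move (clampDir μ (readInput x i)) (digits m i) ≡ digits m (moveInput x μ i)
    move-head m left  zero    le = cong proj₂ (shift-none true (zeros m))
    move-head m left  (suc i) le rewrite clampDir-left x i = move-down-up (digits m i)
    move-head m stay  i       le = cong proj₂ (shift-none true (digits m i))
    move-head m right i       le with m≤n⇒m<n∨m≡n le
    ... | inj₁ (s≤s i≤n) rewrite clampDir-right x i i≤n = cong (digits m) (sym (m≤n⇒m⊓n≡m (s≤s i≤n)))
    ... | inj₂ refl rewrite readInput-⊣ x =
      trans (cong proj₂ (shift-none true (digits m (suc n)))) (cong (digits m) (sym (m≥n⇒m⊓n≡n (n≤1+n (suc n)))))

    moveInput-≤ : ∀ μ i → i ≤ suc n → moveInput x μ i ≤ suc n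
    moveInput-≤ left  i le = ≤-trans pred[n]≤n le
    moveInput-≤ stay  i le = le
    moveInput-≤ right i le = m⊓n≤n (suc i) (suc n)

    module _ (fits : ∀ coins → space (run x initial coins) ≤ width x) (head-fits : suc n < base ^ width x) where

      private m = width x

      -- The space bound is known for reachable configurations; together with the bound on the head
      -- it makes the strings code them faithfully.
      Reachable : Config → Set
      Reachable c = head c ≤ suc n × (∃[ coins ] c ≡ run x initial coins)

      reachable-step : ∀ c coin → Reachable c → Reachable (step x c coin)
      reachable-step c coin (le , coins , refl) =
        subst (_≤ suc n) (sym (step-head x c coin))
          (moveInput-≤ (columnMove coin (column c 0) (readInput x (head c))) (head c) le)
        , coins ++ coin ∷ [] , sym (run-snoc x coins coin)

      firstDigit-columns : ∀ c → firstDigit (columns c m 0) ≡ enc (column c 0)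
      firstDigit-columns c with m | Correctness.0<width b K rule x
      ... | suc _ | _ = refl

      nextKey-columns : ∀ τ c coin → Reachable c → nextKey coin (τ , digits m (head c) , columns c m 0) ≡
        (move up τ , digits m (head (step x c coin)) , columns (step x c coin) m 0)
      nextKey-columns τ c coin (le , coins , refl)
        rewrite firstDigit-columns c | val-digits m (≤-trans (s≤s le) head-fits) | m≤n⇒m⊓n≡m le =
        cong₂ (λ h s → move up τ , h , s)
          (trans (cong (λ s → move (clampDir (columnMove coin s (readInput x (head c))) (readInput x (head c)))
            (digits m (head c)))
                   (dec-enc (column c 0)))
          (trans (move-head m (columnMove coin (column c 0) (readInput x (head c))) (head c) le)
                 (cong (digits m) (sym (step-head x c coin)))))
          (evolve-columns c coin m 0 (tapes-fit c (fits coins)) refl)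

      pathCount-columns : ∀ r τ c → Reachable c → pathCount x r (τ , digits m (head c) , columns c m 0) ≡ accCount x c r
      pathCount-columns zero    τ c re = cong (λ d → if d then 1 else 0)
        (trans (cong digitAccepts (firstDigit-columns c)) (cong columnAccepts (dec-enc (column c 0))))
      pathCount-columns (suc r) τ c re
        rewrite nextKey-columns τ c false re | nextKey-columns τ c true re =
        cong₂ _+_ (pathCount-columns r (move up τ) (step x c false) (reachable-step c false re))
                  (pathCount-columns r (move up τ) (step x c true) (reachable-step c true re))

      pathCount-start : ∀ r → pathCount x r (startKey m) ≡ accCount x initial r
      pathCount-start r = trans (cong (λ s → pathCount x r (zeros m , zeros m , s)) (header-initial m))
        (pathCount-columns r (zeros m) initial (z≤n , [] , refl))

      evolve-star : ∀ i coin p k → evolve i coin starDigit p (Vec.replicate k starDigit) ≡ Vec.replicate k starDigit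
      evolve-star i coin p zero    = refl
      evolve-star i coin p (suc k) = cong₂ _∷_
        (cong (λ s → enc (newColumn i coin s (Maybe.map dec p) (dec starDigit)
          (Maybe.map dec (nextDigit (Vec.replicate k starDigit)))))
              (dec-enc blankColumn))
        (evolve-star i coin (just starDigit) k)

      firstDigit-star : firstDigit (Vec.replicate m starDigit) ≡ starDigit
      firstDigit-star with m | Correctness.0<width b K rule x
      ... | suc _ | _ = refl

      nextKey-star : ∀ τ coin → nextKey coin (τ , zeros m , Vec.replicate m starDigit) ≡
                     (move up τ , zeros m , Vec.replicate m starDigit)
      nextKey-star τ coin rewrite firstDigit-star = cong₂ (λ h s → move up τ , h , s)
        (trans (cong (λ s → move (clampDir (columnMove coin s (symbol (zeros m))) (symbol (zeros m))) (zeros m))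
          (dec-enc blankColumn))
               (cong proj₂ (shift-none true (zeros m))))
        (evolve-star (symbol (zeros m)) coin nothing m)

      -- Both successors are the blank configuration again, one tick later, so each step doubles the
      -- count.
      pathCount-blank : ∀ r τ → pathCount x r (τ , zeros m , Vec.replicate m starDigit) ≡ 2 ^ r
      pathCount-blank zero    τ = cong (λ d → if d then 1 else 0)
        (trans (cong digitAccepts firstDigit-star) (cong columnAccepts (dec-enc blankColumn)))
      pathCount-blank (suc r) τ rewrite nextKey-star τ false | nextKey-star τ true | pathCount-blank r (move up τ) =
        cong (2 ^ r +_) (sym (+-identityʳ (2 ^ r)))

      pathCount-star : ∀ r → pathCount x r (starKey m) ≡ 2 ^ r
      pathCount-star r = trans (cong (λ s → pathCount x r (zeros m , zeros m , s)) (header-star m))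
        (pathCount-blank r (zeros m))

-- Acceptance probabilities and numbers of accepting computations.

double : ℕ → ℚ → ℚ
double zero    p = p
double (suc t) p = double t (p ℚ.+ p)

-- Together with `double t`, which multiplies by `2 ^ t` through repeated addition, this clears
-- denominators using little more than sums and the order of the rationals.
natural : ℕ → ℚ
natural zero    = 0ℚ
natural (suc k) = 1ℚ ℚ.+ natural k

natural-+ : ∀ j k → natural (j + k) ≡ natural j ℚ.+ natural k
natural-+ zero    k = sym (ℚ.+-identityˡ (natural k))
natural-+ (suc j) k = trans (cong (1ℚ ℚ.+_) (natural-+ j k)) (sym (ℚ.+-assoc 1ℚ (natural j) (natural k)))

double-+ : ∀ t p q → double t (p ℚ.+ q) ≡ double t p ℚ.+ double t q
double-+ zero    p q = refl
double-+ (suc t) p q = trans (cong (double t) (interchange p q)) (double-+ t (p ℚ.+ p) (q ℚ.+ q))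
  where
  interchange : ∀ p q → (p ℚ.+ q) ℚ.+ (p ℚ.+ q) ≡ (p ℚ.+ p) ℚ.+ (q ℚ.+ q)
  interchange p q = trans (ℚ.+-assoc p q (p ℚ.+ q)) (trans (cong (p ℚ.+_)
    (trans (sym (ℚ.+-assoc q p q)) (trans (cong (ℚ._+ q) (ℚ.+-comm q p)) (ℚ.+-assoc p q q))))
    (sym (ℚ.+-assoc p p (q ℚ.+ q))))

double-½ : ∀ u → ½ ℚ.* u ℚ.+ ½ ℚ.* u ≡ u
double-½ u = trans (sym (ℚ.*-distribʳ-+ u ½ ½)) (ℚ.*-identityˡ u)

double-mono : ∀ t {p q} → p ℚ.< q → double t p ℚ.< double t q
double-mono zero    lt = lt
double-mono (suc t) lt = double-mono t (ℚ.+-mono-< lt lt)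

double-reflects : ∀ t {p q} → double t p ℚ.< double t q → p ℚ.< q
double-reflects t {p} {q} lt with ℚ.<-cmp p q
... | tri< p<q _ _ = p<q
... | tri≈ _ eq _  = ⊥-elim (ℚ.<-irrefl (cong (double t) eq) lt)
... | tri> _ _ q<p = ⊥-elim (ℚ.<-asym lt (double-mono t q<p))

natural-mono : ∀ {j k} → j < k → natural j ℚ.< natural k
natural-mono {zero}  {suc zero}    (s≤s _)  = ℚ.positive⁻¹ (1ℚ ℚ.+ 0ℚ)
natural-mono {zero}  {suc (suc k)} (s≤s _)  =
  subst (ℚ._< natural (suc (suc k))) (ℚ.+-identityˡ 0ℚ)
    (ℚ.+-mono-< (ℚ.positive⁻¹ 1ℚ) (natural-mono {0} {suc k} (s≤s z≤n)))
natural-mono {suc j} {suc k}       (s≤s lt) = ℚ.+-monoʳ-< 1ℚ (natural-mono lt)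

natural-reflects : ∀ {j k} → natural j ℚ.< natural k → j < k
natural-reflects {j} {k} lt with <-cmp j k
... | tri< j<k _ _ = j<k
... | tri≈ _ eq _  = ⊥-elim (ℚ.<-irrefl (cong natural eq) lt)
... | tri> _ _ k<j = ⊥-elim (ℚ.<-asym lt (natural-mono k<j))

double-1 : ∀ t → double t 1ℚ ≡ natural (2 ^ t)
double-1 zero    = refl
double-1 (suc t) = trans (double-+ t 1ℚ 1ℚ)
  (trans (cong₂ ℚ._+_ (double-1 t) (trans (double-1 t) (cong natural (sym (+-identityʳ (2 ^ t))))))
  (sym (natural-+ (2 ^ t) (2 ^ t + 0))))

module Majority (P : ProbabilisticMachine) (x : Word) where

  open Automaton P

  -- One doubling cancels the factor ½ of each coin.
  double-acceptProb : ∀ c t → double t (acceptProb x c t) ≡ natural (accCount x c t)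
  double-acceptProb c zero with halting (state c) ∧ accepting (state c)
  ... | true  = refl
  ... | false = refl
  double-acceptProb c (suc t) = begin
    double t (½ ℚ.* (p ℚ.+ q) ℚ.+ ½ ℚ.* (p ℚ.+ q)) ≡⟨ cong (double t) (double-½ (p ℚ.+ q)) ⟩
    double t (p ℚ.+ q)                             ≡⟨ double-+ t p q ⟩
    double t p ℚ.+ double t q                      ≡⟨ cong₂ ℚ._+_ (double-acceptProb (step x c false) t)
      (double-acceptProb (step x c true) t) ⟩
    natural m ℚ.+ natural n                        ≡⟨ sym (natural-+ m n) ⟩
    natural (m + n)                                ∎
    where
    open ≡-Reasoning
    p = acceptProb x (step x c false) t
    q = acceptProb x (step x c true) t
    m = accCount x (step x c false) t
    n = accCount x (step x c true) t

  majority : ∀ c t → acceptProb x c t ℚ.> ½ ⇔ 2 ^ t < accCount x c t + accCount x c t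
  majority c t = mk⇔
    -- The first of the `suc t` doublings turns the threshold ½ into `1ℚ` by computation, the others
    -- turn it into `2 ^ t`.
    (λ gt → natural-reflects (subst₂ ℚ._<_ (double-1 t) twice (double-mono (suc t) gt)))
    (λ lt → double-reflects (suc t) (subst₂ ℚ._<_ (sym (double-1 t)) (sym twice) (natural-mono lt)))
    where
    p = acceptProb x c t
    n = accCount x c t
    twice : double (suc t) p ≡ natural (n + n)
    twice = trans (double-+ t p p) (trans (cong₂ ℚ._+_ (double-acceptProb c t) (double-acceptProb c t))
      (sym (natural-+ n n)))

  halted-step : ∀ c coin → Halted c → step x c coin ≡ c
  halted-step c coin h with halting (state c)
  ... | true = refl

  halted-count : ∀ c d → Halted c → accCount x c d ≡ accCount x c 0 * 2 ^ d
  halted-count c zero    h = sym (*-identityʳ _)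
  halted-count c (suc d) h = trans
    (cong₂ (λ c₁ c₂ → accCount x c₁ d + accCount x c₂ d) (halted-step c false h) (halted-step c true h))
    (trans (cong₂ _+_ (halted-count c d h) (halted-count c d h))
    (trans (sym (*-distribˡ-+ (accCount x c 0) (2 ^ d) (2 ^ d)))
           (cong (λ z → accCount x c 0 * (2 ^ d + z)) (sym (+-identityʳ (2 ^ d))))))

  -- After `t` steps every computation has halted, so it merely splits into `2 ^ d` copies with the
  -- same verdict. This allows the clock to run past the time bound of the machine.
  count-extend : ∀ t c d → (∀ coins → length coins ≡ t → Halted (run x c coins)) →
                 accCount x c (t + d) ≡ accCount x c t * 2 ^ d
  count-extend zero    c d h = halted-count c d (h [] refl)
  count-extend (suc t) c d h = trans
    (cong₂ _+_ (count-extend t (step x c false) d (λ coins eq → h (false ∷ coins) (cong suc eq)))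
               (count-extend t (step x c true) d (λ coins eq → h (true ∷ coins) (cong suc eq))))
    (sym (*-distribʳ-+ (2 ^ d) (accCount x (step x c false) t) (accCount x (step x c true) t)))

  majority-extend : ∀ t c d → (∀ coins → length coins ≡ t → Halted (run x c coins)) →
    2 ^ t < accCount x c t + accCount x c t ⇔ 2 ^ (t + d) < accCount x c (t + d) + accCount x c (t + d)
  majority-extend t c d h = mk⇔
    (λ lt → subst₂ _<_ (sym (^-distribˡ-+-* 2 t d)) (sym scaled) (*-monoˡ-< (2 ^ d) {{m^n≢0 2 d}} lt))
    (λ lt → *-cancelʳ-< (2 ^ d) (2 ^ t) (n + n) (subst₂ _<_ (^-distribˡ-+-* 2 t d) scaled lt))
    where
    n = accCount x c t
    scaled : accCount x c (t + d) + accCount x c (t + d) ≡ (n + n) * 2 ^ d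
    scaled = trans (cong₂ _+_ (count-extend t c d h) (count-extend t c d h)) (sym (*-distribʳ-+ (2 ^ d) n n))

-- The constants of the reduction, and the conclusion.

two-elements : ∀ {A : Set} {a b : A} → a ≢ b → Finite A → ∃[ n ] (A ↔ Fin (suc (suc n)))
two-elements {a = a} {b} a≢b (zero , f) with () ← Inverse.to f a
two-elements {a = a} {b} a≢b (suc zero , f) = ⊥-elim (a≢b (trans (sym (Inverse.strictlyInverseʳ f a))
  (trans (cong (Inverse.from f) (equal (Inverse.to f a) (Inverse.to f b))) (Inverse.strictlyInverseʳ f b))))
  where
  equal : (i j : Fin 1) → i ≡ j
  equal zero zero = refl
two-elements a≢b (suc (suc n) , f) = n , f

n<2^n : ∀ n → n < 2 ^ n
n<2^n zero    = s≤s z≤n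
n<2^n (suc n) = ≤-trans (s≤s (n<2^n n)) (≤-trans (≤-reflexive (+-comm 1 (2 ^ n)))
  (+-monoʳ-≤ (2 ^ n) (≤-trans (m^n>0 2 n) (≤-reflexive (sym (+-identityʳ (2 ^ n)))))))

module Hardness (L : Language) (pl : PL L) where

  open PL pl

  private
    space-constant : ℕ
    space-constant = proj₁ logSpace

    c = space-constant

    -- A column with a state differs from one without, so the base is at least 2 and the clock range
    -- is exponential in the width.
    coding = two-elements {a = nothing-column} {just-column} (λ ()) (Automaton.Column-finite M)
      where
      nothing-column just-column : Automaton.Column M
      nothing-column = Automaton.blankColumn M
      just-column    = just start , proj₂ nothing-column

    -- Large enough for the configurations and the clock to fit into the cells.
    padding : ℕ
    padding = degree + (suc coeff + (c + c))

  open Coding M (proj₁ coding) padding (proj₂ coding)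
  open Automaton M using (accCount)

  module _ (x : Word) where

    open Graph x using (startKey; starKey)

    private
      n = length x
      ℓ = bitLength n
      -- Since `n < B` and `2 ≤ B`, a bound polynomial in the input length becomes a power of `B`
      -- whose exponent does not depend on the input.
      B = 2 ^ ℓ
      N = Digits.base (proj₁ coding)
      m = width x

      width≡ : m ≡ ℓ * suc padding
      width≡ = Correctness.expand-length (proj₁ coding) padding rule (binaryLSB n)

      n<B : suc n ≤ B
      n<B = n<2^bitLength n

      2≤B : 2 ≤ B
      2≤B = ^-monoʳ-≤ 2 (bitLength>0 n)

      1≤B : ∀ k → 1 ≤ B ^ k
      1≤B k = m^n>0 B {{m^n≢0 2 ℓ}} k

      -- The row has `suc padding` cells for each of the `ℓ` counter bits, and each cell holds a
      -- digit in base at least 2.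
      B^-bound : B ^ suc padding ≤ N ^ m
      B^-bound = ≤-trans (≤-reflexive (trans (^-*-assoc 2 ℓ (suc padding)) (cong (2 ^_) (sym width≡))))
        (^-monoˡ-≤ m (s≤s (s≤s z≤n)))

      -- The factor `coeff + coeff` is absorbed by `2 ^ suc coeff`, hence by `B ^ suc coeff`; this
      -- accounts for the summands `degree` and `suc coeff` of `padding`.
      time-bound : time n < N ^ m
      time-bound = ≤-trans time<B^ (≤-trans (^-monoʳ-≤ B {{m^n≢0 2 ℓ}}
          (≤-trans (+-monoʳ-≤ degree (m≤m+n (suc coeff) (c + c))) (n≤1+n padding))) B^-bound)
        where
        open ≤-Reasoning
        time<B^ : time n < B ^ (degree + suc coeff)
        time<B^ = begin-strict
          coeff * n ^ degree + coeff
            ≤⟨ +-mono-≤ (*-monoʳ-≤ coeff (^-monoˡ-≤ degree (<⇒≤ n<B)))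
                        (≤-trans (≤-reflexive (sym (*-identityʳ coeff))) (*-monoʳ-≤ coeff (1≤B degree))) ⟩
          coeff * B ^ degree + coeff * B ^ degree
            ≡⟨ sym (*-distribʳ-+ (B ^ degree) coeff coeff) ⟩
          (coeff + coeff) * B ^ degree
            <⟨ *-monoˡ-< (B ^ degree) {{m^n≢0 B degree {{m^n≢0 2 ℓ}}}} (+-mono-< (n<2^n coeff) (n<2^n coeff)) ⟩
          (2 ^ coeff + 2 ^ coeff) * B ^ degree
            ≡⟨ cong (λ z → (2 ^ coeff + z) * B ^ degree) (sym (+-identityʳ (2 ^ coeff))) ⟩
          2 ^ suc coeff * B ^ degree
            ≤⟨ *-monoˡ-≤ (B ^ degree) (^-monoˡ-≤ (suc coeff) 2≤B) ⟩
          B ^ suc coeff * B ^ degree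
            ≡⟨ trans (*-comm (B ^ suc coeff) (B ^ degree)) (sym (^-distribˡ-+-* B degree (suc coeff))) ⟩
          B ^ (degree + suc coeff) ∎

      -- Two factors `B` suffice for all head positions, and `suc padding` is at least 2 because
      -- `padding` contains `suc coeff`.
      head-bound : suc n < N ^ m
      head-bound = ≤-trans (≤-trans two
        (^-monoʳ-≤ B {{m^n≢0 2 ℓ}} {2} (s≤s (≤-trans (s≤s z≤n) (m≤n+m (suc coeff + (c + c)) degree))))) B^-bound
        where
        open ≤-Reasoning
        two : suc (suc n) ≤ B ^ 2
        two = begin
          suc (suc n)   ≤⟨ s≤s n<B ⟩
          1 + B         ≤⟨ +-monoˡ-≤ B (≤-trans (s≤s z≤n) 2≤B) ⟩
          B + B         ≡⟨ cong (B +_) (sym (+-identityʳ B)) ⟩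
          2 * B         ≤⟨ *-monoˡ-≤ B 2≤B ⟩
          B * B         ≡⟨ cong (B *_) (sym (*-identityʳ B)) ⟩
          B ^ 2         ∎

      -- As `ℓ` is positive, the additive constant is absorbed by a second `c * ℓ`; this accounts
      -- for the summand `c + c` of `padding`.
      space-bound : ∀ coins → space (run x initial coins) ≤ m
      space-bound coins = begin
        space (run x initial coins)  ≤⟨ proj₂ logSpace x coins ⟩
        c * ⌊log₂ n ⌋ + c            ≤⟨ +-mono-≤ (*-monoʳ-≤ c (log₂≤bitLength n))
                                          (≤-trans (≤-reflexive (sym (*-identityʳ c))) (*-monoʳ-≤ c (bitLength>0 n))) ⟩
        c * ℓ + c * ℓ                ≡⟨ trans (sym (*-distribʳ-+ ℓ c c)) (*-comm (c + c) ℓ) ⟩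
        ℓ * (c + c)                  ≤⟨ *-monoʳ-≤ ℓ (≤-trans (m≤n+m (c + c) (suc coeff))
                                          (≤-trans (m≤n+m _ degree) (n≤1+n padding))) ⟩
        ℓ * suc padding              ≡⟨ sym width≡ ⟩
        m                            ∎
        where open ≤-Reasoning

      time≤horizon : time n ≤ horizon x
      time≤horizon = ≤-pred (≤-trans time-bound (≤-reflexive (sym (suc-horizon x))))

      extended : time n + (horizon x ∸ time n) ≡ horizon x
      extended = m+[n∸m]≡n time≤horizon

    -- Stated for a variable `t` because the extended running time, a sum, equals `horizon x` only
    -- propositionally.
    pathCounts : ∀ t → t ≡ horizon x →
      2 ^ t < accCount x initial t + accCount x initial t ⇔
      pathCount x (horizon x) (starKey m) < pathCount x (horizon x) (startKey m) + pathCount x (horizon x) (startKey m)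
    pathCounts t eq = mk⇔ (subst₂ _<_ (sym stars) (sym (cong₂ _+_ starts starts)))
      (subst₂ _<_ stars (cong₂ _+_ starts starts))
      where
      stars : pathCount x (horizon x) (starKey m) ≡ 2 ^ t
      stars = trans (pathCount-star x space-bound head-bound (horizon x)) (cong (2 ^_) (sym eq))
      starts : pathCount x (horizon x) (startKey m) ≡ accCount x initial t
      starts = trans (pathCount-start x space-bound head-bound (horizon x)) (cong (accCount x initial) (sym eq))

    acceptance : x ∈ L ⇔
      pathCount x (horizon x) (starKey m) < pathCount x (horizon x) (startKey m) + pathCount x (horizon x) (startKey m)
    acceptance = pathCounts (time n + (horizon x ∸ time n)) extended ⇔-∘
      (Majority.majority-extend M x (time n) initial (horizon x ∸ time n) (polyTime x) ⇔-∘
      (Majority.majority M x initial (time n) ⇔-∘ correct x))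

    correctness : x ∈ L ⇔ reduction x ∈ MC (｛ binary times ｝ ∪ ｛ binary divide ｝)
    correctness = ⇔-sym (reduction-correct x) ⇔-∘ acceptance

  hardness : L ≤ₘˡᵒᵍ MC (｛ binary times ｝ ∪ ｛ binary divide ｝)
  hardness = reduction
    , Correctness.reduction-logSpace (proj₁ coding) padding rule
    , correctness

theorem9 : PLHard (MC (｛ binary times ｝ ∪ ｛ binary divide ｝))
theorem9 L pl = Hardness.hardness L pl
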